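{- With the notation of the context, $$T^{\oplus}=T'\exp(-T_{\mathrm{not}\oplus}),\qquad T^{\ominus}_{\mathrm{not}\oplus}=\frac{T^{\oplus}}{\exp(T_{\mathrm{not}\oplus})},\qquad T^{\oplus}_{\mathrm{not}\oplus}=\frac{T^{\oplus}-1}{\exp(T_{\mathrm{not}\oplus})}.$$
   Context: $\mathcal P$ is a set of prime labeled graphs (at least 3 vertices, only trivial modules) stable under relabeling. $\mathcal T_{\mathcal P}$ is the set of modular decomposition trees (rooted non-plane trees with leaves labeled bijectively by $\{1,\dots,n\}$, internal nodes decorated by $\oplus$ or $\ominus$ with at least 2 children, or by a prime graph $H\in\mathcal P$ with $|H|$ children ordered by minimal leaf label, no $\oplus$-node having a $\oplus$-child and no $\ominus$-node a $\ominus$-child). $T$, $T_{\mathrm{not}\oplus}$ are the exponential generating functions by number of leaves of $\mathcal T_{\mathcal P}$ and of its trees whose root is not $\oplus$. Blossoming of $t\in\mathcal T_{\mathcal P}$ at a leaf $\ell$: for each prime-decorated node on the path from the root to $\ell$, the vertex of its decoration corresponding to the subtree containing $\ell$ is relabeled $*$ and the other labels reduced preserving order; then $\ell$ is relabeled $*$ (the blossom) and the remaining leaf labels reduced. A blossomed tree is a tree so obtained; its size is its number of non-blossom leaves. A blossom is $\oplus$-replaceable (resp. $\ominus$-replaceable) if its parent is not decorated $\oplus$ (resp. $\ominus$) (in particular if the blossom is the whole tree). $T^{\oplus}$ is the exponential generating function of blossomed trees with $\oplus$-replaceable blossom; $T^{\ominus}_{\mathrm{not}\oplus}$ that of blossomed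 trees whose root is not $\oplus$ and whose blossom is $\ominus$-replaceable; $T^{\oplus}_{\mathrm{not}\oplus}$ that of blossomed trees whose root is not $\oplus$ and whose blossom is $\oplus$-replaceable, with the convention that the tree reduced to a single blossom is excluded (so $T^{\oplus}_{\mathrm{not}\oplus}(0)=0$), while it is included in the other two series (constant term $1$). -}

module Defs where

open import Data.Bool using (Bool; true; false; if_then_else_)
open import Data.Nat using (ℕ; zero; suc; _≤_; _<_; _∸_; _<ᵇ_; _≡ᵇ_; _⊓_)
open import Data.Nat.Properties using (_!≢0)
open import Data.Nat.Combinatorics using ()
import Data.Nat as ℕ
open import Data.Integer using (+_)
open import Data.Rational using (ℚ; 0ℚ; 1ℚ; _/_) renaming (_+_ to _+ℚ_; _*_ to _*ℚ_; -_ to -ℚ_)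
import Data.Rational as ℚ
open import Data.Fin using (Fin; zero; suc; punchIn)
open import Data.Fin.Subset using (Subset; _∈_; _∉_; ⁅_⁆) renaming (⊥ to ∅; ⊤ to full)
open import Data.Fin.Permutation using (Permutation′; _⟨$⟩ˡ_)
open import Data.Vec using (Vec; []; _∷_; lookup; tabulate; toList)
open import Data.List using (List; []; _∷_; length; map; upTo; foldr; sum)
open import Data.List.Relation.Unary.Linked using (Linked)
open import Data.List.Relation.Unary.Unique.Propositional using (Unique)
open import Data.List.Relation.Binary.Permutation.Propositional using (_↭_)
import Data.List.Membership.Propositional as LM
open import Data.Maybe using (Maybe; just; nothing)
open import Data.Product using (Σ; _×_; _,_; ∃)
open import Data.Sum using (_⊎_)
open import Data.Unit using (⊤)
open import Data.Empty using (⊥)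
open import Relation.Nullary using (¬_)
open import Relation.Binary.PropositionalEquality using (_≡_; _≢_)
open import Function.Bundles using (_⇔_)

-- Labelled graphs on the vertex set Fin k (= {1,…,k}, shifted to 0-based)

Graph : ℕ → Set
Graph k = Vec (Vec Bool k) k

adj : ∀ {k} → Graph k → Fin k → Fin k → Bool
adj H i j = lookup (lookup H i) j

IsSimple : ∀ {k} → Graph k → Set
IsSimple H = (∀ i → adj H i i ≡ false) × (∀ i j → adj H i j ≡ adj H j i)

IsModule : ∀ {k} → Graph k → Subset k → Set
IsModule H M = ∀ x → x ∉ M → ∀ u v → u ∈ M → v ∈ M → adj H x u ≡ adj H x v

TrivialSubset : ∀ {k} → Subset k → Set
TrivialSubset M = (M ≡ ∅) ⊎ (∃ λ i → M ≡ ⁅ i ⁆) ⊎ (M ≡ full)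

IsPrime : (k : ℕ) → Graph k → Set
IsPrime k H = (3 ≤ k) × IsSimple H × (∀ M → IsModule H M → TrivialSubset M)

relabel : ∀ {k} → Permutation′ k → Graph k → Graph k
relabel σ H = tabulate λ i → tabulate λ j → adj H (σ ⟨$⟩ˡ i) (σ ⟨$⟩ˡ j)

IsPrimeFamily : ((k : ℕ) → Graph k → Set) → Set
IsPrimeFamily P = (∀ k H → P k H → IsPrime k H)
                × (∀ k (H : Graph k) (σ : Permutation′ k) → P k H → P k (relabel σ H))

-- Raw (possibly blossomed) decomposition trees.
-- Leaves carry labels in ℕ (label i stands for i+1); 'blossom' is the leaf *.
-- A prime node with decoration H on k vertices has its k children in a
-- vector: child number i is the subtree attached to vertex i of H.

data Tree : Set where
  leaf    : ℕ → Tree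
  blossom : Tree
  node⊕   : List Tree → Tree
  node⊖   : List Tree → Tree
  nodeP   : (k : ℕ) → Graph k → Vec Tree k → Tree

mutual
  leaves : Tree → List ℕ
  leaves (leaf i) = i ∷ []
  leaves blossom = []
  leaves (node⊕ ts) = leavesL ts
  leaves (node⊖ ts) = leavesL ts
  leaves (nodeP k H ts) = leavesV ts

  leavesL : List Tree → List ℕ
  leavesL [] = []
  leavesL (t ∷ ts) = leaves t Data.List.++ leavesL ts

  leavesV : ∀ {k} → Vec Tree k → List ℕ
  leavesV [] = []
  leavesV (t ∷ ts) = leaves t Data.List.++ leavesV ts

minList : List ℕ → ℕ
minList [] = 0
minList (x ∷ []) = x
minList (x ∷ y ∷ xs) = x ⊓ minList (y ∷ xs)

minLeaf : Tree → ℕ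
minLeaf t = minList (leaves t)

SortedByMin : List Tree → Set
SortedByMin ts = Linked _<_ (map minLeaf ts)

RootNot⊕ : Tree → Set
RootNot⊕ (node⊕ _) = ⊥
RootNot⊕ _ = ⊤

RootNot⊖ : Tree → Set
RootNot⊖ (node⊖ _) = ⊥
RootNot⊖ _ = ⊤

module _ (P : (k : ℕ) → Graph k → Set) where
  mutual
    WF : Tree → Set
    WF (leaf i) = ⊤
    WF blossom = ⊥
    WF (node⊕ ts) = (2 ≤ length ts) × SortedByMin ts × AllNot⊕ ts
    WF (node⊖ ts) = (2 ≤ length ts) × SortedByMin ts × AllNot⊖ ts
    WF (nodeP k H ts) = P k H × SortedByMin (toList ts) × WFV ts

    AllNot⊕ : List Tree → Set
    AllNot⊕ [] = ⊤
    AllNot⊕ (t ∷ ts) = WF t × RootNot⊕ t × AllNot⊕ ts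

    AllNot⊖ : List Tree → Set
    AllNot⊖ [] = ⊤
    AllNot⊖ (t ∷ ts) = WF t × RootNot⊖ t × AllNot⊖ ts

    WFV : ∀ {k} → Vec Tree k → Set
    WFV [] = ⊤
    WFV (t ∷ ts) = WF t × WFV ts

  IsTree : ℕ → Tree → Set
  IsTree n t = WF t × (leaves t ↭ upTo n)

mutual
  hasBlossom : Tree → Bool
  hasBlossom (leaf _) = false
  hasBlossom blossom = true
  hasBlossom (node⊕ ts) = hasBlossomL ts
  hasBlossom (node⊖ ts) = hasBlossomL ts
  hasBlossom (nodeP k H ts) = hasBlossomV ts

  hasBlossomL : List Tree → Bool
  hasBlossomL [] = false
  hasBlossomL (t ∷ ts) = if hasBlossom t then true else hasBlossomL ts

  hasBlossomV : ∀ {k} → Vec Tree k → Bool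
  hasBlossomV [] = false
  hasBlossomV (t ∷ ts) = if hasBlossom t then true else hasBlossomV ts

frontL : List Tree → List Tree
frontL ts = go ts []
  where
  rev++ : List Tree → List Tree → List Tree
  rev++ [] acc = acc
  rev++ (x ∷ xs) acc = rev++ xs (x ∷ acc)
  go : List Tree → List Tree → List Tree
  go [] acc = rev++ acc []
  go (t ∷ ts) acc = if hasBlossom t then t ∷ rev++ acc ts else go ts (t ∷ acc)

findBlossomV : ∀ {k} → Vec Tree k → Maybe (Fin k)
findBlossomV [] = nothing
findBlossomV (t ∷ ts) = if hasBlossom t then just zero else Data.Maybe.map suc (findBlossomV ts)

frontPerm : ∀ {k} → Fin (suc k) → Fin (suc k) → Fin (suc k)
frontPerm i zero = i
frontPerm i (suc j) = punchIn i j

-- prime node whose child at vertex i contains the blossom: vertex i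
-- becomes the vertex * (put in first position), the other vertices are
-- relabelled order-preservingly
frontP : (k : ℕ) → Graph k → Vec Tree k → Tree
frontP zero H ts = nodeP zero H ts
frontP (suc k) H ts with findBlossomV ts
... | nothing = nodeP (suc k) H ts
... | just i = nodeP (suc k)
                 (tabulate λ a → tabulate λ b → adj H (frontPerm i a) (frontPerm i b))
                 (tabulate λ a → lookup ts (frontPerm i a))

mutual
  blossomAt : ℕ → Tree → Tree
  blossomAt m (leaf j) = if j ≡ᵇ m then blossom else (if m <ᵇ j then leaf (j ∸ 1) else leaf j)
  blossomAt m blossom = blossom
  blossomAt m (node⊕ ts) = node⊕ (frontL (blossomAtL m ts))
  blossomAt m (node⊖ ts) = node⊖ (frontL (blossomAtL m ts))
  blossomAt m (nodeP k H ts) = frontP k H (blossomAtV m ts)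

  blossomAtL : ℕ → List Tree → List Tree
  blossomAtL m [] = []
  blossomAtL m (t ∷ ts) = blossomAt m t ∷ blossomAtL m ts

  blossomAtV : ∀ {k} → ℕ → Vec Tree k → Vec Tree k
  blossomAtV m [] = []
  blossomAtV m (t ∷ ts) = blossomAt m t ∷ blossomAtV m ts

Blossomed : ((k : ℕ) → Graph k → Set) → ℕ → Tree → Set
Blossomed P n t = Σ Tree λ t₀ → Σ ℕ λ m → IsTree P (suc n) t₀ × m < suc n × blossomAt m t₀ ≡ t

data ParentKind : Set where
  isRoot par⊕ par⊖ parP none : ParentKind

isBlossom : Tree → Bool
isBlossom blossom = true
isBlossom _ = false

mutual
  parentKind : Tree → ParentKind
  parentKind (leaf _) = none
  parentKind blossom = isRoot
  parentKind (node⊕ ts) = if hasBlossomAsChildL ts then par⊕ else parentKindL ts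
  parentKind (node⊖ ts) = if hasBlossomAsChildL ts then par⊖ else parentKindL ts
  parentKind (nodeP k H ts) = if hasBlossomAsChildV ts then parP else parentKindV ts

  parentKindL : List Tree → ParentKind
  parentKindL [] = none
  parentKindL (t ∷ ts) = if hasBlossom t then parentKind t else parentKindL ts

  parentKindV : ∀ {k} → Vec Tree k → ParentKind
  parentKindV [] = none
  parentKindV (t ∷ ts) = if hasBlossom t then parentKind t else parentKindV ts

  hasBlossomAsChildL : List Tree → Bool
  hasBlossomAsChildL [] = false
  hasBlossomAsChildL (t ∷ ts) = if isBlossom t then true else hasBlossomAsChildL ts

  hasBlossomAsChildV : ∀ {k} → Vec Tree k → Bool
  hasBlossomAsChildV [] = false
  hasBlossomAsChildV (t ∷ ts) = if isBlossom t then true else hasBlossomAsChildV ts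

⊕-replaceable : Tree → Set
⊕-replaceable t = ¬ (parentKind t ≡ par⊕)

⊖-replaceable : Tree → Set
⊖-replaceable t = ¬ (parentKind t ≡ par⊖)

module Classes (P : (k : ℕ) → Graph k → Set) where
  ClT : ℕ → Tree → Set
  ClT n t = IsTree P n t
  ClTnot⊕ : ℕ → Tree → Set
  ClTnot⊕ n t = IsTree P n t × RootNot⊕ t
  ClT⊕ : ℕ → Tree → Set
  ClT⊕ n t = Blossomed P n t × ⊕-replaceable t
  ClT⊖not⊕ : ℕ → Tree → Set
  ClT⊖not⊕ n t = Blossomed P n t × RootNot⊕ t × ⊖-replaceable t
  ClT⊕not⊕ : ℕ → Tree → Set
  ClT⊕not⊕ n t = Blossomed P n t × RootNot⊕ t × ⊕-replaceable t × t ≢ blossom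

HasCount : (Tree → Set) → ℕ → Set
HasCount A c = Σ (List Tree) λ L → (length L ≡ c) × Unique L × (∀ t → (t LM.∈ L) ⇔ A t)

Series : Set
Series = ℕ → ℚ

egf : (ℕ → ℕ) → Series
egf c n = (+ c n) / (n Data.Nat.!)
  where instance _ = n !≢0

oneₛ : Series
oneₛ zero = 1ℚ
oneₛ (suc _) = 0ℚ

_+ₛ_ : Series → Series → Series
(a +ₛ b) n = a n +ℚ b n

-ₛ_ : Series → Series
(-ₛ a) n = -ℚ (a n)

_-ₛ_ : Series → Series → Series
a -ₛ b = a +ₛ (-ₛ b)

sumℚ : List ℚ → ℚ
sumℚ = foldr _+ℚ_ 0ℚ

_*ₛ_ : Series → Series → Series
(a *ₛ b) n = sumℚ (map (λ k → a k *ℚ b (n ∸ k)) (upTo (suc n)))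

deriv : Series → Series
deriv a n = ((+ suc n) / 1) *ℚ a (suc n)

powₛ : Series → ℕ → Series
powₛ a zero = oneₛ
powₛ a (suc j) = a *ₛ powₛ a j

-- exp(a) = Σ_j a^j / j!  (for a with zero constant term, only j ≤ n
-- contributes to the coefficient of x^n)
expₛ : Series → Series
expₛ a n = sumℚ (map (λ j → invFact j *ℚ powₛ a j n) (upTo (suc n)))
  where
  invFact : ℕ → ℚ
  invFact j = (+ 1) / (j Data.Nat.!)
    where instance _ = j !≢0

{-# OPTIONS --safe #-}

-- A blossomed tree is the word of the nodes met on the path from its root to its blossom, in which no two ⊕ and no
-- two ⊖ are consecutive. The subtrees hanging off a ⊕ (or ⊖) of the word form a nonempty set of trees with another
-- root decoration, which is the same thing as one arbitrary tree. Blossoming at the largest label is bijective, so T′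
-- counts all words and T_not⊕′ those not starting with ⊕. Detaching a leading ⊕ gives T′ = T_not⊕′ (1 + T), hence
-- 1 + T = exp(T_not⊕). Reversal of words shows T^⊕ = T_not⊕′, which is the first formula. Exchanging ⊕ and ⊖ along
-- the path, T^⊕ also counts the words not ending with ⊖, and detaching a leading ⊕ gives T^⊕ = T^⊖_not⊕ (1 + T);
-- for nonempty words not ending with ⊕ it gives T^⊕ - 1 = T^⊕_not⊕ (1 + T).

module Submission where

open import Defs
open import Data.Bool using (Bool; true; false; if_then_else_; not)
open import Data.Empty using (⊥; ⊥-elim)
open import Data.Fin using (Fin; zero; suc; toℕ; punchIn; punchOut; _≟_)
open import Data.Fin.Permutation using (Permutation′; permutation; _⟨$⟩ˡ_; _⟨$⟩ʳ_; flip; inverseˡ)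
open import Data.Fin.Properties using (punchIn-punchOut; punchInᵢ≢i; punchOut-punchIn; punchOut-cong)
open import Data.Integer as ℤ using (+_)
import Data.Integer.Properties as ℤₚ
open import Data.Integer.Solver renaming (module +-*-Solver to ℤ-Solver)
open import Data.List as List using (List; []; _∷_; _++_; _∷ʳ_; _ʳ++_; length; map; upTo; cartesianProduct; head; last; reverse)
open import Data.List.Membership.Propositional using (_∈_; _∉_)
open import Data.List.Membership.Propositional.Properties
open import Data.List.Membership.Propositional.Properties.WithK using (unique∧set⇒bag)
open import Data.List.Properties as Listₚ
  using (length-++; length-map; map-++; map-∘; map-applyUpTo; map-cong; map-cong-local; map-id; map-id-local; map-upTo;
         ++-assoc; ++-conicalʳ; ++-identityʳ; last-map; reverse-injective; reverse-involutive; reverse-map; unfold-reverse)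
open import Data.List.Relation.Binary.BagAndSetEquality using (∼bag⇒↭)
open import Data.List.Relation.Binary.Permutation.Propositional as ↭
  using (_↭_; ↭-refl; ↭-sym; ↭-prep; ↭-swap; ↭-trans; ↭-reflexive; ↭⇒↭ₛ; module PermutationReasoning)
open import Data.List.Relation.Binary.Permutation.Propositional.Properties
  using (↭-length; ↭-empty-inv; ↭-reverse; ∈-resp-↭; All-resp-↭; ++⁺; ++⁺ˡ; ++⁺ʳ; ++-comm; shift; shifts; drop-∷)
  renaming (map⁺ to ↭-map⁺)
import Data.List.Relation.Binary.Permutation.Setoid.Properties as SetoidPerm
open import Data.List.Relation.Unary.All as All using (All; []; _∷_)
import Data.List.Relation.Unary.All.Properties as Allₚ
open import Data.List.Relation.Unary.AllPairs using (AllPairs; []; _∷_)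
open import Data.List.Relation.Unary.Any using (here; there)
open import Data.List.Relation.Unary.Linked as Linked using (Linked; []; [-]; _∷_)
import Data.List.Relation.Unary.Linked.Properties as Linkedₚ
open import Data.List.Relation.Unary.Unique.Propositional using (Unique)
import Data.List.Relation.Unary.Unique.Propositional.Properties as Uniqueₚ
open import Data.Maybe as Maybe using (Maybe; just; nothing)
open import Data.Maybe.Properties using (just-injective)
open import Data.Maybe.Relation.Binary.Connected using (Connected; just)
open import Data.Nat as ℕ using (ℕ; zero; suc; z≤n; s≤s; _≤_; _<_; _∸_; _<ᵇ_; _≡ᵇ_; _⊓_; _!)
import Data.Nat.Properties as ℕₚ
open import Data.List.Membership.DecPropositional ℕₚ._≟_ using (_∈?_)
open import Data.Nat.Properties using (_!≢0)
open import Data.Product using (∃; _×_; _,_; proj₁; proj₂)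
open import Data.Rational using (ℚ; 0ℚ; 1ℚ; _/_; fromℚᵘ)
  renaming (_+_ to _+ℚ_; _*_ to _*ℚ_; -_ to -ℚ_)
import Data.Rational.Properties as ℚₚ
open import Data.Rational.Solver renaming (module +-*-Solver to ℚ-Solver)
import Data.Rational.Unnormalised as ℚᵘ
import Data.Rational.Unnormalised.Properties as ℚᵘₚ
open import Data.Sum using (_⊎_; inj₁; inj₂; [_,_]′)
open import Data.Unit using (⊤; tt)
open import Data.Vec as Vec using (Vec; []; _∷_; toList; insertAt; lookup; tabulate)
open import Data.Vec.Properties using (insertAt-lookup; insertAt-punchIn; lookup∘tabulate; tabulate∘lookup; tabulate-cong)
open import Function using (_∘_; id; mk⇔; Equivalence; _⇔_)
open import Relation.Binary.Definitions using (tri<; tri≈; tri>)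
open import Relation.Binary.PropositionalEquality
  using (_≡_; _≢_; refl; sym; trans; cong; cong₂; subst; subst₂; setoid; module ≡-Reasoning)
open import Relation.Nullary using (¬_; yes; no; does; contradiction)
open import Relation.Nullary.Decidable using (dec-true; dec-false)


-- Formal power series

-- Two choices shape the construction. A `linear` step stores a single tree in place of its
-- operands, so its validity does not depend on its sign: exchanging signs along the path leaves the
-- hanging trees untouched, although operands of a ⊕ and of a ⊖ obey different conditions. Moving
-- the blossom to the front forgets the position of its branch and, at a prime node, the vertex that
-- carries it. Both are recovered from the label put back for the blossom: minimal leaves determine
-- the position, the position determines the permutation of the decoration, and stability of `P`
-- under relabelling keeps the decoration in the family both ways. The equation for exp(T_not⊕) is
-- used only as (1 + T) exp(-T_not⊕) = 1. Detaching a leading ⊕ gives E' = T_not⊕' E and E(0) = 1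
-- for E = 1 + T, so the product has derivative 0 and constant term 1. The counts of the tree
-- classes are hypotheses, so finiteness is never proved; the word classes inherit their counts
-- through bijections.

fromℚᵘ-homo-+ : ∀ p q → fromℚᵘ p +ℚ fromℚᵘ q ≡ fromℚᵘ (p ℚᵘ.+ q)
fromℚᵘ-homo-+ p q = ℚₚ.toℚᵘ-injective (ℚᵘₚ.≃-trans (ℚₚ.toℚᵘ-homo-+ (fromℚᵘ p) (fromℚᵘ q))
  (ℚᵘₚ.≃-trans (ℚᵘₚ.+-cong (ℚₚ.toℚᵘ-fromℚᵘ p) (ℚₚ.toℚᵘ-fromℚᵘ q)) (ℚᵘₚ.≃-sym (ℚₚ.toℚᵘ-fromℚᵘ _))))

fromℚᵘ-homo-* : ∀ p q → fromℚᵘ p *ℚ fromℚᵘ q ≡ fromℚᵘ (p ℚᵘ.* q)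
fromℚᵘ-homo-* p q = ℚₚ.toℚᵘ-injective (ℚᵘₚ.≃-trans (ℚₚ.toℚᵘ-homo-* (fromℚᵘ p) (fromℚᵘ q))
  (ℚᵘₚ.≃-trans (ℚᵘₚ.*-cong (ℚₚ.toℚᵘ-fromℚᵘ p) (ℚₚ.toℚᵘ-fromℚᵘ q)) (ℚᵘₚ.≃-sym (ℚₚ.toℚᵘ-fromℚᵘ _))))

/-+ : ∀ i j d .{{_ : ℕ.NonZero d}} → (i / d) +ℚ (j / d) ≡ (i ℤ.+ j) / d
/-+ i j d@(suc d-1) = trans (fromℚᵘ-homo-+ (ℚᵘ.mkℚᵘ i d-1) (ℚᵘ.mkℚᵘ j d-1))
  (ℚₚ.fromℚᵘ-cong {ℚᵘ.mkℚᵘ i d-1 ℚᵘ.+ ℚᵘ.mkℚᵘ j d-1} {ℚᵘ.mkℚᵘ (i ℤ.+ j) d-1} (ℚᵘ.*≡*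
  (ℤ-Solver.solve 3 (λ i j d → (i :* d :+ j :* d) :* d := (i :+ j) :* (d :* d)) refl i j (+ d))))
  where open ℤ-Solver

suc/1* : ∀ k i d .{{_ : ℕ.NonZero d}} .{{_ : ℕ.NonZero (suc k ℕ.* d)}} →
  ((+ suc k) / 1) *ℚ (i / (suc k ℕ.* d)) ≡ i / d
suc/1* k i d@(suc d-1) = trans (fromℚᵘ-homo-* (ℚᵘ.mkℚᵘ (+ suc k) 0) (ℚᵘ.mkℚᵘ i (d-1 ℕ.+ k ℕ.* d)))
  (ℚₚ.fromℚᵘ-cong {ℚᵘ.mkℚᵘ (+ suc k) 0 ℚᵘ.* ℚᵘ.mkℚᵘ i (d-1 ℕ.+ k ℕ.* d)} {ℚᵘ.mkℚᵘ i d-1} (ℚᵘ.*≡* (begin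
    (+ suc k ℤ.* i) ℤ.* + d               ≡⟨ ℤ-Solver.solve 3 (λ k i d → k :* i :* d := i :* (k :* d)) refl (+ suc k) i (+ d) ⟩
    i ℤ.* (+ suc k ℤ.* + d)               ≡⟨ cong (i ℤ.*_) (sym (ℤₚ.pos-* (suc k) d)) ⟩
    i ℤ.* + (suc k ℕ.* d)                 ≡⟨ cong (λ z → i ℤ.* + z) (sym (ℕₚ.*-identityˡ (suc k ℕ.* d))) ⟩
    i ℤ.* + (1 ℕ.* (suc k ℕ.* d)) ∎)))
  where open ≡-Reasoning; open ℤ-Solver

/1-* : ∀ i j → (i / 1) *ℚ (j / 1) ≡ (i ℤ.* j) / 1
/1-* i j = fromℚᵘ-homo-* (ℚᵘ.mkℚᵘ i 0) (ℚᵘ.mkℚᵘ j 0)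

sucℚ : ℕ → ℚ
sucℚ n = (+ suc n) / 1

sucℚ-suc : ∀ n → sucℚ (suc n) ≡ 1ℚ +ℚ sucℚ n
sucℚ-suc n = sym (/-+ (+ 1) (+ suc n) 1)

-- Coefficient n of a derivative is `sucℚ n` times coefficient n + 1. Cancelling this factor
-- compares two series through their constant terms and derivatives, which is the induction
-- principle behind `*ₛ-comm`, `*ₛ-assoc` and `egf-binomialConv`.
sucℚ-cancel : ∀ n x y → sucℚ n *ℚ x ≡ sucℚ n *ℚ y → x ≡ y
sucℚ-cancel n x y eq = begin
  x                                        ≡⟨ sym (ℚₚ.*-identityˡ x) ⟩
  1ℚ *ℚ x                                  ≡⟨ cong (_*ℚ x) (sym inv) ⟩
  (((+ 1) / (suc n)) *ℚ sucℚ n) *ℚ x       ≡⟨ ℚₚ.*-assoc ((+ 1) / suc n) (sucℚ n) x ⟩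
  ((+ 1) / (suc n)) *ℚ (sucℚ n *ℚ x)       ≡⟨ cong (((+ 1) / (suc n)) *ℚ_) eq ⟩
  ((+ 1) / (suc n)) *ℚ (sucℚ n *ℚ y)       ≡⟨ sym (ℚₚ.*-assoc ((+ 1) / suc n) (sucℚ n) y) ⟩
  (((+ 1) / (suc n)) *ℚ sucℚ n) *ℚ y       ≡⟨ cong (_*ℚ y) inv ⟩
  1ℚ *ℚ y                                  ≡⟨ ℚₚ.*-identityˡ y ⟩
  y ∎
  where
  open ≡-Reasoning
  inv : ((+ 1) / (suc n)) *ℚ sucℚ n ≡ 1ℚ
  inv = trans (fromℚᵘ-homo-* (ℚᵘ.mkℚᵘ (+ 1) n) (ℚᵘ.mkℚᵘ (+ suc n) 0))
    (ℚₚ.fromℚᵘ-cong {ℚᵘ.mkℚᵘ (+ 1) n ℚᵘ.* ℚᵘ.mkℚᵘ (+ suc n) 0} {ℚᵘ.1ℚᵘ} (ℚᵘ.*≡*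
    (ℤ-Solver.solve 1 (λ d → con (+ 1) :* d :* con (+ 1) := con (+ 1) :* (d :* con (+ 1))) refl (+ suc n))))
    where open ℤ-Solver

-- The ring of series and its derivation

infix 4 _≈_
_≈_ : Series → Series → Set
a ≈ b = ∀ n → a n ≡ b n

≈-sym : ∀ {a b} → a ≈ b → b ≈ a
≈-sym p n = sym (p n)

≈-trans : ∀ {a b c} → a ≈ b → b ≈ c → a ≈ c
≈-trans p q n = trans (p n) (q n)

zeroₛ : Series
zeroₛ _ = 0ℚ

infixl 7 _·_
_·_ : ℚ → Series → Series
(c · a) n = c *ℚ a n

sum-upTo-suc : ∀ (f : ℕ → ℚ) n → sumℚ (map f (upTo (suc n))) ≡ f 0 +ℚ sumℚ (map (f ∘ suc) (upTo n))
sum-upTo-suc f n = cong (λ l → f 0 +ℚ sumℚ l) (trans (map-applyUpTo suc f n) (sym (map-upTo (f ∘ suc) n)))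

*ₛ-zero : ∀ a b → (a *ₛ b) 0 ≡ a 0 *ℚ b 0
*ₛ-zero a b = ℚₚ.+-identityʳ _

*ₛ-suc : ∀ a b n → (a *ₛ b) (suc n) ≡ a 0 *ℚ b (suc n) +ℚ ((a ∘ suc) *ₛ b) n
*ₛ-suc a b n = sum-upTo-suc (λ k → a k *ℚ b (suc n ∸ k)) (suc n)

-- Coefficient n of a product involves only coefficients up to n of the factors. The bounded form
-- serves factors that agree only up to some order, as truncated exponential sums do.
*ₛ-cong-≤ : ∀ n {a a′ b b′} → (∀ k → k ℕ.≤ n → a k ≡ a′ k) → (∀ k → k ℕ.≤ n → b k ≡ b′ k) →
  (a *ₛ b) n ≡ (a′ *ₛ b′) n
*ₛ-cong-≤ zero {a} {a′} {b} {b′} p q = begin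
  (a *ₛ b) 0      ≡⟨ *ₛ-zero a b ⟩
  a 0 *ℚ b 0      ≡⟨ cong₂ _*ℚ_ (p 0 z≤n) (q 0 z≤n) ⟩
  a′ 0 *ℚ b′ 0    ≡⟨ sym (*ₛ-zero a′ b′) ⟩
  (a′ *ₛ b′) 0 ∎
  where open ≡-Reasoning
*ₛ-cong-≤ (suc n) {a} {a′} {b} {b′} p q = begin
  (a *ₛ b) (suc n)                               ≡⟨ *ₛ-suc a b n ⟩
  a 0 *ℚ b (suc n) +ℚ ((a ∘ suc) *ₛ b) n         ≡⟨ cong₂ _+ℚ_ (cong₂ _*ℚ_ (p 0 z≤n) (q (suc n) ℕₚ.≤-refl))
                                                     (*ₛ-cong-≤ n (λ k k≤n → p (suc k) (s≤s k≤n)) (λ k k≤n → q k (ℕₚ.m≤n⇒m≤1+n k≤n))) ⟩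
  a′ 0 *ℚ b′ (suc n) +ℚ ((a′ ∘ suc) *ₛ b′) n     ≡⟨ sym (*ₛ-suc a′ b′ n) ⟩
  (a′ *ₛ b′) (suc n) ∎
  where open ≡-Reasoning

*ₛ-cong : ∀ {a a′ b b′} → a ≈ a′ → b ≈ b′ → (a *ₛ b) ≈ (a′ *ₛ b′)
*ₛ-cong p q n = *ₛ-cong-≤ n (λ k _ → p k) (λ k _ → q k)

*ₛ-zeroˡ : ∀ b → (zeroₛ *ₛ b) ≈ zeroₛ
*ₛ-zeroˡ b zero    = trans (*ₛ-zero zeroₛ b) (ℚₚ.*-zeroˡ (b 0))
*ₛ-zeroˡ b (suc n) = trans (*ₛ-suc zeroₛ b n) (cong₂ _+ℚ_ (ℚₚ.*-zeroˡ (b (suc n))) (*ₛ-zeroˡ b n))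

*ₛ-identityˡ : ∀ b → (oneₛ *ₛ b) ≈ b
*ₛ-identityˡ b zero    = trans (*ₛ-zero oneₛ b) (ℚₚ.*-identityˡ (b 0))
*ₛ-identityˡ b (suc n) = trans (*ₛ-suc oneₛ b n)
  (trans (cong₂ _+ℚ_ (ℚₚ.*-identityˡ (b (suc n))) (*ₛ-zeroˡ b n)) (ℚₚ.+-identityʳ (b (suc n))))

*ₛ-distribʳ-+ₛ : ∀ c a b → ((a +ₛ b) *ₛ c) ≈ ((a *ₛ c) +ₛ (b *ₛ c))
*ₛ-distribʳ-+ₛ c a b zero = begin
  ((a +ₛ b) *ₛ c) 0                ≡⟨ *ₛ-zero (a +ₛ b) c ⟩
  (a 0 +ℚ b 0) *ℚ c 0              ≡⟨ ℚₚ.*-distribʳ-+ (c 0) (a 0) (b 0) ⟩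
  a 0 *ℚ c 0 +ℚ b 0 *ℚ c 0         ≡⟨ sym (cong₂ _+ℚ_ (*ₛ-zero a c) (*ₛ-zero b c)) ⟩
  ((a *ₛ c) +ₛ (b *ₛ c)) 0 ∎
  where open ≡-Reasoning
*ₛ-distribʳ-+ₛ c a b (suc n) = begin
  ((a +ₛ b) *ₛ c) (suc n)
    ≡⟨ *ₛ-suc (a +ₛ b) c n ⟩
  (a 0 +ℚ b 0) *ℚ c (suc n) +ℚ (((a ∘ suc) +ₛ (b ∘ suc)) *ₛ c) n
    ≡⟨ cong ((a 0 +ℚ b 0) *ℚ c (suc n) +ℚ_) (*ₛ-distribʳ-+ₛ c (a ∘ suc) (b ∘ suc) n) ⟩
  (a 0 +ℚ b 0) *ℚ c (suc n) +ℚ (((a ∘ suc) *ₛ c) n +ℚ ((b ∘ suc) *ₛ c) n)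
    ≡⟨ solve 5 (λ x y z u v → (x :+ y) :* z :+ (u :+ v) := (x :* z :+ u) :+ (y :* z :+ v)) refl
         (a 0) (b 0) (c (suc n)) (((a ∘ suc) *ₛ c) n) (((b ∘ suc) *ₛ c) n) ⟩
  (a 0 *ℚ c (suc n) +ℚ ((a ∘ suc) *ₛ c) n) +ℚ (b 0 *ℚ c (suc n) +ℚ ((b ∘ suc) *ₛ c) n)
    ≡⟨ sym (cong₂ _+ℚ_ (*ₛ-suc a c n) (*ₛ-suc b c n)) ⟩
  ((a *ₛ c) +ₛ (b *ₛ c)) (suc n) ∎
  where open ≡-Reasoning; open ℚ-Solver

·-*ₛ : ∀ x a b → ((x · a) *ₛ b) ≈ (x · (a *ₛ b))
·-*ₛ x a b zero = begin
  ((x · a) *ₛ b) 0     ≡⟨ *ₛ-zero (x · a) b ⟩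
  x *ℚ a 0 *ℚ b 0      ≡⟨ ℚₚ.*-assoc x (a 0) (b 0) ⟩
  x *ℚ (a 0 *ℚ b 0)    ≡⟨ cong (x *ℚ_) (sym (*ₛ-zero a b)) ⟩
  (x · (a *ₛ b)) 0 ∎
  where open ≡-Reasoning
·-*ₛ x a b (suc n) = begin
  ((x · a) *ₛ b) (suc n)
    ≡⟨ *ₛ-suc (x · a) b n ⟩
  x *ℚ a 0 *ℚ b (suc n) +ℚ ((x · (a ∘ suc)) *ₛ b) n
    ≡⟨ cong (x *ℚ a 0 *ℚ b (suc n) +ℚ_) (·-*ₛ x (a ∘ suc) b n) ⟩
  x *ℚ a 0 *ℚ b (suc n) +ℚ x *ℚ ((a ∘ suc) *ₛ b) n
    ≡⟨ solve 4 (λ x y z u → x :* y :* z :+ x :* u := x :* (y :* z :+ u)) refl x (a 0) (b (suc n)) (((a ∘ suc) *ₛ b) n) ⟩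
  x *ℚ (a 0 *ℚ b (suc n) +ℚ ((a ∘ suc) *ₛ b) n)
    ≡⟨ cong (x *ℚ_) (sym (*ₛ-suc a b n)) ⟩
  (x · (a *ₛ b)) (suc n) ∎
  where open ≡-Reasoning; open ℚ-Solver

deriv-cong : ∀ {a b} → a ≈ b → deriv a ≈ deriv b
deriv-cong p n = cong (sucℚ n *ℚ_) (p (suc n))

deriv-oneₛ : deriv oneₛ ≈ zeroₛ
deriv-oneₛ n = ℚₚ.*-zeroʳ (sucℚ n)

deriv-+ₛ : ∀ a b → deriv (a +ₛ b) ≈ (deriv a +ₛ deriv b)
deriv-+ₛ a b n = ℚₚ.*-distribˡ-+ (sucℚ n) (a (suc n)) (b (suc n))

-- *ₛ-suc reduces the coefficient n + 1 of the product with a to the coefficient n of the product with the shift of a.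
deriv-*ₛ : ∀ a b → deriv (a *ₛ b) ≈ ((deriv a *ₛ b) +ₛ (a *ₛ deriv b))
deriv-*ₛ a b zero = begin
  sucℚ 0 *ℚ (a *ₛ b) 1
    ≡⟨ cong (sucℚ 0 *ℚ_) (trans (*ₛ-suc a b 0) (cong (a 0 *ℚ b 1 +ℚ_) (*ₛ-zero (a ∘ suc) b))) ⟩
  sucℚ 0 *ℚ (a 0 *ℚ b 1 +ℚ a 1 *ℚ b 0)
    ≡⟨ solve 5 (λ q x y z w → q :* (x :* y :+ z :* w) := q :* z :* w :+ x :* (q :* y)) refl (sucℚ 0) (a 0) (b 1) (a 1) (b 0) ⟩
  deriv a 0 *ℚ b 0 +ℚ a 0 *ℚ deriv b 0
    ≡⟨ sym (cong₂ _+ℚ_ (*ₛ-zero (deriv a) b) (*ₛ-zero a (deriv b))) ⟩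
  ((deriv a *ₛ b) +ₛ (a *ₛ deriv b)) 0 ∎
  where open ≡-Reasoning; open ℚ-Solver
deriv-*ₛ a b (suc n) = begin
  q *ℚ (a *ₛ b) (2 ℕ.+ n)
    ≡⟨ cong (q *ℚ_) (*ₛ-suc a b (suc n)) ⟩
  q *ℚ (a 0 *ℚ b₂ +ℚ sab)
    ≡⟨ solve 4 (λ q x y z → q :* (x :* y :+ z) := x :* (q :* y) :+ q :* z) refl q (a 0) b₂ sab ⟩
  a 0 *ℚ (q *ℚ b₂) +ℚ q *ℚ sab
    ≡⟨ cong (λ z → a 0 *ℚ (q *ℚ b₂) +ℚ z *ℚ sab) (sucℚ-suc n) ⟩
  a 0 *ℚ (q *ℚ b₂) +ℚ (1ℚ +ℚ sucℚ n) *ℚ sab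
    ≡⟨ solve 3 (λ x p y → x :+ (con 1ℚ :+ p) :* y := x :+ (y :+ p :* y)) refl (a 0 *ℚ (q *ℚ b₂)) (sucℚ n) sab ⟩
  a 0 *ℚ (q *ℚ b₂) +ℚ (sab +ℚ deriv ((a ∘ suc) *ₛ b) n)
    ≡⟨ cong (λ z → a 0 *ℚ (q *ℚ b₂) +ℚ (sab +ℚ z)) (deriv-*ₛ (a ∘ suc) b n) ⟩
  a 0 *ℚ (q *ℚ b₂) +ℚ (sab +ℚ (dsab +ℚ sadb))
    ≡⟨ cong (λ z → a 0 *ℚ (q *ℚ b₂) +ℚ (z +ℚ (dsab +ℚ sadb))) (*ₛ-suc (a ∘ suc) b n) ⟩
  a 0 *ℚ (q *ℚ b₂) +ℚ ((a 1 *ℚ b₁ +ℚ ssab) +ℚ (dsab +ℚ sadb))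
    ≡⟨ solve 5 (λ x y z u v → x :+ ((y :+ z) :+ (u :+ v)) := (con 1ℚ :* y :+ (z :+ u)) :+ (x :+ v)) refl
         (a 0 *ℚ (q *ℚ b₂)) (a 1 *ℚ b₁) ssab dsab sadb ⟩
  (1ℚ *ℚ (a 1 *ℚ b₁) +ℚ (ssab +ℚ dsab)) +ℚ (a 0 *ℚ (q *ℚ b₂) +ℚ sadb)
    ≡⟨ cong₂ (λ y z → (y +ℚ z) +ℚ (a 0 *ℚ (q *ℚ b₂) +ℚ sadb)) (sym (ℚₚ.*-assoc 1ℚ (a 1) b₁)) (sym shifted) ⟩
  (1ℚ *ℚ a 1 *ℚ b₁ +ℚ ((deriv a ∘ suc) *ₛ b) n) +ℚ (a 0 *ℚ (q *ℚ b₂) +ℚ sadb)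
    ≡⟨ sym (cong₂ _+ℚ_ (*ₛ-suc (deriv a) b n) (*ₛ-suc a (deriv b) n)) ⟩
  ((deriv a *ₛ b) +ₛ (a *ₛ deriv b)) (suc n) ∎
  where
  open ≡-Reasoning
  open ℚ-Solver
  q = sucℚ (suc n)
  b₁ = b (suc n)
  b₂ = b (2 ℕ.+ n)
  sab = ((a ∘ suc) *ₛ b) (suc n)
  ssab = ((a ∘ ℕ.suc ∘ ℕ.suc) *ₛ b) n
  dsab = (deriv (a ∘ suc) *ₛ b) n
  sadb = ((a ∘ suc) *ₛ deriv b) n
  -- Differentiation does not commute with the shift: since k + 2 = 1 + (k + 1), the shifted
  -- derivative exceeds the derivative of the shift by the second shift of `a`.
  shifted : ((deriv a ∘ suc) *ₛ b) n ≡ ssab +ℚ dsab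
  shifted = trans
    (*ₛ-cong {b = b} (λ k → trans (cong (_*ℚ a (2 ℕ.+ k)) (sucℚ-suc k))
        (solve 2 (λ p x → (con 1ℚ :+ p) :* x := x :+ p :* x) refl (sucℚ k) (a (2 ℕ.+ k)))) (λ _ → refl) n)
    (*ₛ-distribʳ-+ₛ b (a ∘ ℕ.suc ∘ ℕ.suc) (deriv (a ∘ suc)) n)

-- By the Leibniz rule, the derivatives of both sides agree at coefficient n once commutativity is
-- known at n for the factors and their derivatives; the induction therefore runs over all series at
-- once.
*ₛ-comm : ∀ a b → (a *ₛ b) ≈ (b *ₛ a)
*ₛ-comm a b zero = trans (*ₛ-zero a b) (trans (ℚₚ.*-comm (a 0) (b 0)) (sym (*ₛ-zero b a)))
*ₛ-comm a b (suc n) = sucℚ-cancel n _ _ (begin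
  deriv (a *ₛ b) n                          ≡⟨ deriv-*ₛ a b n ⟩
  (deriv a *ₛ b) n +ℚ (a *ₛ deriv b) n      ≡⟨ cong₂ _+ℚ_ (*ₛ-comm (deriv a) b n) (*ₛ-comm a (deriv b) n) ⟩
  (b *ₛ deriv a) n +ℚ (deriv b *ₛ a) n      ≡⟨ ℚₚ.+-comm ((b *ₛ deriv a) n) ((deriv b *ₛ a) n) ⟩
  (deriv b *ₛ a) n +ℚ (b *ₛ deriv a) n      ≡⟨ sym (deriv-*ₛ b a n) ⟩
  deriv (b *ₛ a) n ∎)
  where open ≡-Reasoning

*ₛ-distribˡ-+ₛ : ∀ c a b → (c *ₛ (a +ₛ b)) ≈ ((c *ₛ a) +ₛ (c *ₛ b))
*ₛ-distribˡ-+ₛ c a b n = trans (*ₛ-comm c (a +ₛ b) n)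
  (trans (*ₛ-distribʳ-+ₛ c a b n) (cong₂ _+ℚ_ (*ₛ-comm a c n) (*ₛ-comm b c n)))

*ₛ-· : ∀ x a b → (a *ₛ (x · b)) ≈ (x · (a *ₛ b))
*ₛ-· x a b n = trans (*ₛ-comm a (x · b) n) (trans (·-*ₛ x b a n) (cong (x *ℚ_) (*ₛ-comm b a n)))

*ₛ-zeroʳ : ∀ a → (a *ₛ zeroₛ) ≈ zeroₛ
*ₛ-zeroʳ a = ≈-trans (*ₛ-comm a zeroₛ) (*ₛ-zeroˡ a)

*ₛ-identityʳ : ∀ a → (a *ₛ oneₛ) ≈ a
*ₛ-identityʳ a = ≈-trans (*ₛ-comm a oneₛ) (*ₛ-identityˡ a)

*ₛ-assoc : ∀ a b c → ((a *ₛ b) *ₛ c) ≈ (a *ₛ (b *ₛ c))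
*ₛ-assoc a b c zero = begin
  ((a *ₛ b) *ₛ c) 0        ≡⟨ trans (*ₛ-zero (a *ₛ b) c) (cong (_*ℚ c 0) (*ₛ-zero a b)) ⟩
  a 0 *ℚ b 0 *ℚ c 0        ≡⟨ ℚₚ.*-assoc (a 0) (b 0) (c 0) ⟩
  a 0 *ℚ (b 0 *ℚ c 0)      ≡⟨ sym (trans (*ₛ-zero a (b *ₛ c)) (cong (a 0 *ℚ_) (*ₛ-zero b c))) ⟩
  (a *ₛ (b *ₛ c)) 0 ∎
  where open ≡-Reasoning
*ₛ-assoc a b c (suc n) = sucℚ-cancel n _ _ (begin
  deriv ((a *ₛ b) *ₛ c) n
    ≡⟨ deriv-*ₛ (a *ₛ b) c n ⟩
  (deriv (a *ₛ b) *ₛ c) n +ℚ ((a *ₛ b) *ₛ deriv c) n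
    ≡⟨ cong (_+ℚ ((a *ₛ b) *ₛ deriv c) n) (*ₛ-cong {b = c} (deriv-*ₛ a b) (λ _ → refl) n) ⟩
  (((deriv a *ₛ b) +ₛ (a *ₛ deriv b)) *ₛ c) n +ℚ ((a *ₛ b) *ₛ deriv c) n
    ≡⟨ cong (_+ℚ ((a *ₛ b) *ₛ deriv c) n) (*ₛ-distribʳ-+ₛ c (deriv a *ₛ b) (a *ₛ deriv b) n) ⟩
  (((deriv a *ₛ b) *ₛ c) n +ℚ ((a *ₛ deriv b) *ₛ c) n) +ℚ ((a *ₛ b) *ₛ deriv c) n
    ≡⟨ ℚₚ.+-assoc (((deriv a *ₛ b) *ₛ c) n) (((a *ₛ deriv b) *ₛ c) n) (((a *ₛ b) *ₛ deriv c) n) ⟩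
  ((deriv a *ₛ b) *ₛ c) n +ℚ (((a *ₛ deriv b) *ₛ c) n +ℚ ((a *ₛ b) *ₛ deriv c) n)
    ≡⟨ cong₂ _+ℚ_ (*ₛ-assoc (deriv a) b c n) (cong₂ _+ℚ_ (*ₛ-assoc a (deriv b) c n) (*ₛ-assoc a b (deriv c) n)) ⟩
  (deriv a *ₛ (b *ₛ c)) n +ℚ ((a *ₛ (deriv b *ₛ c)) n +ℚ (a *ₛ (b *ₛ deriv c)) n)
    ≡⟨ cong ((deriv a *ₛ (b *ₛ c)) n +ℚ_) (sym (*ₛ-distribˡ-+ₛ a (deriv b *ₛ c) (b *ₛ deriv c) n)) ⟩
  (deriv a *ₛ (b *ₛ c)) n +ℚ (a *ₛ ((deriv b *ₛ c) +ₛ (b *ₛ deriv c))) n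
    ≡⟨ cong ((deriv a *ₛ (b *ₛ c)) n +ℚ_) (*ₛ-cong {a = a} (λ _ → refl) (≈-sym (deriv-*ₛ b c)) n) ⟩
  (deriv a *ₛ (b *ₛ c)) n +ℚ (a *ₛ deriv (b *ₛ c)) n
    ≡⟨ sym (deriv-*ₛ a (b *ₛ c) n) ⟩
  deriv (a *ₛ (b *ₛ c)) n ∎)
  where open ≡-Reasoning

-- Exponential generating functions and binomial convolution

deriv-egf : ∀ c → deriv (egf c) ≈ egf (c ∘ suc)
deriv-egf c n = suc/1* n (+ c (suc n)) (n !)
  where instance
    _ = n !≢0
    _ = suc n !≢0

egf-+ : ∀ c d n → egf (λ k → c k ℕ.+ d k) n ≡ egf c n +ℚ egf d n
egf-+ c d n = sym (/-+ (+ c n) (+ d n) (n !))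
  where instance _ = n !≢0

-- This is the sum over k of C(n,k) c(k) d(n-k), unfolded by Pascal's rule. The recursion has the
-- shape of the Leibniz rule and also of the choice, for one label, between two factors.
binomialConv : (ℕ → ℕ) → (ℕ → ℕ) → ℕ → ℕ
binomialConv c d zero    = c 0 ℕ.* d 0
binomialConv c d (suc n) = binomialConv (c ∘ suc) d n ℕ.+ binomialConv c (d ∘ suc) n

-- `deriv` shifts the counting sequence of an `egf`, so the recursion of `binomialConv` becomes the
-- Leibniz rule for the product.
egf-binomialConv : ∀ c d → egf (binomialConv c d) ≈ (egf c *ₛ egf d)
egf-binomialConv c d zero = begin
  + (c 0 ℕ.* d 0) / 1            ≡⟨ cong (_/ 1) (ℤₚ.pos-* (c 0) (d 0)) ⟩
  (+ c 0 ℤ.* + d 0) / 1          ≡⟨ sym (/1-* (+ c 0) (+ d 0)) ⟩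
  egf c 0 *ℚ egf d 0             ≡⟨ sym (*ₛ-zero (egf c) (egf d)) ⟩
  (egf c *ₛ egf d) 0 ∎
  where open ≡-Reasoning
egf-binomialConv c d (suc n) = sucℚ-cancel n _ _ (begin
  deriv (egf (binomialConv c d)) n
    ≡⟨ deriv-egf (binomialConv c d) n ⟩
  egf (binomialConv c d ∘ suc) n
    ≡⟨ egf-+ (binomialConv (c ∘ suc) d) (binomialConv c (d ∘ suc)) n ⟩
  egf (binomialConv (c ∘ suc) d) n +ℚ egf (binomialConv c (d ∘ suc)) n
    ≡⟨ cong₂ _+ℚ_ (egf-binomialConv (c ∘ suc) d n) (egf-binomialConv c (d ∘ suc) n) ⟩
  (egf (c ∘ suc) *ₛ egf d) n +ℚ (egf c *ₛ egf (d ∘ suc)) n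
    ≡⟨ sym (cong₂ _+ℚ_ (*ₛ-cong {b = egf d} (deriv-egf c) (λ _ → refl) n)
                       (*ₛ-cong {a = egf c} (λ _ → refl) (deriv-egf d) n)) ⟩
  (deriv (egf c) *ₛ egf d) n +ℚ (egf c *ₛ deriv (egf d)) n
    ≡⟨ sym (deriv-*ₛ (egf c) (egf d) n) ⟩
  deriv (egf c *ₛ egf d) n ∎)
  where open ≡-Reasoning

-- The exponential and its differential equation

sum-*ₛ : ∀ b (c : ℕ → ℚ) (s : ℕ → Series) js →
  (b *ₛ (λ m → sumℚ (map (λ j → c j *ℚ s j m) js))) ≈ (λ n → sumℚ (map (λ j → c j *ℚ (b *ₛ s j) n) js))
sum-*ₛ b c s [] = *ₛ-zeroʳ b
sum-*ₛ b c s (j ∷ js) n = trans (*ₛ-distribˡ-+ₛ b (c j · s j) (λ m → sumℚ (map (λ i → c i *ℚ s i m) js)) n)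
  (cong₂ _+ℚ_ (*ₛ-· (c j) b (s j) n) (sum-*ₛ b c s js n))

*-sum : ∀ x (f : ℕ → ℚ) js → x *ℚ sumℚ (map f js) ≡ sumℚ (map (λ j → x *ℚ f j) js)
*-sum x f [] = ℚₚ.*-zeroʳ x
*-sum x f (j ∷ js) = trans (ℚₚ.*-distribˡ-+ x (f j) _) (cong (x *ℚ f j +ℚ_) (*-sum x f js))

sum-cong : ∀ {f g : ℕ → ℚ} → (∀ j → f j ≡ g j) → ∀ js → sumℚ (map f js) ≡ sumℚ (map g js)
sum-cong p js = cong sumℚ (map-cong p js)

sum-vanishing : ∀ {f : ℕ → ℚ} → (∀ j → f j ≡ 0ℚ) → ∀ js → sumℚ (map f js) ≡ 0ℚ
sum-vanishing p [] = refl
sum-vanishing p (j ∷ js) = cong₂ _+ℚ_ (p j) (sum-vanishing p js)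

sum-upTo-extend : ∀ {f : ℕ → ℚ} {m n} → m ℕ.≤ n → (∀ j → m ℕ.≤ j → f j ≡ 0ℚ) →
  sumℚ (map f (upTo m)) ≡ sumℚ (map f (upTo n))
sum-upTo-extend {n = n} z≤n p = sym (sum-vanishing (λ j → p j z≤n) (upTo n))
sum-upTo-extend {f} {suc m} {suc n} (s≤s m≤n) p = begin
  sumℚ (map f (upTo (suc m)))             ≡⟨ sum-upTo-suc f m ⟩
  f 0 +ℚ sumℚ (map (f ∘ suc) (upTo m))    ≡⟨ cong (f 0 +ℚ_) (sum-upTo-extend m≤n (λ j m≤j → p (suc j) (s≤s m≤j))) ⟩
  f 0 +ℚ sumℚ (map (f ∘ suc) (upTo n))    ≡⟨ sym (sum-upTo-suc f n) ⟩
  sumℚ (map f (upTo (suc n))) ∎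
  where open ≡-Reasoning

-- Each factor `a` raises the order by at least one. This is what lets finite truncations of the
-- exponential stand for the full sum.
powₛ-vanishing : ∀ a → a 0 ≡ 0ℚ → ∀ j n → n ℕ.< j → powₛ a j n ≡ 0ℚ
powₛ-vanishing a a₀ (suc j) zero _ = trans (*ₛ-zero a (powₛ a j))
  (trans (cong (_*ℚ powₛ a j 0) a₀) (ℚₚ.*-zeroˡ (powₛ a j 0)))
powₛ-vanishing a a₀ (suc j) (suc n) (s≤s n<j) = trans (*ₛ-suc a (powₛ a j) n) (trans
  (cong₂ _+ℚ_ (trans (cong (_*ℚ powₛ a j (suc n)) a₀) (ℚₚ.*-zeroˡ (powₛ a j (suc n))))
    (trans (*ₛ-cong-≤ n {a ∘ suc} {a ∘ suc} {powₛ a j} {zeroₛ} (λ _ _ → refl)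
             (λ k k≤n → powₛ-vanishing a a₀ j k (ℕₚ.≤-<-trans k≤n n<j)))
           (*ₛ-zeroʳ (a ∘ suc) n)))
  refl)

deriv-powₛ : ∀ a j → deriv (powₛ a (suc j)) ≈ (sucℚ j · (deriv a *ₛ powₛ a j))
deriv-powₛ a zero n = begin
  deriv (a *ₛ oneₛ) n           ≡⟨ deriv-cong (*ₛ-identityʳ a) n ⟩
  deriv a n                     ≡⟨ sym (*ₛ-identityʳ (deriv a) n) ⟩
  (deriv a *ₛ oneₛ) n           ≡⟨ sym (ℚₚ.*-identityˡ _) ⟩
  1ℚ *ℚ (deriv a *ₛ oneₛ) n ∎
  where open ≡-Reasoning
deriv-powₛ a (suc j) n = begin
  deriv (a *ₛ p) n
    ≡⟨ deriv-*ₛ a p n ⟩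
  (deriv a *ₛ p) n +ℚ (a *ₛ deriv p) n
    ≡⟨ cong ((deriv a *ₛ p) n +ℚ_) (begin
         (a *ₛ deriv p) n                                ≡⟨ *ₛ-cong {a = a} (λ _ → refl) (deriv-powₛ a j) n ⟩
         (a *ₛ (sucℚ j · (deriv a *ₛ powₛ a j))) n       ≡⟨ *ₛ-· (sucℚ j) a (deriv a *ₛ powₛ a j) n ⟩
         sucℚ j *ℚ (a *ₛ (deriv a *ₛ powₛ a j)) n        ≡⟨ cong (sucℚ j *ℚ_) (sym (*ₛ-assoc a (deriv a) (powₛ a j) n)) ⟩
         sucℚ j *ℚ ((a *ₛ deriv a) *ₛ powₛ a j) n        ≡⟨ cong (sucℚ j *ℚ_) (*ₛ-cong {b = powₛ a j} (*ₛ-comm a (deriv a)) (λ _ → refl) n) ⟩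
         sucℚ j *ℚ ((deriv a *ₛ a) *ₛ powₛ a j) n        ≡⟨ cong (sucℚ j *ℚ_) (*ₛ-assoc (deriv a) a (powₛ a j) n) ⟩
         sucℚ j *ℚ (deriv a *ₛ p) n ∎) ⟩
  (deriv a *ₛ p) n +ℚ sucℚ j *ℚ (deriv a *ₛ p) n
    ≡⟨ solve 2 (λ x q → x :+ q :* x := (con 1ℚ :+ q) :* x) refl ((deriv a *ₛ p) n) (sucℚ j) ⟩
  (1ℚ +ℚ sucℚ j) *ℚ (deriv a *ₛ p) n
    ≡⟨ cong (_*ℚ (deriv a *ₛ p) n) (sym (sucℚ-suc j)) ⟩
  sucℚ (suc j) *ℚ (deriv a *ₛ p) n ∎
  where
  open ≡-Reasoning
  open ℚ-Solver
  p = powₛ a (suc j)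

1/! : ℕ → ℚ
1/! j = (+ 1) / (j !)
  where instance _ = j !≢0

sucℚ*1/! : ∀ j → sucℚ j *ℚ 1/! (suc j) ≡ 1/! j
sucℚ*1/! j = suc/1* j (+ 1) (j !)
  where instance
    _ = j !≢0
    _ = suc j !≢0

-- `expₛ` cuts its sum at a bound that varies with the coefficient. A bound common to all
-- coefficients up to `N` turns the sum into a combination of whole series, which can be multiplied
-- term by term.
expₛ-truncate : ∀ a → a 0 ≡ 0ℚ → ∀ {n N} → n ℕ.≤ N →
  expₛ a n ≡ sumℚ (map (λ j → 1/! j *ℚ powₛ a j n) (upTo (suc N)))
expₛ-truncate a a₀ n≤N = sum-upTo-extend (s≤s n≤N)
  (λ j n<j → trans (cong (1/! j *ℚ_) (powₛ-vanishing a a₀ j _ n<j)) (ℚₚ.*-zeroʳ (1/! j)))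

deriv-expₛ : ∀ a → a 0 ≡ 0ℚ → deriv (expₛ a) ≈ (deriv a *ₛ expₛ a)
deriv-expₛ a a₀ n = begin
  sucℚ n *ℚ sumℚ (map (λ j → 1/! j *ℚ powₛ a j (suc n)) (upTo (2 ℕ.+ n)))
    ≡⟨ *-sum (sucℚ n) (λ j → 1/! j *ℚ powₛ a j (suc n)) (upTo (2 ℕ.+ n)) ⟩
  sumℚ (map (λ j → sucℚ n *ℚ (1/! j *ℚ powₛ a j (suc n))) (upTo (2 ℕ.+ n)))
    -- The term j = 0 is the constant series 1 and contributes nothing. In the others the factor j +
    -- 1 of the power rule turns 1/(j+1)! into 1/j!.
    ≡⟨ sum-upTo-suc (λ j → sucℚ n *ℚ (1/! j *ℚ powₛ a j (suc n))) (suc n) ⟩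
  sucℚ n *ℚ (1ℚ *ℚ 0ℚ) +ℚ sumℚ (map (λ j → sucℚ n *ℚ (1/! (suc j) *ℚ powₛ a (suc j) (suc n))) (upTo (suc n)))
    ≡⟨ cong₂ _+ℚ_ (ℚₚ.*-zeroʳ (sucℚ n)) (sum-cong term (upTo (suc n))) ⟩
  0ℚ +ℚ sumℚ (map (λ j → 1/! j *ℚ (deriv a *ₛ powₛ a j) n) (upTo (suc n)))
    ≡⟨ ℚₚ.+-identityˡ _ ⟩
  sumℚ (map (λ j → 1/! j *ℚ (deriv a *ₛ powₛ a j) n) (upTo (suc n)))
    ≡⟨ sym (sum-*ₛ (deriv a) 1/! (powₛ a) (upTo (suc n)) n) ⟩
  (deriv a *ₛ (λ m → sumℚ (map (λ j → 1/! j *ℚ powₛ a j m) (upTo (suc n))))) n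
    ≡⟨ *ₛ-cong-≤ n {deriv a} (λ _ _ → refl) (λ k k≤n → sym (expₛ-truncate a a₀ k≤n)) ⟩
  (deriv a *ₛ expₛ a) n ∎
  where
  open ≡-Reasoning
  open ℚ-Solver
  term : ∀ j → sucℚ n *ℚ (1/! (suc j) *ℚ powₛ a (suc j) (suc n)) ≡ 1/! j *ℚ (deriv a *ₛ powₛ a j) n
  term j = begin
    sucℚ n *ℚ (1/! (suc j) *ℚ powₛ a (suc j) (suc n))
      ≡⟨ solve 3 (λ q i p → q :* (i :* p) := i :* (q :* p)) refl (sucℚ n) (1/! (suc j)) (powₛ a (suc j) (suc n)) ⟩
    1/! (suc j) *ℚ deriv (powₛ a (suc j)) n
      ≡⟨ cong (1/! (suc j) *ℚ_) (deriv-powₛ a j n) ⟩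
    1/! (suc j) *ℚ (sucℚ j *ℚ (deriv a *ₛ powₛ a j) n)
      ≡⟨ solve 3 (λ q i p → i :* (q :* p) := (q :* i) :* p) refl (sucℚ j) (1/! (suc j)) ((deriv a *ₛ powₛ a j) n) ⟩
    sucℚ j *ℚ 1/! (suc j) *ℚ (deriv a *ₛ powₛ a j) n
      ≡⟨ cong (_*ℚ (deriv a *ₛ powₛ a j) n) (sucℚ*1/! j) ⟩
    1/! j *ℚ (deriv a *ₛ powₛ a j) n ∎

-- E and exp(-a) solve the ODEs y' = a'y and y' = -a'y, so the derivative of their product vanishes.
*ₛ-expₛ-inverse : ∀ E a → E 0 ≡ 1ℚ → a 0 ≡ 0ℚ → deriv E ≈ (deriv a *ₛ E) → (E *ₛ expₛ (-ₛ a)) ≈ oneₛ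
*ₛ-expₛ-inverse E a E₀ a₀ E′ zero = trans (*ₛ-zero E (expₛ (-ₛ a))) (cong (_*ℚ 1ℚ) E₀)
*ₛ-expₛ-inverse E a E₀ a₀ E′ (suc n) = sucℚ-cancel n _ _ (begin
  deriv (E *ₛ X) n
    ≡⟨ deriv-*ₛ E X n ⟩
  (deriv E *ₛ X) n +ℚ (E *ₛ deriv X) n
    ≡⟨ cong₂ _+ℚ_ (*ₛ-cong {b = X} (≈-trans E′ (*ₛ-comm (deriv a) E)) (λ _ → refl) n)
                  (*ₛ-cong {a = E} (λ _ → refl) X′ n) ⟩
  ((E *ₛ deriv a) *ₛ X) n +ℚ (E *ₛ ((-ℚ 1ℚ) · (deriv a *ₛ X))) n
    ≡⟨ cong₂ _+ℚ_ (*ₛ-assoc E (deriv a) X n) (*ₛ-· (-ℚ 1ℚ) E (deriv a *ₛ X) n) ⟩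
  y +ℚ (-ℚ 1ℚ) *ℚ y
    ≡⟨ solve 1 (λ x → x :+ con (-ℚ 1ℚ) :* x := con 0ℚ) refl y ⟩
  0ℚ
    ≡⟨ sym (deriv-oneₛ n) ⟩
  deriv oneₛ n ∎)
  where
  open ≡-Reasoning
  open ℚ-Solver
  X = expₛ (-ₛ a)
  y = (E *ₛ (deriv a *ₛ X)) n
  X′ : deriv X ≈ ((-ℚ 1ℚ) · (deriv a *ₛ X))
  X′ = ≈-trans (deriv-expₛ (-ₛ a) (cong -ℚ_ a₀)) (≈-trans
    (*ₛ-cong {b = X} (λ k → solve 2 (λ q x → q :* (:- x) := con (-ℚ 1ℚ) :* (q :* x)) refl (sucℚ k) (a (suc k))) (λ _ → refl))
    (·-*ₛ (-ℚ 1ℚ) (deriv a) X))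

-- Counting labelled structures

Unique-resp-↭ : {A : Set} {xs ys : List A} → xs ↭ ys → Unique xs → Unique ys
Unique-resp-↭ {A} p = SetoidPerm.Unique-resp-↭ (setoid A) (↭⇒↭ₛ p)

unique⇒↭ : {A : Set} {xs ys : List A} → Unique xs → Unique ys → (∀ x → x ∈ xs ⇔ x ∈ ys) → xs ↭ ys
unique⇒↭ uxs uys eq = ∼bag⇒↭ (unique∧set⇒bag uxs uys (eq _))

unique-++ˡ : {A : Set} (xs : List A) {ys : List A} → Unique (xs ++ ys) → Unique xs
unique-++ˡ [] _ = []
unique-++ˡ (x ∷ xs) (p ∷ u) = Allₚ.++⁻ˡ xs p ∷ unique-++ˡ xs u

unique-++-disjoint : {A : Set} (xs : List A) {ys : List A} → Unique (xs ++ ys) → ∀ {x} → x ∈ xs → x ∈ ys → ⊥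
unique-++-disjoint (x ∷ xs) (p ∷ _) (here refl) y∈ys = All.lookup p (∈-++⁺ʳ xs y∈ys) refl
unique-++-disjoint (x ∷ xs) (_ ∷ u) (there x∈xs) y∈ys = unique-++-disjoint xs u x∈xs y∈ys

-- `HasCount` for an arbitrary carrier, since bit vectors, pairs and words are counted besides
-- trees.
record Count {X : Set} (A : X → Set) (c : ℕ) : Set where
  constructor counted
  field
    list     : List X
    length≡  : length list ≡ c
    unique   : Unique list
    complete : ∀ x → (x ∈ list) ⇔ A x

fromHasCount : ∀ {A c} → HasCount A c → Count A c
fromHasCount (l , e , u , m) = counted l e u m

module _ {X : Set} where

  count-unique : ∀ {A : X → Set} {c d} → Count A c → Count A d → c ≡ d
  count-unique (counted l refl u m) (counted l′ refl u′ m′) = ↭-length (unique⇒↭ u u′ λ x →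
    mk⇔ (Equivalence.from (m′ x) ∘ Equivalence.to (m x)) (Equivalence.from (m x) ∘ Equivalence.to (m′ x)))

  count-resp-⇔ : ∀ {A B : X → Set} {c} → (∀ x → A x ⇔ B x) → Count A c → Count B c
  count-resp-⇔ e (counted l p u m) = counted l p u λ x →
    mk⇔ (Equivalence.to (e x) ∘ Equivalence.to (m x)) (Equivalence.from (m x) ∘ Equivalence.from (e x))

  count-⊥ : ∀ {A : X → Set} → (∀ x → ¬ A x) → Count A 0
  count-⊥ ¬A = counted [] refl [] λ x → mk⇔ (λ ()) (⊥-elim ∘ ¬A x)

  count-≡ : ∀ a → Count {X} (_≡ a) 1
  count-≡ a = counted (a ∷ []) refl ([] ∷ []) λ x → mk⇔ (λ { (here e) → e ; (there ()) }) here

  count-⊎ : ∀ {A B C : X → Set} {c d} → (∀ x → A x → B x → ⊥) →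
    (∀ x → A x → C x) → (∀ x → B x → C x) → (∀ x → C x → A x ⊎ B x) →
    Count A c → Count B d → Count C (c ℕ.+ d)
  count-⊎ dis f g h (counted l refl u m) (counted l′ refl u′ m′) = counted (l ++ l′) (length-++ l)
    (Uniqueₚ.++⁺ u u′ (λ (p , q) → dis _ (Equivalence.to (m _) p) (Equivalence.to (m′ _) q)))
    λ x → mk⇔
      (λ p → [ f x ∘ Equivalence.to (m x) , g x ∘ Equivalence.to (m′ x) ]′ (∈-++⁻ l p))
      (λ p → [ ∈-++⁺ˡ ∘ Equivalence.from (m x) , ∈-++⁺ʳ l ∘ Equivalence.from (m′ x) ]′ (h x p))

  count-× : ∀ {Y : Set} {A : X → Set} {B : Y → Set} {c d} →
    Count A c → Count B d → Count (λ (x , y) → A x × B y) (c ℕ.* d)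
  count-× (counted l refl u m) (counted l′ refl u′ m′) = counted (cartesianProduct l l′)
    (length-cartesianProduct l l′) (Uniqueₚ.cartesianProduct⁺ u u′)
    λ (x , y) → mk⇔
      (λ p → let (q , r) = ∈-cartesianProduct⁻ l l′ p in Equivalence.to (m x) q , Equivalence.to (m′ y) r)
      (λ (q , r) → ∈-cartesianProduct⁺ (Equivalence.from (m x) q) (Equivalence.from (m′ y) r))
    where
    length-cartesianProduct : ∀ {A B : Set} (xs : List A) (ys : List B) →
      length (cartesianProduct xs ys) ≡ length xs ℕ.* length ys
    length-cartesianProduct [] ys = refl
    length-cartesianProduct (x ∷ xs) ys = trans (length-++ (map (x ,_) ys))
      (cong₂ ℕ._+_ (length-map (x ,_) ys) (length-cartesianProduct xs ys))

  module _ {Y : Set} {A : X → Set} {B : Y → Set} (R : X → Y → Set)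
    (total      : ∀ {x} → A x → ∃ λ y → B y × R x y)
    (surjective : ∀ {y} → B y → ∃ λ x → A x × R x y)
    (injective  : ∀ {x x′ y} → A x → A x′ → R x y → R x′ y → x ≡ x′)
    (functional : ∀ {x y y′} → A x → B y → B y′ → R x y → R x y′ → y ≡ y′)
    where

    private
      image : ∀ l → Unique l → All A l → ∃ λ l′ → length l′ ≡ length l × Unique l′
        × (∀ {y} → y ∈ l′ → B y × ∃ λ x → x ∈ l × R x y)
        × (∀ {x} → x ∈ l → ∃ λ y → y ∈ l′ × R x y)
      image [] [] [] = [] , refl , [] , (λ ()) , λ ()
      image (x ∷ l) (x∉l ∷ u) (Ax ∷ Al) with total Ax | image l u Al
      ... | y , By , Rxy | l′ , e , u′ , back , forth =
        y ∷ l′ , cong suc e , All.tabulate (λ { y∈l′ refl → fresh y∈l′ }) ∷ u′ , back′ , forth′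
        where
        fresh : y ∉ l′
        fresh y∈l′ with back y∈l′
        ... | _ , x′ , x′∈l , Rx′y = All.lookup x∉l x′∈l (injective Ax (All.lookup Al x′∈l) Rxy Rx′y)
        back′ : ∀ {z} → z ∈ y ∷ l′ → B z × ∃ λ w → w ∈ x ∷ l × R w z
        back′ (here refl) = By , x , here refl , Rxy
        back′ (there z∈l′) with back z∈l′
        ... | Bz , w , w∈l , Rwz = Bz , w , there w∈l , Rwz
        forth′ : ∀ {w} → w ∈ x ∷ l → ∃ λ z → z ∈ y ∷ l′ × R w z
        forth′ (here refl) = y , here refl , Rxy
        forth′ (there w∈l) with forth w∈l
        ... | z , z∈l′ , Rwz = z , there z∈l′ , Rwz

    -- The bijection is given as a relation, so that neither direction has to be a function on the
    -- whole carrier. This suits `Cut`, where the word is found by searching the tree and the tree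
    -- is rebuilt from the word only under validity conditions.
    count-transfer : ∀ {c} → Count A c → Count B c
    count-transfer (counted l refl u m) with image l u (All.tabulate (Equivalence.to (m _)))
    ... | l′ , e , u′ , back , forth = counted l′ e u′ λ y → mk⇔ (proj₁ ∘ back) onto
      where
      onto : ∀ {y} → B y → y ∈ l′
      onto By with surjective By
      ... | x , Ax , Rxy with forth (Equivalence.from (m x) Ax)
      ... | y′ , y′∈l′ , Rxy′ with functional Ax By (proj₁ (back y′∈l′)) Rxy Rxy′
      ... | refl = y′∈l′

-- Subsets of {0,…,n-1} as bit vectors: embed enumerates the marked positions increasingly, and rank inverts it.

ones : ∀ {n} → Vec Bool n → ℕ
ones [] = 0
ones (true ∷ v) = suc (ones v)
ones (false ∷ v) = ones v

complement : ∀ {n} → Vec Bool n → Vec Bool n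
complement = Vec.map not

-- Positions beyond the end count as marked, in agreement with `embed []` and `rank []` being the
-- identity. This makes `embed-rank` and `at-embed` true without a bound on the index.
at : ∀ {n} → Vec Bool n → ℕ → Bool
at [] i = true
at (b ∷ v) zero = b
at (b ∷ v) (suc i) = at v i

embed : ∀ {n} → Vec Bool n → ℕ → ℕ
embed [] i = i
embed (true ∷ v) zero = zero
embed (true ∷ v) (suc i) = suc (embed v i)
embed (false ∷ v) i = suc (embed v i)

rank : ∀ {n} → Vec Bool n → ℕ → ℕ
rank [] i = i
rank (b ∷ v) zero = zero
rank (true ∷ v) (suc i) = suc (rank v i)
rank (false ∷ v) (suc i) = rank v i

Monotone : (ℕ → ℕ) → Set
Monotone f = ∀ {i j} → i ≤ j → f i ≤ f j

rank-embed : ∀ {n} (v : Vec Bool n) i → rank v (embed v i) ≡ i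
rank-embed [] i = refl
rank-embed (true ∷ v) zero = refl
rank-embed (true ∷ v) (suc i) = cong suc (rank-embed v i)
rank-embed (false ∷ v) i = rank-embed v i

embed-rank : ∀ {n} (v : Vec Bool n) i → at v i ≡ true → embed v (rank v i) ≡ i
embed-rank [] i p = refl
embed-rank (true ∷ v) zero p = refl
embed-rank (true ∷ v) (suc i) p = cong suc (embed-rank v i p)
embed-rank (false ∷ v) (suc i) p = cong suc (embed-rank v i p)

embed-mono : ∀ {n} (v : Vec Bool n) → Monotone (embed v)
embed-mono [] p = p
embed-mono (true ∷ v) {zero} p = z≤n
embed-mono (true ∷ v) {suc i} {suc j} (s≤s p) = s≤s (embed-mono v p)
embed-mono (false ∷ v) p = s≤s (embed-mono v p)

rank-mono : ∀ {n} (v : Vec Bool n) → Monotone (rank v)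
rank-mono [] p = p
rank-mono (b ∷ v) {zero} p = z≤n
rank-mono (true ∷ v) {suc i} {suc j} (s≤s p) = s≤s (rank-mono v p)
rank-mono (false ∷ v) {suc i} {suc j} (s≤s p) = rank-mono v p

rank< : ∀ {n} (v : Vec Bool n) {i} → i < n → at v i ≡ true → rank v i < ones v
rank< (true ∷ v) {zero} i<n p = s≤s z≤n
rank< (true ∷ v) {suc i} (s≤s i<n) p = s≤s (rank< v i<n p)
rank< (false ∷ v) {suc i} (s≤s i<n) p = rank< v i<n p

embed< : ∀ {n} (v : Vec Bool n) {i} → i < ones v → embed v i < n
embed< (true ∷ v) {zero} p = s≤s z≤n
embed< (true ∷ v) {suc i} (s≤s p) = s≤s (embed< v p)
embed< (false ∷ v) p = s≤s (embed< v p)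

at-embed : ∀ {n} (v : Vec Bool n) i → at v (embed v i) ≡ true
at-embed [] i = refl
at-embed (true ∷ v) zero = refl
at-embed (true ∷ v) (suc i) = at-embed v i
at-embed (false ∷ v) i = at-embed v i

at-complement : ∀ {n} (v : Vec Bool n) {i} → i < n → at (complement v) i ≡ not (at v i)
at-complement (b ∷ v) {zero} p = refl
at-complement (b ∷ v) {suc i} (s≤s p) = at-complement v p

at-ext : ∀ {n} (v w : Vec Bool n) → (∀ {i} → i < n → at v i ≡ true → at w i ≡ true) →
  (∀ {i} → i < n → at w i ≡ true → at v i ≡ true) → v ≡ w
at-ext [] [] p q = refl
at-ext (b ∷ v) (c ∷ w) p q = cong₂ _∷_ (bool b c (p (s≤s z≤n)) (q (s≤s z≤n)))
  (at-ext v w (p ∘ s≤s) (q ∘ s≤s))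
  where
  bool : ∀ b c → (b ≡ true → c ≡ true) → (c ≡ true → b ≡ true) → b ≡ c
  bool false false p q = refl
  bool false true p q = q refl
  bool true c p q = sym (p refl)

characteristic : ∀ n → List ℕ → Vec Bool n
characteristic n xs = Vec.tabulate λ i → does (toℕ i ∈? xs)

at-characteristic : ∀ {n i} xs → i < n → at (characteristic n xs) i ≡ does (i ∈? xs)
at-characteristic xs = go id
  where
  go : ∀ {n i} (f : ℕ → ℕ) → i < n → at (Vec.tabulate {n = n} (λ j → does (f (toℕ j) ∈? xs))) i ≡ does (f i ∈? xs)
  go {suc n} {zero} f p = refl
  go {suc n} {suc i} f (s≤s p) = go (f ∘ suc) p

marked : ∀ {n} → Vec Bool n → List ℕ
marked v = map (embed v) (upTo (ones v))

upTo-suc : ∀ n → upTo (suc n) ≡ 0 ∷ map suc (upTo n)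
upTo-suc n = cong (0 ∷_) (sym (map-upTo suc n))

marked-true : ∀ {n} (v : Vec Bool n) → marked (true ∷ v) ≡ 0 ∷ map suc (marked v)
marked-true v = trans (cong (map (embed (true ∷ v))) (upTo-suc (ones v)))
  (cong (0 ∷_) (trans (sym (map-∘ (upTo (ones v)))) (map-∘ (upTo (ones v)))))

marked-false : ∀ {n} (v : Vec Bool n) → marked (false ∷ v) ≡ map suc (marked v)
marked-false v = map-∘ (upTo (ones v))

marked-partition : ∀ {n} (v : Vec Bool n) → marked v ++ marked (complement v) ↭ upTo n
marked-partition [] = ↭-refl
marked-partition {suc n} (true ∷ v) = begin
  marked (true ∷ v) ++ marked (false ∷ complement v)
    ≡⟨ cong₂ _++_ (marked-true v) (marked-false (complement v)) ⟩
  0 ∷ map suc (marked v) ++ map suc (marked (complement v))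
    ≡⟨ cong (0 ∷_) (sym (map-++ suc (marked v) _)) ⟩
  0 ∷ map suc (marked v ++ marked (complement v))
    ↭⟨ ↭-prep 0 (↭-map⁺ suc (marked-partition v)) ⟩
  0 ∷ map suc (upTo n)
    ≡⟨ sym (upTo-suc n) ⟩
  upTo (suc n) ∎
  where open PermutationReasoning
marked-partition {suc n} (false ∷ v) = begin
  marked (false ∷ v) ++ marked (true ∷ complement v)
    ≡⟨ cong₂ _++_ (marked-false v) (marked-true (complement v)) ⟩
  map suc (marked v) ++ 0 ∷ map suc (marked (complement v))
    ↭⟨ shift 0 (map suc (marked v)) _ ⟩
  0 ∷ map suc (marked v) ++ map suc (marked (complement v))
    ≡⟨ cong (0 ∷_) (sym (map-++ suc (marked v) _)) ⟩
  0 ∷ map suc (marked v ++ marked (complement v))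
    ↭⟨ ↭-prep 0 (↭-map⁺ suc (marked-partition v)) ⟩
  0 ∷ map suc (upTo n)
    ≡⟨ sym (upTo-suc n) ⟩
  upTo (suc n) ∎
  where open PermutationReasoning

∈-marked⁻ : ∀ {n} (v : Vec Bool n) {i} → i ∈ marked v → i < n × at v i ≡ true
∈-marked⁻ v p with ∈-map⁻ (embed v) p
... | k , k∈ , refl = embed< v (∈-upTo⁻ k∈) , at-embed v k

∈-marked⁺ : ∀ {n} (v : Vec Bool n) {i} → i < n → at v i ≡ true → i ∈ marked v
∈-marked⁺ v {i} i<n p = subst (_∈ marked v) (embed-rank v i p) (∈-map⁺ (embed v) (∈-upTo⁺ (rank< v i<n p)))

unique-marked : ∀ {n} (v : Vec Bool n) → Unique (marked v)
unique-marked v = Uniqueₚ.map⁺ (λ {i} {j} e → trans (sym (rank-embed v i)) (trans (cong (rank v) e) (rank-embed v j)))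
  (Uniqueₚ.upTo⁺ (ones v))

map-rank-marked : ∀ {n} (v : Vec Bool n) → map (rank v) (marked v) ≡ upTo (ones v)
map-rank-marked v = trans (sym (map-∘ (upTo (ones v)))) (map-id-local (All.universal (rank-embed v) _))

-- Products of labelled classes

InjectiveOn : List ℕ → (ℕ → ℕ) → Set
InjectiveOn xs f = ∀ {i j} → i ∈ xs → j ∈ xs → f i ≡ f j → i ≡ j

-- A labelled class in the spirit of species, but transported only along monotone maps injective on
-- the labels: siblings are listed by increasing minimal leaf, and other relabellings could break
-- that order.
record Labelled : Set₁ where
  field
    Carrier        : Set
    labels         : Carrier → List ℕ
    rename         : (ℕ → ℕ) → Carrier → Carrier
    Valid          : Carrier → Set
    labels-rename  : ∀ f x → labels (rename f x) ≡ map f (labels x)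
    rename-inverse : ∀ f g x → (∀ {i} → i ∈ labels x → g (f i) ≡ i) → rename g (rename f x) ≡ x
    rename-valid   : ∀ f x → Monotone f → InjectiveOn (labels x) f → Valid x → Valid (rename f x)

  OfSize : ℕ → Carrier → Set
  OfSize n x = Valid x × labels x ↭ upTo n

-- The head bit decides which of the two factors receives label 0, and the size of that factor grows
-- by one: this is the recursion of `binomialConv`.
count-subsets : ∀ {X Y : Set} {A : ℕ → X → Set} {B : ℕ → Y → Set} {c d} n →
  (∀ k → Count (A k) (c k)) → (∀ k → Count (B k) (d k)) →
  Count {Vec Bool n × X × Y} (λ (v , x , y) → A (ones v) x × B (ones (complement v)) y) (binomialConv c d n)
count-subsets zero a b = count-transfer (λ z w → ([] , z) ≡ w)
  (λ {z} p → ([] , z) , p , refl) (λ { {[] , z} p → z , p , refl }) (λ { _ _ refl refl → refl })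
  (λ { _ _ _ refl refl → refl }) (count-× (a 0) (b 0))
count-subsets {X} {Y} {A} {B} {c} {d} (suc n) a b = count-⊎
  {A = λ z → Q z × Vec.head (proj₁ z) ≡ true} {B = λ z → Q z × Vec.head (proj₁ z) ≡ false}
  (λ { (true ∷ v , _) _ (_ , ()) ; (false ∷ v , _) (_ , ()) _ })
  (λ _ → proj₁) (λ _ → proj₁)
  (λ { (true ∷ v , _) q → inj₁ (q , refl) ; (false ∷ v , _) q → inj₂ (q , refl) })
  (count-transfer (λ (v , z) w → (true ∷ v , z) ≡ w)
    (λ { {v , z} p → (true ∷ v , z) , (p , refl) , refl })
    (λ { {true ∷ v , z} (p , _) → (v , z) , p , refl ; {false ∷ v , z} (_ , ()) })
    (λ { _ _ refl refl → refl }) (λ { _ _ _ refl refl → refl })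
    (count-subsets n (a ∘ suc) b))
  (count-transfer (λ (v , z) w → (false ∷ v , z) ≡ w)
    (λ { {v , z} p → (false ∷ v , z) , (p , refl) , refl })
    (λ { {false ∷ v , z} (p , _) → (v , z) , p , refl ; {true ∷ v , z} (_ , ()) })
    (λ { _ _ refl refl → refl }) (λ { _ _ _ refl refl → refl })
    (count-subsets n a (b ∘ suc)))
  where
  Q : Vec Bool (suc n) × X × Y → Set
  Q (v , x , y) = A (ones v) x × B (ones (complement v)) y

module _ (𝓐 𝓑 : Labelled) where
  private
    module A = Labelled 𝓐
    module B = Labelled 𝓑

  PairOfSize : ℕ → A.Carrier × B.Carrier → Set
  PairOfSize n (x , y) = (A.Valid x × B.Valid y) × A.labels x ++ B.labels y ↭ upTo n

  private
    spread : ∀ {n} → Vec Bool n × A.Carrier × B.Carrier → A.Carrier × B.Carrier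
    spread (v , x , y) = A.rename (embed v) x , B.rename (embed (complement v)) y

  module _ (𝓒 : Labelled) where
    open Labelled 𝓒

    labels-embed : ∀ {n} (v : Vec Bool n) {x} → labels x ↭ upTo (ones v) → labels (rename (embed v) x) ↭ marked v
    labels-embed v {x} p = ↭-trans (↭-reflexive (labels-rename (embed v) x)) (↭-map⁺ (embed v) p)

    embed-valid : ∀ {n} (v : Vec Bool n) {x} → Valid x → Valid (rename (embed v) x)
    embed-valid v {x} = rename-valid (embed v) x (embed-mono v)
      (λ {i} {j} _ _ e → trans (sym (rank-embed v i)) (trans (cong (rank v) e) (rank-embed v j)))

    rename-embed-injective : ∀ {n} (v : Vec Bool n) {x y} → rename (embed v) x ≡ rename (embed v) y → x ≡ y
    rename-embed-injective v {x} {y} e = trans (sym (rename-inverse (embed v) (rank v) x (λ _ → rank-embed v _)))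
      (trans (cong (rename (rank v)) e) (rename-inverse (embed v) (rank v) y (λ _ → rank-embed v _)))

    -- The inverse of embedding: ranks bring the labels of one part to an initial segment, and
    -- `embed` restores them because each of these labels is marked.
    compress : ∀ {n} (v : Vec Bool n) {x} → labels x ↭ marked v → Valid x →
      OfSize (ones v) (rename (rank v) x) × rename (embed v) (rename (rank v) x) ≡ x
    compress v {x} p val = (rename-valid (rank v) x (rank-mono v) inj val , perm) , rename-inverse (rank v) (embed v) x back
      where
      back : ∀ {i} → i ∈ labels x → embed v (rank v i) ≡ i
      back i∈ = embed-rank v _ (proj₂ (∈-marked⁻ v (∈-resp-↭ p i∈)))
      inj : InjectiveOn (labels x) (rank v)
      inj i∈ j∈ e = trans (sym (back i∈)) (trans (cong (embed v) e) (back j∈))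
      perm : labels (rename (rank v) x) ↭ upTo (ones v)
      perm = ↭-trans (↭-reflexive (labels-rename (rank v) x))
        (↭-trans (↭-map⁺ (rank v) p) (↭-reflexive (map-rank-marked v)))

  -- The product rule for labelled classes: a pair amounts to the label set of its first component
  -- together with two structures on initial segments.
  count-pairs : ∀ {c d} → (∀ n → Count (A.OfSize n) (c n)) → (∀ n → Count (B.OfSize n) (d n)) →
    ∀ n → Count (PairOfSize n) (binomialConv c d n)
  count-pairs a b n = count-transfer (λ z w → spread z ≡ w) total surj
    inj (λ { _ _ _ refl refl → refl }) (count-subsets n a b)
    where
    Split : Vec Bool n × A.Carrier × B.Carrier → Set
    Split (v , x , y) = A.OfSize (ones v) x × B.OfSize (ones (complement v)) y

    total : ∀ {z} → Split z → ∃ λ w → PairOfSize n w × spread z ≡ w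
    total {v , x , y} ((vx , px) , (vy , py)) = spread (v , x , y) ,
      ((embed-valid 𝓐 v vx , embed-valid 𝓑 (complement v) vy) ,
       ↭-trans (++⁺ (labels-embed 𝓐 v px) (labels-embed 𝓑 (complement v) py)) (marked-partition v)) , refl

    inj : ∀ {z z′ w} → Split z → Split z′ → spread z ≡ w → spread z′ ≡ w → z ≡ z′
    -- The bit vector is recovered from the pair, since its marked positions are exactly the labels
    -- of the first component.
    inj {v , x , y} {v′ , x′ , y′} ((_ , px) , _) ((_ , px′) , _) refl e
      with at-ext v v′ (incl v v′ px px′ (sym (cong proj₁ e))) (incl v′ v px′ px (cong proj₁ e))
      where
      incl : ∀ (v v′ : Vec Bool n) {x x′} → A.labels x ↭ upTo (ones v) → A.labels x′ ↭ upTo (ones v′) →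
        A.rename (embed v) x ≡ A.rename (embed v′) x′ → ∀ {i} → i < n → at v i ≡ true → at v′ i ≡ true
      incl v v′ px px′ e {i} i<n p = proj₂ (∈-marked⁻ v′ (∈-resp-↭ (labels-embed 𝓐 v′ px′)
        (subst (λ z → i ∈ A.labels z) e (∈-resp-↭ (↭-sym (labels-embed 𝓐 v px)) (∈-marked⁺ v i<n p)))))
    ... | refl = cong₂ (λ x y → v , x , y) (rename-embed-injective 𝓐 v (sym (cong proj₁ e)))
      (rename-embed-injective 𝓑 (complement v) (sym (cong proj₂ e)))

    surj : ∀ {w} → PairOfSize n w → ∃ λ z → Split z × spread z ≡ w
    surj {X , Y} ((vX , vY) , p) =
      let (sX , eX) = compress 𝓐 v pX vX; (sY , eY) = compress 𝓑 (complement v) pY vY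
      in _ , (sX , sY) , cong₂ _,_ eX eY
      where
      v = characteristic n (A.labels X)
      u : Unique (A.labels X ++ B.labels Y)
      u = Unique-resp-↭ (↭-sym p) (Uniqueₚ.upTo⁺ n)
      dis : ∀ {i} → i ∈ A.labels X → i ∈ B.labels Y → ⊥
      dis = unique-++-disjoint (A.labels X) u
      bound : ∀ {i} → i ∈ A.labels X ++ B.labels Y → i < n
      bound = ∈-upTo⁻ ∘ ∈-resp-↭ p
      pX : A.labels X ↭ marked v
      pX = unique⇒↭ (unique-++ˡ (A.labels X) u) (unique-marked v) λ i → mk⇔
        (λ i∈ → let i<n = bound (∈-++⁺ˡ i∈) in
          ∈-marked⁺ v i<n (trans (at-characteristic (A.labels X) i<n) (dec-true (i ∈? A.labels X) i∈)))
        (λ i∈ → let (i<n , q) = ∈-marked⁻ v i∈ in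
          decide i (trans (sym (at-characteristic (A.labels X) i<n)) q))
        where
        decide : ∀ i → does (i ∈? A.labels X) ≡ true → i ∈ A.labels X
        decide i q with i ∈? A.labels X
        ... | yes i∈ = i∈
      pY : B.labels Y ↭ marked (complement v)
      pY = unique⇒↭ (unique-++ˡ (B.labels Y) (Unique-resp-↭ (++-comm (A.labels X) (B.labels Y)) u))
        (unique-marked (complement v)) λ i → mk⇔
        (λ i∈ → let i<n = bound (∈-++⁺ʳ (A.labels X) i∈) in
          ∈-marked⁺ (complement v) i<n (trans (at-complement v i<n) (cong not
            (trans (at-characteristic (A.labels X) i<n) (dec-false (i ∈? A.labels X) (λ i∈X → dis i∈X i∈))))))
        (λ i∈ → let (i<n , q) = ∈-marked⁻ (complement v) i∈ in
          [ (λ i∈X → ⊥-elim (true≢false (trans (sym q) (trans (at-complement v i<n) (cong not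
              (trans (at-characteristic (A.labels X) i<n) (dec-true (i ∈? A.labels X) i∈X)))))))
          , id ]′ (∈-++⁻ (A.labels X) (∈-resp-↭ (↭-sym p) (∈-upTo⁺ i<n))))
        where
        true≢false : true ≡ false → ⊥
        true≢false ()

-- Decomposition trees

mutual
  renameT : (ℕ → ℕ) → Tree → Tree
  renameT f (leaf i) = leaf (f i)
  renameT f blossom = blossom
  renameT f (node⊕ ts) = node⊕ (renameL f ts)
  renameT f (node⊖ ts) = node⊖ (renameL f ts)
  renameT f (nodeP k H ts) = nodeP k H (renameV f ts)

  renameL : (ℕ → ℕ) → List Tree → List Tree
  renameL f [] = []
  renameL f (t ∷ ts) = renameT f t ∷ renameL f ts

  renameV : ∀ {k} → (ℕ → ℕ) → Vec Tree k → Vec Tree k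
  renameV f [] = []
  renameV f (t ∷ ts) = renameT f t ∷ renameV f ts

mutual
  leaves-rename : ∀ f t → leaves (renameT f t) ≡ map f (leaves t)
  leaves-rename f (leaf i) = refl
  leaves-rename f blossom = refl
  leaves-rename f (node⊕ ts) = leavesL-rename f ts
  leaves-rename f (node⊖ ts) = leavesL-rename f ts
  leaves-rename f (nodeP k H ts) = leavesV-rename f ts

  leavesL-rename : ∀ f ts → leavesL (renameL f ts) ≡ map f (leavesL ts)
  leavesL-rename f [] = refl
  leavesL-rename f (t ∷ ts) = trans (cong₂ _++_ (leaves-rename f t) (leavesL-rename f ts))
    (sym (map-++ f (leaves t) (leavesL ts)))

  leavesV-rename : ∀ {k} f (ts : Vec Tree k) → leavesV (renameV f ts) ≡ map f (leavesV ts)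
  leavesV-rename f [] = refl
  leavesV-rename f (t ∷ ts) = trans (cong₂ _++_ (leaves-rename f t) (leavesV-rename f ts))
    (sym (map-++ f (leaves t) (leavesV ts)))

mutual
  renameT-inverse : ∀ f g t → (∀ {i} → i ∈ leaves t → g (f i) ≡ i) → renameT g (renameT f t) ≡ t
  renameT-inverse f g (leaf i) p = cong leaf (p (here refl))
  renameT-inverse f g blossom p = refl
  renameT-inverse f g (node⊕ ts) p = cong node⊕ (renameL-inverse f g ts p)
  renameT-inverse f g (node⊖ ts) p = cong node⊖ (renameL-inverse f g ts p)
  renameT-inverse f g (nodeP k H ts) p = cong (nodeP k H) (renameV-inverse f g ts p)

  renameL-inverse : ∀ f g ts → (∀ {i} → i ∈ leavesL ts → g (f i) ≡ i) → renameL g (renameL f ts) ≡ ts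
  renameL-inverse f g [] p = refl
  renameL-inverse f g (t ∷ ts) p = cong₂ _∷_ (renameT-inverse f g t (p ∘ ∈-++⁺ˡ))
    (renameL-inverse f g ts (p ∘ ∈-++⁺ʳ (leaves t)))

  renameV-inverse : ∀ {k} f g (ts : Vec Tree k) → (∀ {i} → i ∈ leavesV ts → g (f i) ≡ i) →
    renameV g (renameV f ts) ≡ ts
  renameV-inverse f g [] p = refl
  renameV-inverse f g (t ∷ ts) p = cong₂ _∷_ (renameT-inverse f g t (p ∘ ∈-++⁺ˡ))
    (renameV-inverse f g ts (p ∘ ∈-++⁺ʳ (leaves t)))

mutual
  renameT-fixed : ∀ f t → (∀ {i} → i ∈ leaves t → f i ≡ i) → renameT f t ≡ t
  renameT-fixed f (leaf i) p = cong leaf (p (here refl))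
  renameT-fixed f blossom p = refl
  renameT-fixed f (node⊕ ts) p = cong node⊕ (renameL-fixed f ts p)
  renameT-fixed f (node⊖ ts) p = cong node⊖ (renameL-fixed f ts p)
  renameT-fixed f (nodeP k H ts) p = cong (nodeP k H) (renameV-fixed f ts p)

  renameL-fixed : ∀ f ts → (∀ {i} → i ∈ leavesL ts → f i ≡ i) → renameL f ts ≡ ts
  renameL-fixed f [] p = refl
  renameL-fixed f (t ∷ ts) p = cong₂ _∷_ (renameT-fixed f t (p ∘ ∈-++⁺ˡ)) (renameL-fixed f ts (p ∘ ∈-++⁺ʳ (leaves t)))

  renameV-fixed : ∀ {k} f (ts : Vec Tree k) → (∀ {i} → i ∈ leavesV ts → f i ≡ i) → renameV f ts ≡ ts
  renameV-fixed f [] p = refl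
  renameV-fixed f (t ∷ ts) p = cong₂ _∷_ (renameT-fixed f t (p ∘ ∈-++⁺ˡ)) (renameV-fixed f ts (p ∘ ∈-++⁺ʳ (leaves t)))

leavesL-++ : ∀ ss ts → leavesL (ss ++ ts) ≡ leavesL ss ++ leavesL ts
leavesL-++ [] ts = refl
leavesL-++ (s ∷ ss) ts = trans (cong (leaves s ++_) (leavesL-++ ss ts)) (sym (++-assoc (leaves s) (leavesL ss) (leavesL ts)))

leavesL-insert : ∀ xs b ys → leavesL (xs ++ b ∷ ys) ↭ leaves b ++ leavesL (xs ++ ys)
leavesL-insert xs b ys = begin
  leavesL (xs ++ b ∷ ys)                 ≡⟨ leavesL-++ xs (b ∷ ys) ⟩
  leavesL xs ++ leaves b ++ leavesL ys   ↭⟨ shifts (leavesL xs) (leaves b) ⟩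
  leaves b ++ leavesL xs ++ leavesL ys   ≡⟨ cong (leaves b ++_) (sym (leavesL-++ xs ys)) ⟩
  leaves b ++ leavesL (xs ++ ys) ∎
  where open PermutationReasoning

leavesV-toList : ∀ {k} (ts : Vec Tree k) → leavesV ts ≡ leavesL (toList ts)
leavesV-toList [] = refl
leavesV-toList (t ∷ ts) = cong (leaves t ++_) (leavesV-toList ts)

renameL-++ : ∀ f ss ts → renameL f (ss ++ ts) ≡ renameL f ss ++ renameL f ts
renameL-++ f [] ts = refl
renameL-++ f (s ∷ ss) ts = cong (renameT f s ∷_) (renameL-++ f ss ts)

renameV-toList : ∀ {k} f (ts : Vec Tree k) → toList (renameV f ts) ≡ renameL f (toList ts)
renameV-toList f [] = refl
renameV-toList f (t ∷ ts) = cong (renameT f t ∷_) (renameV-toList f ts)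

length-renameL : ∀ f ts → length (renameL f ts) ≡ length ts
length-renameL f [] = refl
length-renameL f (t ∷ ts) = cong suc (length-renameL f ts)

mutual
  hasBlossom-rename : ∀ f t → hasBlossom (renameT f t) ≡ hasBlossom t
  hasBlossom-rename f (leaf i) = refl
  hasBlossom-rename f blossom = refl
  hasBlossom-rename f (node⊕ ts) = hasBlossomL-rename f ts
  hasBlossom-rename f (node⊖ ts) = hasBlossomL-rename f ts
  hasBlossom-rename f (nodeP k H ts) = hasBlossomV-rename f ts

  hasBlossomL-rename : ∀ f ts → hasBlossomL (renameL f ts) ≡ hasBlossomL ts
  hasBlossomL-rename f [] = refl
  hasBlossomL-rename f (t ∷ ts) = cong₂ (λ b c → if b then true else c) (hasBlossom-rename f t) (hasBlossomL-rename f ts)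

  hasBlossomV-rename : ∀ {k} f (ts : Vec Tree k) → hasBlossomV (renameV f ts) ≡ hasBlossomV ts
  hasBlossomV-rename f [] = refl
  hasBlossomV-rename f (t ∷ ts) = cong₂ (λ b c → if b then true else c) (hasBlossom-rename f t) (hasBlossomV-rename f ts)

-- Minimal leaves and the order of siblings

minList-∈ : ∀ x xs → minList (x ∷ xs) ∈ x ∷ xs
minList-∈ x [] = here refl
minList-∈ x (y ∷ xs) = [ here , (λ e → there (subst (_∈ y ∷ xs) (sym e) (minList-∈ y xs))) ]′
  (ℕₚ.⊓-sel x (minList (y ∷ xs)))

minList-map : ∀ f → Monotone f → ∀ x xs → minList (map f (x ∷ xs)) ≡ f (minList (x ∷ xs))
minList-map f mono x [] = refl
minList-map f mono x (y ∷ xs) = trans (cong (f x ⊓_) (minList-map f mono y xs))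
  (sym (ℕₚ.mono-≤-distrib-⊓ mono x (minList (y ∷ xs))))

NonEmpty : Tree → Set
NonEmpty t = ∃ λ x → ∃ λ xs → leaves t ≡ x ∷ xs

minLeaf-∈ : ∀ {t} → NonEmpty t → minLeaf t ∈ leaves t
minLeaf-∈ (x , xs , e) = subst (λ l → minList l ∈ l) (sym e) (minList-∈ x xs)

minLeaf-rename : ∀ {f t} → Monotone f → NonEmpty t → minLeaf (renameT f t) ≡ f (minLeaf t)
minLeaf-rename {f} {t} mono (x , xs , e) = trans (cong minList (trans (leaves-rename f t) (cong (map f) e)))
  (trans (minList-map f mono x xs) (cong (f ∘ minList) (sym e)))

leavesL-∈ : ∀ {t ts i} → t ∈ ts → i ∈ leaves t → i ∈ leavesL ts
leavesL-∈ (here refl) p = ∈-++⁺ˡ p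
leavesL-∈ {ts = s ∷ _} (there t∈) p = ∈-++⁺ʳ (leaves s) (leavesL-∈ t∈ p)

MinLess : Tree → Tree → Set
MinLess s t = minLeaf s < minLeaf t

Sorted : List Tree → Set
Sorted = AllPairs MinLess

toSorted : ∀ {ts} → SortedByMin ts → Sorted ts
toSorted {ts} = Linkedₚ.Linked⇒AllPairs (λ {s} {t} {u} → ℕₚ.<-trans {minLeaf s} {minLeaf t} {minLeaf u}) ∘ Linkedₚ.map⁻

fromSorted : ∀ {ts} → Sorted ts → SortedByMin ts
fromSorted = Linkedₚ.map⁺ ∘ Linkedₚ.AllPairs⇒Linked

-- A monotone map commutes with minima, hence keeps the order weakly. Strictness comes from
-- injectivity, as both minima are labels of the forest.
Sorted-rename : ∀ {f} ts → Monotone f → InjectiveOn (leavesL ts) f → All NonEmpty ts → Sorted ts → Sorted (renameL f ts)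
Sorted-rename [] mono inj [] [] = []
Sorted-rename {f} (t ∷ ts) mono inj (ne ∷ nes) (p ∷ ps) = go ts nes p there ∷
  Sorted-rename ts mono (λ i∈ j∈ → inj (∈-++⁺ʳ (leaves t) i∈) (∈-++⁺ʳ (leaves t) j∈)) nes ps
  where
  go : ∀ us → All NonEmpty us → All (MinLess t) us → (∀ {u} → u ∈ us → u ∈ t ∷ ts) → All (MinLess (renameT f t)) (renameL f us)
  go [] [] [] sub = []
  go (u ∷ us) (n ∷ ns) (q ∷ qs) sub = subst₂ _<_ (sym (minLeaf-rename {t = t} mono ne)) (sym (minLeaf-rename {t = u} mono n))
    (ℕₚ.≤∧≢⇒< (mono (ℕₚ.<⇒≤ q)) (λ e → ℕₚ.<⇒≢ q
      (inj (leavesL-∈ {t} {t ∷ ts} (here refl) (minLeaf-∈ {t} ne)) (leavesL-∈ {u} (sub (here refl)) (minLeaf-∈ {u} n)) e)))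
    ∷ go us ns qs (sub ∘ there)

data Sign : Set where
  ⊕ ⊖ : Sign

node : Sign → List Tree → Tree
node ⊕ = node⊕
node ⊖ = node⊖

RootNot : Sign → Tree → Set
RootNot ⊕ = RootNot⊕
RootNot ⊖ = RootNot⊖

RootNot-rename : ∀ c {f} t → RootNot c t → RootNot c (renameT f t)
RootNot-rename ⊕ (leaf _) p = p
RootNot-rename ⊕ blossom p = p
RootNot-rename ⊕ (node⊖ _) p = p
RootNot-rename ⊕ (nodeP _ _ _) p = p
RootNot-rename ⊖ (leaf _) p = p
RootNot-rename ⊖ blossom p = p
RootNot-rename ⊖ (node⊕ _) p = p
RootNot-rename ⊖ (nodeP _ _ _) p = p

leaves-node : ∀ c ts → leaves (node c ts) ≡ leavesL ts
leaves-node ⊕ ts = refl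
leaves-node ⊖ ts = refl

rename-node : ∀ c f ts → renameT f (node c ts) ≡ node c (renameL f ts)
rename-node ⊕ f ts = refl
rename-node ⊖ f ts = refl

-- A nonempty forest whose trees are not rooted at c is the same thing as one tree.

join : Sign → List Tree → Tree
join c (t ∷ []) = t
join c ts = node c ts

split : Sign → Tree → List Tree
split ⊕ (node⊕ ts) = ts
split ⊖ (node⊖ ts) = ts
split c t = t ∷ []

split-node : ∀ c ts → split c (node c ts) ≡ ts
split-node ⊕ ts = refl
split-node ⊖ ts = refl

split-RootNot : ∀ c t → RootNot c t → split c t ≡ t ∷ []
split-RootNot ⊕ (leaf _) p = refl
split-RootNot ⊕ blossom p = refl
split-RootNot ⊕ (node⊖ _) p = refl
split-RootNot ⊕ (nodeP _ _ _) p = refl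
split-RootNot ⊖ (leaf _) p = refl
split-RootNot ⊖ blossom p = refl
split-RootNot ⊖ (node⊕ _) p = refl
split-RootNot ⊖ (nodeP _ _ _) p = refl

root? : ∀ c t → (∃ λ ts → t ≡ node c ts) ⊎ RootNot c t
root? ⊕ (leaf _) = inj₂ tt
root? ⊕ blossom = inj₂ tt
root? ⊕ (node⊕ ts) = inj₁ (ts , refl)
root? ⊕ (node⊖ _) = inj₂ tt
root? ⊕ (nodeP _ _ _) = inj₂ tt
root? ⊖ (leaf _) = inj₂ tt
root? ⊖ blossom = inj₂ tt
root? ⊖ (node⊕ _) = inj₂ tt
root? ⊖ (node⊖ ts) = inj₁ (ts , refl)
root? ⊖ (nodeP _ _ _) = inj₂ tt

split-rename : ∀ c f t → split c (renameT f t) ≡ renameL f (split c t)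
split-rename c f t with root? c t
... | inj₁ (ts , refl) = trans (cong (split c) (rename-node c f ts))
  (trans (split-node c (renameL f ts)) (cong (renameL f) (sym (split-node c ts))))
... | inj₂ p = trans (split-RootNot c (renameT f t) (RootNot-rename c t p)) (cong (renameL f) (sym (split-RootNot c t p)))

leaves-join : ∀ c ts → leaves (join c ts) ≡ leavesL ts
leaves-join c [] = leaves-node c []
leaves-join c (t ∷ []) = sym (++-identityʳ (leaves t))
leaves-join c (t ∷ u ∷ ts) = leaves-node c (t ∷ u ∷ ts)

leaves-split : ∀ c t → leavesL (split c t) ≡ leaves t
leaves-split c t with root? c t
... | inj₁ (ts , refl) = trans (cong leavesL (split-node c ts)) (sym (leaves-node c ts))
... | inj₂ p = trans (cong leavesL (split-RootNot c t p)) (++-identityʳ (leaves t))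

length-insert : ∀ {A : Set} (xs : List A) {y ys} → length (xs ++ y ∷ ys) ≡ suc (length (xs ++ ys))
length-insert [] = refl
length-insert (x ∷ xs) = cong suc (length-insert xs)

-- Well-formed trees and their operands

module WellFormed (P : (k : ℕ) → Graph k → Set) (P⇒prime : ∀ k H → P k H → IsPrime k H) where

  IsOperand : Sign → Tree → Set
  IsOperand c t = WF P t × RootNot c t

  private
    operands⊕ : ∀ ts → AllNot⊕ P ts ⇔ All (IsOperand ⊕) ts
    operands⊕ ts = mk⇔ (to ts) from
      where
      to : ∀ ts → AllNot⊕ P ts → All (IsOperand ⊕) ts
      to [] _ = []
      to (t ∷ ts) (w , r , p) = (w , r) ∷ to ts p
      from : ∀ {ts} → All (IsOperand ⊕) ts → AllNot⊕ P ts
      from [] = tt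
      from ((w , r) ∷ p) = w , r , from p

    operands⊖ : ∀ ts → AllNot⊖ P ts ⇔ All (IsOperand ⊖) ts
    operands⊖ ts = mk⇔ (to ts) from
      where
      to : ∀ ts → AllNot⊖ P ts → All (IsOperand ⊖) ts
      to [] _ = []
      to (t ∷ ts) (w , r , p) = (w , r) ∷ to ts p
      from : ∀ {ts} → All (IsOperand ⊖) ts → AllNot⊖ P ts
      from [] = tt
      from ((w , r) ∷ p) = w , r , from p

  WFV⇔All : ∀ {k} (ts : Vec Tree k) → WFV P ts ⇔ All (WF P) (toList ts)
  WFV⇔All ts = mk⇔ (to ts) (from ts)
    where
    to : ∀ {k} (ts : Vec Tree k) → WFV P ts → All (WF P) (toList ts)
    to [] _ = []
    to (t ∷ ts) (w , p) = w ∷ to ts p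
    from : ∀ {k} (ts : Vec Tree k) → All (WF P) (toList ts) → WFV P ts
    from [] _ = tt
    from (t ∷ ts) (w ∷ p) = w , from ts p

  WF-node⁻ : ∀ c {ts} → WF P (node c ts) → 2 ≤ length ts × Sorted ts × All (IsOperand c) ts
  WF-node⁻ ⊕ {ts} (l , s , p) = l , toSorted s , Equivalence.to (operands⊕ ts) p
  WF-node⁻ ⊖ {ts} (l , s , p) = l , toSorted s , Equivalence.to (operands⊖ ts) p

  WF-node⁺ : ∀ c {ts} → 2 ≤ length ts → Sorted ts → All (IsOperand c) ts → WF P (node c ts)
  WF-node⁺ ⊕ {ts} l s p = l , fromSorted s , Equivalence.from (operands⊕ ts) p
  WF-node⁺ ⊖ {ts} l s p = l , fromSorted s , Equivalence.from (operands⊖ ts) p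

  NonEmpty-node : ∀ {t} ts → NonEmpty t → ∃ λ x → ∃ λ xs → leavesL (t ∷ ts) ≡ x ∷ xs
  NonEmpty-node ts (x , xs , e) = x , xs ++ leavesL ts , cong (_++ leavesL ts) e

  WF⇒NonEmpty : ∀ t → WF P t → NonEmpty t
  WF⇒NonEmpty (leaf i) _ = i , [] , refl
  WF⇒NonEmpty (node⊕ []) (() , _)
  WF⇒NonEmpty (node⊕ (t ∷ ts)) (_ , _ , w , _) = NonEmpty-node {t} ts (WF⇒NonEmpty t w)
  WF⇒NonEmpty (node⊖ []) (() , _)
  WF⇒NonEmpty (node⊖ (t ∷ ts)) (_ , _ , w , _) = NonEmpty-node {t} ts (WF⇒NonEmpty t w)
  WF⇒NonEmpty (nodeP k H []) (p , _) with P⇒prime k H p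
  ... | () , _
  WF⇒NonEmpty (nodeP k H (t ∷ ts)) (p , _ , w , _) = subst (λ l → ∃ λ x → ∃ λ xs → l ≡ x ∷ xs)
    (cong (leaves t ++_) (sym (leavesV-toList ts))) (NonEmpty-node {t} (toList ts) (WF⇒NonEmpty t w))

  mutual
    WF-rename : ∀ f t → Monotone f → InjectiveOn (leaves t) f → WF P t → WF P (renameT f t)
    WF-rename f (leaf i) mono inj w = tt
    WF-rename f (node⊕ ts) mono inj w = let (l , s , p) = WF-node⁻ ⊕ {ts} w in
      WF-node⁺ ⊕ (subst (2 ≤_) (sym (length-renameL f ts)) l)
        (Sorted-rename ts mono inj (All.map (λ {t} → WF⇒NonEmpty t ∘ proj₁) p) s) (operands-rename ⊕ f ts mono inj p)
    WF-rename f (node⊖ ts) mono inj w = let (l , s , p) = WF-node⁻ ⊖ {ts} w in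
      WF-node⁺ ⊖ (subst (2 ≤_) (sym (length-renameL f ts)) l)
        (Sorted-rename ts mono inj (All.map (λ {t} → WF⇒NonEmpty t ∘ proj₁) p) s) (operands-rename ⊖ f ts mono inj p)
    WF-rename f (nodeP k H ts) mono inj (p , s , w) = p , SortedV-rename f ts mono inj s w , WFV-rename f ts mono inj w

    operands-rename : ∀ c f ts → Monotone f → InjectiveOn (leavesL ts) f → All (IsOperand c) ts → All (IsOperand c) (renameL f ts)
    operands-rename c f [] mono inj [] = []
    operands-rename c f (t ∷ ts) mono inj ((w , r) ∷ p) =
      (WF-rename f t mono (λ i∈ j∈ → inj (∈-++⁺ˡ i∈) (∈-++⁺ˡ j∈)) w , RootNot-rename c t r)
      ∷ operands-rename c f ts mono (λ i∈ j∈ → inj (∈-++⁺ʳ (leaves t) i∈) (∈-++⁺ʳ (leaves t) j∈)) p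

    WFV-rename : ∀ {k} f (ts : Vec Tree k) → Monotone f → InjectiveOn (leavesV ts) f → WFV P ts → WFV P (renameV f ts)
    WFV-rename f [] mono inj _ = tt
    WFV-rename f (t ∷ ts) mono inj (w , p) =
      WF-rename f t mono (λ i∈ j∈ → inj (∈-++⁺ˡ i∈) (∈-++⁺ˡ j∈)) w ,
      WFV-rename f ts mono (λ i∈ j∈ → inj (∈-++⁺ʳ (leaves t) i∈) (∈-++⁺ʳ (leaves t) j∈)) p

    SortedV-rename : ∀ {k} f (ts : Vec Tree k) → Monotone f → InjectiveOn (leavesV ts) f →
      SortedByMin (toList ts) → WFV P ts → SortedByMin (toList (renameV f ts))
    SortedV-rename f ts mono inj s w = subst SortedByMin (sym (renameV-toList f ts)) (fromSorted
      (Sorted-rename (toList ts) mono (subst (λ l → InjectiveOn l f) (leavesV-toList ts) inj)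
        (All.map (λ {t} → WF⇒NonEmpty t) (Equivalence.to (WFV⇔All ts) w)) (toSorted s)))

  mutual
    WF⇒¬hasBlossom : ∀ t → WF P t → hasBlossom t ≡ false
    WF⇒¬hasBlossom (leaf i) w = refl
    WF⇒¬hasBlossom (node⊕ ts) (_ , _ , p) = ¬hasBlossomL⊕ ts p
    WF⇒¬hasBlossom (node⊖ ts) (_ , _ , p) = ¬hasBlossomL⊖ ts p
    WF⇒¬hasBlossom (nodeP k H ts) (_ , _ , p) = ¬hasBlossomV ts p

    ¬hasBlossomL⊕ : ∀ ts → AllNot⊕ P ts → hasBlossomL ts ≡ false
    ¬hasBlossomL⊕ [] p = refl
    ¬hasBlossomL⊕ (t ∷ ts) (w , _ , p) rewrite WF⇒¬hasBlossom t w = ¬hasBlossomL⊕ ts p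

    ¬hasBlossomL⊖ : ∀ ts → AllNot⊖ P ts → hasBlossomL ts ≡ false
    ¬hasBlossomL⊖ [] p = refl
    ¬hasBlossomL⊖ (t ∷ ts) (w , _ , p) rewrite WF⇒¬hasBlossom t w = ¬hasBlossomL⊖ ts p

    ¬hasBlossomV : ∀ {k} (ts : Vec Tree k) → WFV P ts → hasBlossomV ts ≡ false
    ¬hasBlossomV [] p = refl
    ¬hasBlossomV (t ∷ ts) (w , p) rewrite WF⇒¬hasBlossom t w = ¬hasBlossomV ts p

  WF-join : ∀ c {ts} → 1 ≤ length ts → Sorted ts → All (IsOperand c) ts → WF P (join c ts)
  WF-join c {t ∷ []} l s ((w , _) ∷ []) = w
  WF-join c {t ∷ u ∷ ts} l s p = WF-node⁺ c (s≤s (s≤s z≤n)) s p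

  split-join : ∀ c {ts} → 1 ≤ length ts → All (IsOperand c) ts → split c (join c ts) ≡ ts
  split-join c {t ∷ []} l ((_ , r) ∷ []) = split-RootNot c t r
  split-join c {t ∷ u ∷ ts} l p = split-node c (t ∷ u ∷ ts)

  WF-split : ∀ c {t} → WF P t → 1 ≤ length (split c t) × Sorted (split c t) × All (IsOperand c) (split c t)
  WF-split c {t} w with root? c t
  ... | inj₁ (ts , refl) rewrite split-node c ts = let (l , s , p) = WF-node⁻ c w in ℕₚ.<⇒≤ l , s , p
  ... | inj₂ r rewrite split-RootNot c t r = s≤s z≤n , [] ∷ [] , (w , r) ∷ []

  -- A well-formed `c`-node has at least two children, so `join` never collapses it to an only
  -- child.
  join-split : ∀ c {t} → WF P t → join c (split c t) ≡ t
  join-split c {t} w with root? c t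
  ... | inj₁ (ts , refl) rewrite split-node c ts = go ts (proj₁ (WF-node⁻ c w))
    where
    go : ∀ ts → 2 ≤ length ts → join c ts ≡ node c ts
    go (_ ∷ _ ∷ _) _ = refl
    go (_ ∷ []) (s≤s ())
  ... | inj₂ r rewrite split-RootNot c t r = refl

-- Blossoming at a leaf

-- The auxiliary functions of frontL are local to Defs; unification recovers them.
mutual
  front-go : List Tree → List Tree → List Tree → List Tree
  front-go = _

  front-go-≡ : ∀ i ts → frontL (leaf i ∷ ts) ≡ front-go (leaf i ∷ ts) ts (leaf i ∷ [])
  front-go-≡ i ts with leaf i ∷ ts | List.[ leaf i ]
  ... | us | acc = refl

mutual
  front-rev : List Tree → List Tree → List Tree → List Tree
  front-rev = _

  front-rev-≡ : ∀ us ts acc → front-go us (blossom ∷ ts) acc ≡ blossom ∷ front-rev us acc ts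
  front-rev-≡ us ts acc = refl

front-rev-ʳ++ : ∀ us acc ts → front-rev us acc ts ≡ acc ʳ++ ts
front-rev-ʳ++ us [] ts = refl
front-rev-ʳ++ us (t ∷ acc) ts = front-rev-ʳ++ us acc (t ∷ ts)

front-go-insert : ∀ us xs acc {b ys} → All (λ t → hasBlossom t ≡ false) xs → hasBlossom b ≡ true →
  front-go us (xs ++ b ∷ ys) acc ≡ b ∷ acc ʳ++ (xs ++ ys)
front-go-insert us [] acc {b} {ys} [] q rewrite q = cong (b ∷_) (front-rev-ʳ++ us acc ys)
front-go-insert us (x ∷ xs) acc (p ∷ ps) q rewrite p = front-go-insert us xs (x ∷ acc) ps q

frontL-insert : ∀ xs {b ys} → All (λ t → hasBlossom t ≡ false) xs → hasBlossom b ≡ true →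
  frontL (xs ++ b ∷ ys) ≡ b ∷ xs ++ ys
frontL-insert xs {b} {ys} = front-go-insert (xs ++ b ∷ ys) xs []

frontBack : ∀ {k} → Fin (suc k) → Fin (suc k) → Fin (suc k)
frontBack i x with i ≟ x
... | yes _ = zero
... | no i≢x = suc (punchOut i≢x)

-- The backward map is `frontPerm` because `relabel` reads adjacencies through `⟨$⟩ˡ`. The
-- decoration built by `frontP` is then a `relabel` of the original one, to which the closure of the
-- family applies.
moveToFront : ∀ {k} → Fin (suc k) → Permutation′ (suc k)
moveToFront {k} i = permutation (frontBack i) (frontPerm i) back∘perm perm∘back
  where
  perm∘back : ∀ x → frontPerm i (frontBack i x) ≡ x
  perm∘back x with i ≟ x
  ... | yes i≡x = i≡x
  ... | no i≢x = punchIn-punchOut i≢x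
  back∘perm : ∀ x → frontBack i (frontPerm i x) ≡ x
  back∘perm zero with i ≟ i
  ... | yes _ = refl
  ... | no i≢i = contradiction refl i≢i
  back∘perm (suc x) with i ≟ punchIn i x
  ... | yes e = contradiction (sym e) (punchInᵢ≢i i x)
  ... | no i≢ = cong suc (trans (punchOut-cong i refl) (punchOut-punchIn i))

adj-relabel : ∀ {k} (σ : Permutation′ k) H i j → adj (relabel σ H) i j ≡ adj H (σ ⟨$⟩ˡ i) (σ ⟨$⟩ˡ j)
adj-relabel σ H i j = trans (cong (λ r → lookup r j) (lookup∘tabulate _ i)) (lookup∘tabulate _ j)

relabel-flip : ∀ {k} (σ : Permutation′ k) H → relabel (flip σ) (relabel σ H) ≡ H
relabel-flip σ H = trans
  (tabulate-cong λ i → trans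
    (tabulate-cong λ j → trans (adj-relabel σ H (σ ⟨$⟩ʳ i) (σ ⟨$⟩ʳ j)) (cong₂ (adj H) (inverseˡ σ) (inverseˡ σ)))
    (tabulate∘lookup (lookup H i)))
  (tabulate∘lookup H)

front : ∀ {k} → Fin (suc k) → Graph (suc k) → Graph (suc k)
front i = relabel (moveToFront i)

unfront : ∀ {k} → Fin (suc k) → Graph (suc k) → Graph (suc k)
unfront i = relabel (flip (moveToFront i))

findBlossomV-insertAt : ∀ {k} (ts : Vec Tree k) i {b} → hasBlossomV ts ≡ false → hasBlossom b ≡ true →
  findBlossomV (insertAt ts i b) ≡ just i
findBlossomV-insertAt ts zero p q rewrite q = refl
findBlossomV-insertAt (t ∷ ts) (suc i) p q with hasBlossom t
... | false = cong (Maybe.map suc) (findBlossomV-insertAt ts i p q)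

frontP-insertAt : ∀ {k} H (ts : Vec Tree k) i {b} → hasBlossomV ts ≡ false → hasBlossom b ≡ true →
  frontP (suc k) H (insertAt ts i b) ≡ nodeP (suc k) (front i H) (b ∷ ts)
frontP-insertAt {k} H ts i {b} p q rewrite findBlossomV-insertAt ts i {b} p q =
  cong (nodeP (suc k) (front i H)) (cong₂ _∷_ (insertAt-lookup ts i b)
    (trans (tabulate-cong (insertAt-punchIn ts i b)) (tabulate∘lookup ts)))

-- blossomAt m renames the remaining leaves along the increasing bijection ℕ ∖ {m} → ℕ.

skip : ℕ → ℕ → ℕ
skip m j = if m <ᵇ j then j ∸ 1 else j

skip-suc : ∀ m j → skip (suc m) (suc j) ≡ suc (skip m j)
skip-suc m zero = refl
skip-suc m (suc j) with m <ᵇ suc j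
... | true = refl
... | false = refl

skip-mono : ∀ m → Monotone (skip m)
skip-mono zero z≤n = z≤n
skip-mono zero (s≤s p) = p
skip-mono (suc m) z≤n = z≤n
skip-mono (suc m) {suc i} {suc j} (s≤s p) rewrite skip-suc m i | skip-suc m j = s≤s (skip-mono m p)

skip-injective : ∀ m {i j} → i ≢ m → j ≢ m → skip m i ≡ skip m j → i ≡ j
skip-injective zero {zero} p q e = contradiction refl p
skip-injective zero {suc i} {zero} p q e = contradiction refl q
skip-injective zero {suc i} {suc j} p q e = cong suc e
skip-injective (suc m) {zero} {zero} p q e = refl
skip-injective (suc m) {zero} {suc j} p q e with trans e (skip-suc m j)
... | ()
skip-injective (suc m) {suc i} {zero} p q e with trans (sym e) (skip-suc m i)
... | ()
skip-injective (suc m) {suc i} {suc j} p q e = cong suc (skip-injective m (p ∘ cong suc) (q ∘ cong suc)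
  (ℕₚ.suc-injective (trans (sym (skip-suc m i)) (trans e (skip-suc m j)))))

skip-< : ∀ {m i} → i < m → skip m i ≡ i
skip-< {suc m} {zero} p = refl
skip-< {suc m} {suc i} (s≤s p) = trans (skip-suc m i) (cong suc (skip-< p))

unskip : ℕ → ℕ → ℕ
unskip zero i = suc i
unskip (suc m) zero = zero
unskip (suc m) (suc i) = suc (unskip m i)

skip-unskip : ∀ m i → skip m (unskip m i) ≡ i
skip-unskip zero i = refl
skip-unskip (suc m) zero = refl
skip-unskip (suc m) (suc i) = trans (skip-suc m (unskip m i)) (cong suc (skip-unskip m i))

upTo-unskip : ∀ {m n} → m ≤ n → upTo (suc n) ↭ m ∷ map (unskip m) (upTo n)
upTo-unskip {zero} {n} z≤n = ↭-reflexive (upTo-suc n)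
upTo-unskip {suc m} {suc n} (s≤s m≤n) = begin
  upTo (2 ℕ.+ n)                                        ≡⟨ upTo-suc (suc n) ⟩
  0 ∷ map suc (upTo (suc n))                            ↭⟨ ↭-prep 0 (↭-map⁺ suc (upTo-unskip m≤n)) ⟩
  0 ∷ suc m ∷ map suc (map (unskip m) (upTo n))         ↭⟨ ↭-swap 0 (suc m) ↭-refl ⟩
  suc m ∷ 0 ∷ map suc (map (unskip m) (upTo n))         ≡⟨ cong (λ l → suc m ∷ 0 ∷ l) (trans (sym (map-∘ (upTo n))) (map-∘ (upTo n))) ⟩
  suc m ∷ map (unskip (suc m)) (0 ∷ map suc (upTo n))   ≡⟨ cong (λ l → suc m ∷ map (unskip (suc m)) l) (sym (upTo-suc n)) ⟩
  suc m ∷ map (unskip (suc m)) (upTo (suc n)) ∎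
  where open PermutationReasoning

skip-upTo : ∀ {m n xs} → m ≤ n → m ∷ xs ↭ upTo (suc n) → map (skip m) xs ↭ upTo n
skip-upTo {m} {n} {xs} m≤n p = begin
  map (skip m) xs                         ↭⟨ ↭-map⁺ (skip m) (drop-∷ (↭-trans p (upTo-unskip m≤n))) ⟩
  map (skip m) (map (unskip m) (upTo n))  ≡⟨ sym (map-∘ (upTo n)) ⟩
  map (skip m ∘ unskip m) (upTo n)        ≡⟨ Listₚ.map-cong (skip-unskip m) (upTo n) ⟩
  map id (upTo n)                         ≡⟨ map-id (upTo n) ⟩
  upTo n ∎
  where open PermutationReasoning

blossomAt-leaf : ∀ m → blossomAt m (leaf m) ≡ blossom
blossomAt-leaf m with m ≡ᵇ m | ℕₚ.≡⇒≡ᵇ m m refl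
... | true | _ = refl

front-go-none : ∀ us xs acc → All (λ t → hasBlossom t ≡ false) xs → front-go us xs acc ≡ acc ʳ++ xs
front-go-none us [] acc [] = front-rev-ʳ++ us acc []
front-go-none us (x ∷ xs) acc (p ∷ ps) rewrite p = front-go-none us xs (x ∷ acc) ps

hasBlossomL⇒All : ∀ ts → hasBlossomL ts ≡ false → All (λ t → hasBlossom t ≡ false) ts
hasBlossomL⇒All [] _ = []
hasBlossomL⇒All (t ∷ ts) p with hasBlossom t in eq
... | false = eq ∷ hasBlossomL⇒All ts p

frontL-none : ∀ ts → hasBlossomL ts ≡ false → frontL ts ≡ ts
frontL-none ts p = front-go-none ts ts [] (hasBlossomL⇒All ts p)

findBlossomV-none : ∀ {k} (ts : Vec Tree k) → hasBlossomV ts ≡ false → findBlossomV ts ≡ nothing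
findBlossomV-none [] p = refl
findBlossomV-none (t ∷ ts) p with hasBlossom t
... | false = cong (Maybe.map suc) (findBlossomV-none ts p)

frontP-none : ∀ k H (ts : Vec Tree k) → hasBlossomV ts ≡ false → frontP k H ts ≡ nodeP k H ts
frontP-none zero H ts p = refl
frontP-none (suc k) H ts p rewrite findBlossomV-none ts p = refl

mutual
  -- Off the path no blossom appears, so neither `frontL` nor `frontP` reorders anything and only
  -- the shift of labels remains.
  blossomAt-∉ : ∀ m t → hasBlossom t ≡ false → m ∉ leaves t → blossomAt m t ≡ renameT (skip m) t
  blossomAt-∉ m (leaf j) _ p with j ≡ᵇ m | ℕₚ.≡ᵇ⇒≡ j m
  ... | true | e = contradiction (here (sym (e _))) p
  ... | false | _ with m <ᵇ j
  ...   | true = refl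
  ...   | false = refl
  blossomAt-∉ m (node⊕ ts) b p = cong node⊕ (trans (cong frontL (blossomAtL-∉ m ts b p))
    (frontL-none (renameL (skip m) ts) (trans (hasBlossomL-rename (skip m) ts) b)))
  blossomAt-∉ m (node⊖ ts) b p = cong node⊖ (trans (cong frontL (blossomAtL-∉ m ts b p))
    (frontL-none (renameL (skip m) ts) (trans (hasBlossomL-rename (skip m) ts) b)))
  blossomAt-∉ m (nodeP k H ts) b p = trans (cong (frontP k H) (blossomAtV-∉ m ts b p))
    (frontP-none k H (renameV (skip m) ts) (trans (hasBlossomV-rename (skip m) ts) b))

  blossomAtL-∉ : ∀ m ts → hasBlossomL ts ≡ false → m ∉ leavesL ts → blossomAtL m ts ≡ renameL (skip m) ts
  blossomAtL-∉ m [] _ p = refl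
  blossomAtL-∉ m (t ∷ ts) b p with hasBlossom t in eq
  ... | false = cong₂ _∷_ (blossomAt-∉ m t eq (p ∘ ∈-++⁺ˡ)) (blossomAtL-∉ m ts b (p ∘ ∈-++⁺ʳ (leaves t)))

  blossomAtV-∉ : ∀ {k} m (ts : Vec Tree k) → hasBlossomV ts ≡ false → m ∉ leavesV ts → blossomAtV m ts ≡ renameV (skip m) ts
  blossomAtV-∉ m [] _ p = refl
  blossomAtV-∉ m (t ∷ ts) b p with hasBlossom t in eq
  ... | false = cong₂ _∷_ (blossomAt-∉ m t eq (p ∘ ∈-++⁺ˡ)) (blossomAtV-∉ m ts b (p ∘ ∈-++⁺ʳ (leaves t)))

blossomAtL-++ : ∀ m ss ts → blossomAtL m (ss ++ ts) ≡ blossomAtL m ss ++ blossomAtL m ts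
blossomAtL-++ m [] ts = refl
blossomAtL-++ m (s ∷ ss) ts = cong (blossomAt m s ∷_) (blossomAtL-++ m ss ts)

blossomAt-node : ∀ c m ts → blossomAt m (node c ts) ≡ node c (frontL (blossomAtL m ts))
blossomAt-node ⊕ m ts = refl
blossomAt-node ⊖ m ts = refl

blossomAtV-insertAt : ∀ {k} m (ts : Vec Tree k) i b → hasBlossomV ts ≡ false → m ∉ leavesV ts →
  blossomAtV m (insertAt ts i b) ≡ insertAt (renameV (skip m) ts) i (blossomAt m b)
blossomAtV-insertAt m ts zero b q p = cong (blossomAt m b ∷_) (blossomAtV-∉ m ts q p)
blossomAtV-insertAt m (t ∷ ts) (suc i) b q p with hasBlossom t in eq
... | false = cong₂ _∷_ (blossomAt-∉ m t eq (p ∘ ∈-++⁺ˡ)) (blossomAtV-insertAt m ts i b q (p ∘ ∈-++⁺ʳ (leaves t)))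

-- Paths from the root to the blossom

-- The path from the root to the blossom: linear c t is a c-node whose other children are the operands of t
-- (see join), prime k H ts is a prime node with blossom-side vertex 0 of H and other children ts.

data Step : Set where
  linear : Sign → Tree → Step
  prime  : (k : ℕ) → Graph (suc k) → Vec Tree k → Step

data Kind : Set where
  sgn : Sign → Kind
  prm : Kind

Word : Set
Word = List Step

kind : Step → Kind
kind (linear c t) = sgn c
kind (prime k H ts) = prm

kinds : Word → List Kind
kinds = map kind

renameS : (ℕ → ℕ) → Step → Step
renameS f (linear c t) = linear c (renameT f t)
renameS f (prime k H ts) = prime k H (renameV f ts)

renameW : (ℕ → ℕ) → Word → Word
renameW f = map (renameS f)

leavesS : Step → List ℕ
leavesS (linear c t) = leaves t
leavesS (prime k H ts) = leavesV ts

-- The leaves of the first step come last. The label list of a word starting with a `linear` step is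
-- then literally that of the pair formed by the remaining word and the step's tree, as
-- `count-detach` requires.
leavesW : Word → List ℕ
leavesW [] = []
leavesW (s ∷ w) = leavesW w ++ leavesS s

toTree : Word → Tree
toTree [] = blossom
toTree (linear c t ∷ w) = node c (toTree w ∷ split c t)
toTree (prime k H ts ∷ w) = nodeP (suc k) H (toTree w ∷ ts)

fromTree : Tree → Word
fromTree (node⊕ (b ∷ ts)) = linear ⊕ (join ⊕ ts) ∷ fromTree b
fromTree (node⊖ (b ∷ ts)) = linear ⊖ (join ⊖ ts) ∷ fromTree b
fromTree (nodeP (suc k) H (b ∷ ts)) = prime k H ts ∷ fromTree b
fromTree _ = []

Compatible : Kind → Kind → Set
Compatible k l = ∀ c → k ≡ sgn c → l ≡ sgn c → ⊥

Alternating : List Kind → Set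
Alternating = Linked Compatible

HeadNot : Sign → List Kind → Set
HeadNot c ks = head ks ≢ just (sgn c)

alternating-∷ : ∀ {k ks} → (∀ c → k ≡ sgn c → HeadNot c ks) → Alternating ks → Alternating (k ∷ ks)
alternating-∷ {ks = []} p a = [-]
alternating-∷ {ks = l ∷ ks} p a = (λ c e e′ → p c e (cong just e′)) ∷ a

alternating-head : ∀ {k ks} → Alternating (k ∷ ks) → ∀ c → k ≡ sgn c → HeadNot c ks
alternating-head [-] c e ()
alternating-head (p ∷ a) c e e′ = p c e (just-injective e′)

kinds-rename : ∀ f w → kinds (renameW f w) ≡ kinds w
kinds-rename f [] = refl
kinds-rename f (linear c t ∷ w) = cong (sgn c ∷_) (kinds-rename f w)
kinds-rename f (prime k H ts ∷ w) = cong (prm ∷_) (kinds-rename f w)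

leavesS-rename : ∀ f s → leavesS (renameS f s) ≡ map f (leavesS s)
leavesS-rename f (linear c t) = leaves-rename f t
leavesS-rename f (prime k H ts) = leavesV-rename f ts

leavesW-rename : ∀ f w → leavesW (renameW f w) ≡ map f (leavesW w)
leavesW-rename f [] = refl
leavesW-rename f (s ∷ w) = trans (cong₂ _++_ (leavesW-rename f w) (leavesS-rename f s))
  (sym (map-++ f (leavesW w) (leavesS s)))

renameS-inverse : ∀ f g s → (∀ {i} → i ∈ leavesS s → g (f i) ≡ i) → renameS g (renameS f s) ≡ s
renameS-inverse f g (linear c t) p = cong (linear c) (renameT-inverse f g t p)
renameS-inverse f g (prime k H ts) p = cong (prime k H) (renameV-inverse f g ts p)

renameW-inverse : ∀ f g w → (∀ {i} → i ∈ leavesW w → g (f i) ≡ i) → renameW g (renameW f w) ≡ w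
renameW-inverse f g [] p = refl
renameW-inverse f g (s ∷ w) p = cong₂ _∷_ (renameS-inverse f g s (p ∘ ∈-++⁺ʳ (leavesW w)))
  (renameW-inverse f g w (p ∘ ∈-++⁺ˡ))

renameW-fixed : ∀ f w → (∀ {i} → i ∈ leavesW w → f i ≡ i) → renameW f w ≡ w
renameW-fixed f [] p = refl
renameW-fixed f (linear c t ∷ w) p = cong₂ (λ t w → linear c t ∷ w) (renameT-fixed f t (p ∘ ∈-++⁺ʳ (leavesW w)))
  (renameW-fixed f w (p ∘ ∈-++⁺ˡ))
renameW-fixed f (prime k H ts ∷ w) p = cong₂ (λ ts w → prime k H ts ∷ w) (renameV-fixed f ts (p ∘ ∈-++⁺ʳ (leavesW w)))
  (renameW-fixed f w (p ∘ ∈-++⁺ˡ))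

hasBlossom-toTree : ∀ w → hasBlossom (toTree w) ≡ true
hasBlossom-toTree [] = refl
hasBlossom-toTree (linear ⊕ t ∷ w) rewrite hasBlossom-toTree w = refl
hasBlossom-toTree (linear ⊖ t ∷ w) rewrite hasBlossom-toTree w = refl
hasBlossom-toTree (prime k H ts ∷ w) rewrite hasBlossom-toTree w = refl

RootNot-node : ∀ c c′ {ts} → c′ ≢ c → RootNot c (node c′ ts)
RootNot-node ⊕ ⊕ p = contradiction refl p
RootNot-node ⊕ ⊖ p = tt
RootNot-node ⊖ ⊕ p = tt
RootNot-node ⊖ ⊖ p = contradiction refl p

¬RootNot-node : ∀ c {ts} → ¬ RootNot c (node c ts)
¬RootNot-node ⊕ ()
¬RootNot-node ⊖ ()

RootNot-nodeP : ∀ c {k H ts} → RootNot c (nodeP k H ts)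
RootNot-nodeP ⊕ = tt
RootNot-nodeP ⊖ = tt

RootNot-leaf : ∀ c {i} → RootNot c (leaf i)
RootNot-leaf ⊕ = tt
RootNot-leaf ⊖ = tt

leavesV-insertAt : ∀ {k} (ts : Vec Tree k) i b → leavesV (insertAt ts i b) ↭ leaves b ++ leavesV ts
leavesV-insertAt ts zero b = ↭-refl
leavesV-insertAt (t ∷ ts) (suc i) b = ↭-trans (++⁺ˡ (leaves t) (leavesV-insertAt ts i b)) (shifts (leaves t) (leaves b))

toList-insertAt : ∀ {A : Set} {k} (ts : Vec A k) i b →
  ∃ λ xs → ∃ λ ys → toList ts ≡ xs ++ ys × toList (insertAt ts i b) ≡ xs ++ b ∷ ys
toList-insertAt ts zero b = [] , toList ts , refl , refl
toList-insertAt (t ∷ ts) (suc i) b with toList-insertAt ts i b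
... | xs , ys , e , e′ = t ∷ xs , ys , cong (t ∷_) e , cong (t ∷_) e′

insertAt-position : ∀ {A : Set} {k} (ts : Vec A k) xs ys b → toList ts ≡ xs ++ ys →
  ∃ λ i → toList (insertAt ts i b) ≡ xs ++ b ∷ ys
insertAt-position ts [] ys b e = zero , cong (b ∷_) e
insertAt-position (t ∷ ts) (x ∷ xs) ys b e with Listₚ.∷-injective e
... | refl , e′ with insertAt-position ts xs ys b e′
...   | i , e″ = suc i , cong (t ∷_) e″

AllPairs-remove : ∀ {A : Set} {R : A → A → Set} xs {b ys} → AllPairs R (xs ++ b ∷ ys) → AllPairs R (xs ++ ys)
AllPairs-remove [] (_ ∷ p) = p
AllPairs-remove (x ∷ xs) (q ∷ p) = Allₚ.++⁺ (Allₚ.++⁻ˡ xs q) (All.tail (Allₚ.++⁻ʳ xs q)) ∷ AllPairs-remove xs p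

All-remove : ∀ {A : Set} {P : A → Set} xs {b ys} → All P (xs ++ b ∷ ys) → All P (xs ++ ys)
All-remove xs p = Allₚ.++⁺ (Allₚ.++⁻ˡ xs p) (All.tail (Allₚ.++⁻ʳ xs p))

All-middle : ∀ {A : Set} {P : A → Set} xs {b ys} → All P (xs ++ b ∷ ys) → P b
All-middle xs p = All.head (Allₚ.++⁻ʳ xs p)

All-insert : ∀ {A : Set} {P : A → Set} xs {b ys} → P b → All P (xs ++ ys) → All P (xs ++ b ∷ ys)
All-insert xs q p = Allₚ.++⁺ (Allₚ.++⁻ˡ xs p) (q ∷ Allₚ.++⁻ʳ xs p)

-- Cutting forgets where the branch stood among its siblings; its minimal leaf, distinct from
-- theirs, dictates where it goes back.
sorted-insert : ∀ b ts → Sorted ts → All (λ t → minLeaf t ≢ minLeaf b) ts →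
  ∃ λ xs → ∃ λ ys → ts ≡ xs ++ ys × Sorted (xs ++ b ∷ ys)
sorted-insert b [] [] [] = [] , [] , refl , [] ∷ []
sorted-insert b (t ∷ ts) (p ∷ ps) (q ∷ qs) with ℕₚ.<-cmp (minLeaf b) (minLeaf t)
... | tri< b<t _ _ = [] , t ∷ ts , refl ,
  (b<t ∷ All.map (λ {u} → ℕₚ.<-trans {minLeaf b} {minLeaf t} {minLeaf u} b<t) p) ∷ p ∷ ps
... | tri≈ _ e _ = contradiction (sym e) q
... | tri> _ _ t<b with sorted-insert b ts ps qs
...   | xs , ys , refl , s = t ∷ xs , ys , refl , All-insert xs t<b p ∷ s

-- If the positions differed, some sibling would have a minimal leaf both larger and smaller than
-- that of `b`.
sorted-insert-unique : ∀ b xs xs′ {ys ys′} → Sorted (xs ++ b ∷ ys) → Sorted (xs′ ++ b ∷ ys′) →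
  xs ++ ys ≡ xs′ ++ ys′ → xs ++ b ∷ ys ≡ xs′ ++ b ∷ ys′
sorted-insert-unique b [] [] _ _ refl = refl
sorted-insert-unique b [] (x ∷ xs′) ((p ∷ _) ∷ _) (q ∷ _) refl = ⊥-elim (ℕₚ.<-asym p (All-middle xs′ q))
sorted-insert-unique b (x ∷ xs) [] (q ∷ _) ((p ∷ _) ∷ _) refl = ⊥-elim (ℕₚ.<-asym p (All-middle xs q))
sorted-insert-unique b (x ∷ xs) (x′ ∷ xs′) (_ ∷ s) (_ ∷ s′) e with Listₚ.∷-injective e
... | refl , e′ = cong (x ∷_) (sorted-insert-unique b xs xs′ s s′ e′)

insertAt-unique : ∀ {k} b (ts : Vec Tree k) i j → Sorted (toList (insertAt ts i b)) → Sorted (toList (insertAt ts j b)) → i ≡ j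
insertAt-unique b ts zero zero _ _ = refl
insertAt-unique b (t ∷ ts) zero (suc j) ((p ∷ _) ∷ _) (q ∷ _) with toList-insertAt ts j b
... | xs , ys , _ , e = ⊥-elim (ℕₚ.<-asym p (All-middle xs (subst (All (MinLess t)) e q)))
insertAt-unique b (t ∷ ts) (suc i) zero (q ∷ _) ((p ∷ _) ∷ _) with toList-insertAt ts i b
... | xs , ys , _ , e = ⊥-elim (ℕₚ.<-asym p (All-middle xs (subst (All (MinLess t)) e q)))
insertAt-unique b (t ∷ ts) (suc i) (suc j) (_ ∷ s) (_ ∷ s′) = cong suc (insertAt-unique b ts i j s s′)

-- Cut m t w: w describes the path from the root of t to its leaf m.
data Cut (m : ℕ) : Tree → Word → Set where
  here   : Cut m (leaf m) []
  linear : ∀ {c} xs {b ys w s t} → t ≡ node c (xs ++ b ∷ ys) → s ≡ join c (xs ++ ys) →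
           Cut m b w → Cut m t (linear c s ∷ w)
  prime  : ∀ {k} H i {b t G w} (ts : Vec Tree k) → t ≡ nodeP (suc k) H (insertAt ts i b) → G ≡ front i H →
           Cut m b w → Cut m t (prime k G ts ∷ w)

mutual
  locate : ∀ {m} t → m ∈ leaves t → ∃ (Cut m t)
  locate (leaf i) (here refl) = [] , here
  locate (node⊕ ts) p with locateL ts p
  ... | xs , b , ys , e , w , cut = linear ⊕ _ ∷ w , linear {c = ⊕} xs (cong node⊕ e) refl cut
  locate (node⊖ ts) p with locateL ts p
  ... | xs , b , ys , e , w , cut = linear ⊖ _ ∷ w , linear {c = ⊖} xs (cong node⊖ e) refl cut
  locate (nodeP zero H []) ()
  locate (nodeP (suc k) H ts) p with locateV ts p
  ... | i , b , us , e , w , cut = _ , prime H i us (cong (nodeP (suc k) H) e) refl cut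

  locateL : ∀ {m} ts → m ∈ leavesL ts → ∃ λ xs → ∃ λ b → ∃ λ ys → ts ≡ xs ++ b ∷ ys × ∃ (Cut m b)
  locateL (t ∷ ts) p with ∈-++⁻ (leaves t) p
  ... | inj₁ q = [] , t , ts , refl , locate t q
  ... | inj₂ q with locateL ts q
  ...   | xs , b , ys , e , r = t ∷ xs , b , ys , cong (t ∷_) e , r

  locateV : ∀ {m k} (ts : Vec Tree (suc k)) → m ∈ leavesV ts →
    ∃ λ i → ∃ λ b → ∃ λ us → ts ≡ insertAt us i b × ∃ (Cut m b)
  locateV (t ∷ ts) p with ∈-++⁻ (leaves t) p
  ... | inj₁ q = zero , t , ts , refl , locate t q
  locateV (t ∷ []) p | inj₂ ()
  locateV (t ∷ ts@(_ ∷ _)) p | inj₂ q with locateV ts q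
  ...   | i , b , us , e , r = suc i , b , t ∷ us , cong (t ∷_) e , r

cut-leaves : ∀ {m t w} → Cut m t w → leaves t ↭ m ∷ leavesW w
cut-leaves here = ↭-refl
cut-leaves {m} (linear {c} xs {b} {ys} {w} refl refl cut) = begin
  leaves (node c (xs ++ b ∷ ys))                ≡⟨ leaves-node c (xs ++ b ∷ ys) ⟩
  leavesL (xs ++ b ∷ ys)                        ↭⟨ leavesL-insert xs b ys ⟩
  leaves b ++ leavesL (xs ++ ys)                ↭⟨ ++⁺ʳ _ (cut-leaves cut) ⟩
  m ∷ leavesW w ++ leavesL (xs ++ ys)           ≡⟨ cong (λ l → m ∷ leavesW w ++ l) (sym (leaves-join c (xs ++ ys))) ⟩
  m ∷ leavesW w ++ leaves (join c (xs ++ ys)) ∎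
  where open PermutationReasoning
cut-leaves (prime H i {b} ts refl refl cut) = ↭-trans (leavesV-insertAt ts i b) (++⁺ʳ _ (cut-leaves cut))

cut-∈ : ∀ {m t w} → Cut m t w → m ∈ leaves t
cut-∈ cut = ∈-resp-↭ (↭-sym (cut-leaves cut)) (here refl)

cut-linear-unique : ∀ c xs {b ys} → Unique (leaves (node c (xs ++ b ∷ ys))) → Unique (leaves b ++ leavesL (xs ++ ys))
cut-linear-unique c xs {b} {ys} = Unique-resp-↭ (↭-trans (↭-reflexive (leaves-node c (xs ++ b ∷ ys))) (leavesL-insert xs b ys))

All⇒hasBlossomL : ∀ {ts} → All (λ t → hasBlossom t ≡ false) ts → hasBlossomL ts ≡ false
All⇒hasBlossomL [] = refl
All⇒hasBlossomL (p ∷ ps) rewrite p = All⇒hasBlossomL ps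

-- Valid words and trees with a distinguished leaf

module ValidWords (P : (k : ℕ) → Graph k → Set) (P⇒prime : ∀ k H → P k H → IsPrime k H)
  (P-relabel : ∀ k (H : Graph k) (σ : Permutation′ k) → P k H → P k (relabel σ H)) where

  open WellFormed P P⇒prime

  ValidStep : Step → Set
  ValidStep (linear c t) = WF P t
  ValidStep (prime k H ts) = P (suc k) H × SortedByMin (toList ts) × WFV P ts

  ValidWord : Word → Set
  ValidWord w = Alternating (kinds w) × All ValidStep w

  WFV-remove : ∀ {k} (ts : Vec Tree k) i {b} → WFV P (insertAt ts i b) → WFV P ts
  WFV-remove ts zero (_ , p) = p
  WFV-remove (t ∷ ts) (suc i) (w , p) = w , WFV-remove ts i p

  WFV-middle : ∀ {k} (ts : Vec Tree k) i {b} → WFV P (insertAt ts i b) → WF P b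
  WFV-middle ts zero (w , _) = w
  WFV-middle (t ∷ ts) (suc i) (_ , p) = WFV-middle ts i p

  WFV-insert : ∀ {k} (ts : Vec Tree k) i {b} → WF P b → WFV P ts → WFV P (insertAt ts i b)
  WFV-insert ts zero q p = q , p
  WFV-insert (t ∷ ts) (suc i) q (w , p) = w , WFV-insert ts i q p

  WF-linear : ∀ c xs {b ys} → WF P (node c (xs ++ b ∷ ys)) →
    IsOperand c b × 1 ≤ length (xs ++ ys) × Sorted (xs ++ ys) × All (IsOperand c) (xs ++ ys)
  WF-linear c xs w with WF-node⁻ c w
  ... | l , s , p = All-middle xs p , ℕₚ.≤-pred (subst (2 ≤_) (length-insert xs) l) , AllPairs-remove xs s , All-remove xs p

  -- The second component feeds the induction: the branch below a `c`-node is not rooted at `c`, so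
  -- its word does not start with `c` and the extended word still alternates.
  cut-valid : ∀ {m t w} → WF P t → Cut m t w → ValidWord w × (∀ c → RootNot c t → HeadNot c (kinds w))
  cut-valid wf here = ([] , []) , λ c _ ()
  cut-valid wf (linear {c} xs refl refl cut) with WF-linear c xs wf
  ... | (wb , rb) , l , s , p with cut-valid wb cut
  ... | (a , v) , h = (alternating-∷ (λ { c refl → h c rb }) a , WF-join c l s p ∷ v) ,
    λ { c r refl → ¬RootNot-node c r }
  cut-valid (pH , s , p) (prime H i {b} ts refl refl cut) with cut-valid (WFV-middle ts i p) cut
  ... | (a , v) , h = (alternating-∷ (λ c ()) a , (P-relabel _ H (moveToFront i) pH , sorted , WFV-remove ts i p) ∷ v) , λ c _ ()
    where
    sorted : SortedByMin (toList ts)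
    sorted with toList-insertAt ts i b
    ... | xs , ys , e , e′ = subst SortedByMin (sym e) (fromSorted (AllPairs-remove xs (toSorted (subst SortedByMin e′ s))))

  -- Labels are distinct, so `m` occurs only in the branch followed by the cut. This branch alone
  -- receives the blossom and moves to the front, while its siblings are merely relabelled.
  blossomAt-cut : ∀ {m t w} → WF P t → Unique (leaves t) → Cut m t w → blossomAt m t ≡ toTree (renameW (skip m) w)
  blossomAt-cut {m} wf u here = blossomAt-leaf m
  blossomAt-cut {m} wf u (linear {c} xs {b} {ys} {w} refl refl cut) with WF-linear c xs wf
  ... | (wb , _) , l , s , p = begin
    blossomAt m (node c (xs ++ b ∷ ys))
      ≡⟨ blossomAt-node c m (xs ++ b ∷ ys) ⟩
    node c (frontL (blossomAtL m (xs ++ b ∷ ys)))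
      ≡⟨ cong (node c ∘ frontL) (blossomAtL-++ m xs (b ∷ ys)) ⟩
    node c (frontL (blossomAtL m xs ++ blossomAt m b ∷ blossomAtL m ys))
      ≡⟨ cong₂ (λ l l′ → node c (frontL (l ++ blossomAt m b ∷ l′))) (blossomAtL-∉ m xs nbx m∉xs) (blossomAtL-∉ m ys nby m∉ys) ⟩
    node c (frontL (renameL (skip m) xs ++ blossomAt m b ∷ renameL (skip m) ys))
      ≡⟨ cong (node c) (frontL-insert (renameL (skip m) xs)
           (hasBlossomL⇒All _ (trans (hasBlossomL-rename (skip m) xs) nbx)) (trans (cong hasBlossom ih) (hasBlossom-toTree (renameW (skip m) w)))) ⟩
    node c (blossomAt m b ∷ renameL (skip m) xs ++ renameL (skip m) ys)
      ≡⟨ cong₂ (λ b l → node c (b ∷ l)) ih (begin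
           renameL (skip m) xs ++ renameL (skip m) ys        ≡⟨ sym (renameL-++ (skip m) xs ys) ⟩
           renameL (skip m) (xs ++ ys)                       ≡⟨ cong (renameL (skip m)) (sym (split-join c l p)) ⟩
           renameL (skip m) (split c (join c (xs ++ ys)))    ≡⟨ sym (split-rename c (skip m) (join c (xs ++ ys))) ⟩
           split c (renameT (skip m) (join c (xs ++ ys))) ∎) ⟩
    node c (toTree (renameW (skip m) w) ∷ split c (renameT (skip m) (join c (xs ++ ys)))) ∎
    where
    open ≡-Reasoning
    u′ = cut-linear-unique c xs u
    ih = blossomAt-cut wb (unique-++ˡ (leaves b) u′) cut
    m∉ : m ∉ leavesL xs ++ leavesL ys
    m∉ q = unique-++-disjoint (leaves b) u′ (cut-∈ cut) (subst (m ∈_) (sym (leavesL-++ xs ys)) q)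
    m∉xs = m∉ ∘ ∈-++⁺ˡ
    m∉ys = m∉ ∘ ∈-++⁺ʳ (leavesL xs)
    nb = All.map (λ {t} → WF⇒¬hasBlossom t ∘ proj₁) p
    nbx = All⇒hasBlossomL (Allₚ.++⁻ˡ xs nb)
    nby = All⇒hasBlossomL (Allₚ.++⁻ʳ xs nb)
  blossomAt-cut {m} (pH , s , p) u (prime {k} H i {b} {w = w} ts refl refl cut) = begin
    frontP (suc k) H (blossomAtV m (insertAt ts i b))
      ≡⟨ cong (frontP (suc k) H) (blossomAtV-insertAt m ts i b nb (unique-++-disjoint (leaves b) u′ (cut-∈ cut))) ⟩
    frontP (suc k) H (insertAt (renameV (skip m) ts) i (blossomAt m b))
      ≡⟨ frontP-insertAt H (renameV (skip m) ts) i (trans (hasBlossomV-rename (skip m) ts) nb)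
           (trans (cong hasBlossom ih) (hasBlossom-toTree (renameW (skip m) w))) ⟩
    nodeP (suc k) (front i H) (blossomAt m b ∷ renameV (skip m) ts)
      ≡⟨ cong (λ b → nodeP (suc k) (front i H) (b ∷ renameV (skip m) ts)) ih ⟩
    nodeP (suc k) (front i H) (toTree (renameW (skip m) w) ∷ renameV (skip m) ts) ∎
    where
    open ≡-Reasoning
    u′ = Unique-resp-↭ (leavesV-insertAt ts i b) u
    ih = blossomAt-cut (WFV-middle ts i p) (unique-++ˡ (leaves b) u′) cut
    nb = ¬hasBlossomV ts (WFV-remove ts i p)

  -- The tree is determined from the cut leaf upwards. Once the branches agree, sortedness fixes
  -- their place among the siblings; at a prime node the place fixes the permutation, which can be
  -- undone on the decoration.
  cut-injective : ∀ {m t t′ w} → WF P t → WF P t′ → Cut m t w → Cut m t′ w → t ≡ t′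
  cut-injective wf wf′ here here = refl
  cut-injective wf wf′ (linear {c} xs {b} {ys} refl refl cut) (linear xs′ {b′} {ys′} refl e cut′)
    with WF-linear c xs wf | WF-linear c xs′ wf′
  ... | (wb , _) , l , _ , p | (wb′ , _) , l′ , _ , p′ with cut-injective wb wb′ cut cut′
  ... | refl = cong (node c) (sorted-insert-unique b xs xs′ (proj₁ (proj₂ (WF-node⁻ c wf))) (proj₁ (proj₂ (WF-node⁻ c wf′)))
    (trans (sym (split-join c l p)) (trans (cong (split c) e) (split-join c l′ p′))))
  cut-injective (_ , s , p) (_ , s′ , p′) (prime H i ts refl refl cut) (prime H′ j ts refl e cut′)
    with cut-injective (WFV-middle ts i p) (WFV-middle ts j p′) cut cut′
  ... | refl with insertAt-unique _ ts i j (toSorted s) (toSorted s′)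
  ... | refl = cong (λ H → nodeP _ H (insertAt ts i _)) (trans (sym (relabel-flip (moveToFront i) H))
    (trans (cong (unfront i) e) (relabel-flip (moveToFront i) H′)))

  minLeaf-∉ : ∀ {b t ts} → WF P b → WF P t → t ∈ ts → Unique (leaves b ++ leavesL ts) → minLeaf t ≢ minLeaf b
  minLeaf-∉ {b} {t} wb wt t∈ u e = unique-++-disjoint (leaves b) u (minLeaf-∈ {b} (WF⇒NonEmpty b wb))
    (leavesL-∈ t∈ (subst (_∈ leaves t) e (minLeaf-∈ {t} (WF⇒NonEmpty t wt))))

  -- The inverse of cutting, built upwards from a leaf labelled `m`. The last component belongs to
  -- the induction: a word allowed to follow a `c`-step must give a branch not rooted at `c`, as the
  -- new node requires.
  graft : ∀ {m} w → ValidWord w → Unique (m ∷ leavesW w) →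
    ∃ λ t → WF P t × Cut m t w × (∀ c → HeadNot c (kinds w) → RootNot c t)
  graft [] v u = leaf _ , tt , here , λ c _ → RootNot-leaf c
  graft {m} (linear c s ∷ w) (a , ws ∷ v) u with graft w (Linked.tail a , v) (unique-++ˡ (m ∷ leavesW w) u)
  ... | b , wb , cut , r with WF-split c ws
  ... | l , sorted , ops with sorted-insert b (split c s) sorted
          (All.tabulate λ t∈ → minLeaf-∉ wb (proj₁ (All.lookup ops t∈)) t∈
            (Unique-resp-↭ (++⁺ (↭-sym (cut-leaves cut)) (↭-reflexive (sym (leaves-split c s)))) u))
  ... | xs , ys , e , sorted′ = node c (xs ++ b ∷ ys) ,
    WF-node⁺ c (subst (2 ≤_) (sym (length-insert xs)) (s≤s (subst (λ ts → 1 ≤ length ts) e l))) sorted′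
      (All-insert xs (wb , r c (alternating-head a c refl)) (subst (All (IsOperand c)) e ops)) ,
    linear xs refl (trans (sym (join-split c ws)) (cong (join c) e)) cut ,
    λ c′ h → RootNot-node c′ c (λ { refl → h refl })
  graft {m} (prime k G ts ∷ w) (a , (pG , s , p) ∷ v) u with graft w (Linked.tail a , v) (unique-++ˡ (m ∷ leavesW w) u)
  ... | b , wb , cut , _ with sorted-insert b (toList ts) (toSorted s)
          (All.tabulate λ t∈ → minLeaf-∉ wb (All.lookup (Equivalence.to (WFV⇔All ts) p) t∈) t∈
            (Unique-resp-↭ (++⁺ (↭-sym (cut-leaves cut)) (↭-reflexive (leavesV-toList ts))) u))
  ... | xs , ys , e , sorted′ with insertAt-position ts xs ys b e
  -- The decoration is chosen so that moving vertex `i` to the front gives back `G`.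
  ... | i , e′ = nodeP (suc k) (unfront i G) (insertAt ts i b) ,
    (P-relabel _ G (flip (moveToFront i)) pG , fromSorted (subst Sorted (sym e′) sorted′) , WFV-insert ts i wb p) ,
    prime (unfront i G) i ts refl (sym (relabel-flip (flip (moveToFront i)) G)) cut ,
    λ c _ → RootNot-nodeP c

  -- Validity enters through `join-split`: a malformed `c`-node with a single child would not be
  -- rebuilt.
  fromTree-toTree : ∀ {w} → All ValidStep w → fromTree (toTree w) ≡ w
  fromTree-toTree [] = refl
  fromTree-toTree {linear ⊕ t ∷ w} (p ∷ v) = cong₂ (λ t w → linear ⊕ t ∷ w) (join-split ⊕ p) (fromTree-toTree v)
  fromTree-toTree {linear ⊖ t ∷ w} (p ∷ v) = cong₂ (λ t w → linear ⊖ t ∷ w) (join-split ⊖ p) (fromTree-toTree v)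
  fromTree-toTree {prime k H ts ∷ w} (p ∷ v) = cong (prime k H ts ∷_) (fromTree-toTree v)

  toTree-injective : ∀ {w w′} → All ValidStep w → All ValidStep w′ → toTree w ≡ toTree w′ → w ≡ w′
  toTree-injective v v′ e = trans (sym (fromTree-toTree v)) (trans (cong fromTree e) (fromTree-toTree v′))

-- Enumeration of the classes

unitCount : ℕ → ℕ
unitCount zero = 1
unitCount (suc _) = 0

egf-unitCount : egf unitCount ≈ oneₛ
egf-unitCount zero = refl
egf-unitCount (suc n) = ℚₚ.0/n≡0 (suc n !)
  where instance _ = suc n !≢0

leavesW-↭ : ∀ {w w′} → w ↭ w′ → leavesW w ↭ leavesW w′
leavesW-↭ ↭.refl = ↭-refl
leavesW-↭ (↭.prep s p) = ++⁺ʳ (leavesS s) (leavesW-↭ p)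
leavesW-↭ {_ ∷ _ ∷ w} {_ ∷ _ ∷ w′} (↭.swap s s′ p) = begin
  (leavesW w ++ leavesS s′) ++ leavesS s     ≡⟨ ++-assoc (leavesW w) (leavesS s′) (leavesS s) ⟩
  leavesW w ++ leavesS s′ ++ leavesS s       ↭⟨ ++⁺ (leavesW-↭ p) (++-comm (leavesS s′) (leavesS s)) ⟩
  leavesW w′ ++ leavesS s ++ leavesS s′      ≡⟨ sym (++-assoc (leavesW w′) (leavesS s) (leavesS s′)) ⟩
  (leavesW w′ ++ leavesS s) ++ leavesS s′ ∎
  where open PermutationReasoning
leavesW-↭ (↭.trans p q) = ↭-trans (leavesW-↭ p) (leavesW-↭ q)

-- Reversal of words and exchange of signs

last-∷ʳ : ∀ {A : Set} (xs : List A) x → last (xs ∷ʳ x) ≡ just x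
last-∷ʳ [] x = refl
last-∷ʳ (y ∷ []) x = refl
last-∷ʳ (y ∷ z ∷ xs) x = last-∷ʳ (z ∷ xs) x

last-∷-≢nothing : ∀ {A : Set} (x : A) xs → last (x ∷ xs) ≢ nothing
last-∷-≢nothing x [] ()
last-∷-≢nothing x (y ∷ xs) = last-∷-≢nothing y xs

last-reverse : ∀ {A : Set} (xs : List A) → last (reverse xs) ≡ head xs
last-reverse [] = refl
last-reverse (x ∷ xs) = trans (cong last (unfold-reverse x xs)) (last-∷ʳ (reverse xs) x)

head-reverse : ∀ {A : Set} (xs : List A) → head (reverse xs) ≡ last xs
head-reverse xs = trans (sym (last-reverse (reverse xs))) (cong last (reverse-involutive xs))

-- `Compatible` is symmetric, so an adjacent pair may be read in either direction.
alternating-reverse : ∀ {ks} → Alternating ks → Alternating (reverse ks)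
alternating-reverse [] = []
alternating-reverse [-] = [-]
alternating-reverse {k ∷ l ∷ ks} (p ∷ a) = subst Alternating (sym (unfold-reverse k (l ∷ ks)))
  (Linkedₚ.++⁺ (alternating-reverse a)
    (subst (λ m → Connected Compatible m (just k)) (sym (last-reverse (l ∷ ks))) (just (λ c e e′ → p c e′ e))) [-])

opposite : Sign → Sign
opposite ⊕ = ⊖
opposite ⊖ = ⊕

opposite-involutive : ∀ c → opposite (opposite c) ≡ c
opposite-involutive ⊕ = refl
opposite-involutive ⊖ = refl

oppositeK : Kind → Kind
oppositeK (sgn c) = sgn (opposite c)
oppositeK prm = prm

oppositeS : Step → Step
oppositeS (linear c t) = linear (opposite c) t
oppositeS (prime k H ts) = prime k H ts

oppositeW : Word → Word
oppositeW = map oppositeS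

oppositeW-involutive : ∀ w → oppositeW (oppositeW w) ≡ w
oppositeW-involutive [] = refl
oppositeW-involutive (linear c t ∷ w) = cong₂ (λ c w → linear c t ∷ w) (opposite-involutive c) (oppositeW-involutive w)
oppositeW-involutive (prime k H ts ∷ w) = cong (prime k H ts ∷_) (oppositeW-involutive w)

kinds-opposite : ∀ w → kinds (oppositeW w) ≡ map oppositeK (kinds w)
kinds-opposite [] = refl
kinds-opposite (linear c t ∷ w) = cong (sgn (opposite c) ∷_) (kinds-opposite w)
kinds-opposite (prime k H ts ∷ w) = cong (prm ∷_) (kinds-opposite w)

leavesW-opposite : ∀ w → leavesW (oppositeW w) ≡ leavesW w
leavesW-opposite [] = refl
leavesW-opposite (linear c t ∷ w) = cong (_++ leaves t) (leavesW-opposite w)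
leavesW-opposite (prime k H ts ∷ w) = cong (_++ leavesV ts) (leavesW-opposite w)

oppositeK-sgn : ∀ {k c} → oppositeK k ≡ sgn c → k ≡ sgn (opposite c)
oppositeK-sgn {sgn ⊕} refl = refl
oppositeK-sgn {sgn ⊖} refl = refl

alternating-opposite : ∀ {ks} → Alternating ks → Alternating (map oppositeK ks)
alternating-opposite a = Linkedₚ.map⁺ (Linked.map (λ p c e e′ → p (opposite c) (oppositeK-sgn e) (oppositeK-sgn e′)) a)

-- Stated for the last kind alone and not for the list, unlike `HeadNot`, so that it can serve as
-- the parameter `L` of `count-detach`, which compares a missing last kind with ⊕.
LastNot : Sign → Maybe Kind → Set
LastNot c m = m ≢ just (sgn c)

LastNot-opposite : ∀ c ks → LastNot c (last ks) → LastNot (opposite c) (last (map oppositeK ks))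
LastNot-opposite c ks h e with last ks in eq | trans (sym (last-map oppositeK ks)) e
... | just k | e′ = h (cong just (trans (oppositeK-sgn (just-injective e′)) (cong sgn (opposite-involutive c))))

parent : Maybe Kind → ParentKind
parent nothing = isRoot
parent (just (sgn ⊕)) = par⊕
parent (just (sgn ⊖)) = par⊖
parent (just prm) = parP

replaceable⊕⇔ : ∀ m → (¬ parent m ≡ par⊕) ⇔ LastNot ⊕ m
replaceable⊕⇔ nothing = mk⇔ (λ _ ()) (λ _ ())
replaceable⊕⇔ (just (sgn ⊕)) = mk⇔ (λ p _ → p refl) (λ p _ → p refl)
replaceable⊕⇔ (just (sgn ⊖)) = mk⇔ (λ _ ()) (λ _ ())
replaceable⊕⇔ (just prm) = mk⇔ (λ _ ()) (λ _ ())

replaceable⊖⇔ : ∀ m → (¬ parent m ≡ par⊖) ⇔ LastNot ⊖ m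
replaceable⊖⇔ nothing = mk⇔ (λ _ ()) (λ _ ())
replaceable⊖⇔ (just (sgn ⊕)) = mk⇔ (λ _ ()) (λ _ ())
replaceable⊖⇔ (just (sgn ⊖)) = mk⇔ (λ p _ → p refl) (λ p _ → p refl)
replaceable⊖⇔ (just prm) = mk⇔ (λ _ ()) (λ _ ())

¬hasBlossom⇒¬isBlossom : ∀ t → hasBlossom t ≡ false → isBlossom t ≡ false
¬hasBlossom⇒¬isBlossom (leaf _) p = refl
¬hasBlossom⇒¬isBlossom (node⊕ _) p = refl
¬hasBlossom⇒¬isBlossom (node⊖ _) p = refl
¬hasBlossom⇒¬isBlossom (nodeP _ _ _) p = refl

¬hasBlossomAsChildL : ∀ ts → hasBlossomL ts ≡ false → hasBlossomAsChildL ts ≡ false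
¬hasBlossomAsChildL [] p = refl
¬hasBlossomAsChildL (t ∷ ts) p with hasBlossom t in eq
... | false rewrite ¬hasBlossom⇒¬isBlossom t eq = ¬hasBlossomAsChildL ts p

¬hasBlossomAsChildV : ∀ {k} (ts : Vec Tree k) → hasBlossomV ts ≡ false → hasBlossomAsChildV ts ≡ false
¬hasBlossomAsChildV [] p = refl
¬hasBlossomAsChildV (t ∷ ts) p with hasBlossom t in eq
... | false rewrite ¬hasBlossom⇒¬isBlossom t eq = ¬hasBlossomAsChildV ts p

isBlossom-toTree : ∀ s w → isBlossom (toTree (s ∷ w)) ≡ false
isBlossom-toTree (linear ⊕ t) w = refl
isBlossom-toTree (linear ⊖ t) w = refl
isBlossom-toTree (prime k H ts) w = refl

RootNot-toTree : ∀ c w → RootNot c (toTree w) ⇔ HeadNot c (kinds w)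
RootNot-toTree ⊕ [] = mk⇔ (λ _ ()) (λ _ → tt)
RootNot-toTree ⊖ [] = mk⇔ (λ _ ()) (λ _ → tt)
RootNot-toTree ⊕ (linear ⊕ t ∷ w) = mk⇔ (λ ()) (λ p → p refl)
RootNot-toTree ⊕ (linear ⊖ t ∷ w) = mk⇔ (λ _ ()) (λ _ → tt)
RootNot-toTree ⊖ (linear ⊕ t ∷ w) = mk⇔ (λ _ ()) (λ _ → tt)
RootNot-toTree ⊖ (linear ⊖ t ∷ w) = mk⇔ (λ ()) (λ p → p refl)
RootNot-toTree ⊕ (prime k H ts ∷ w) = mk⇔ (λ _ ()) (λ _ → tt)
RootNot-toTree ⊖ (prime k H ts ∷ w) = mk⇔ (λ _ ()) (λ _ → tt)

-- The empty word is excluded as well, so that prepending ⊕ to a word never changes this condition.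
NonemptyLastNot⊕ : Maybe Kind → Set
NonemptyLastNot⊕ m = m ≢ nothing × LastNot ⊕ m

module Enumeration (P : (k : ℕ) → Graph k → Set) (P⇒prime : ∀ k H → P k H → IsPrime k H)
  (P-relabel : ∀ k (H : Graph k) (σ : Permutation′ k) → P k H → P k (relabel σ H)) where

  open WellFormed P P⇒prime
  open ValidWords P P⇒prime P-relabel
  open Labelled using (OfSize)

  -- `parentKind` follows the first child that has a blossom. In `toTree` this is the first child of
  -- every node on the path, and its siblings have no blossom, so the search stops at the last step.
  parentKind-toTree : ∀ w → All ValidStep w → parentKind (toTree w) ≡ parent (last (kinds w))
  parentKind-toTree [] _ = refl
  parentKind-toTree (linear ⊕ t ∷ []) _ = refl
  parentKind-toTree (linear ⊖ t ∷ []) _ = refl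
  parentKind-toTree (prime k H ts ∷ []) _ = refl
  parentKind-toTree (linear ⊕ t ∷ w@(s ∷ w′)) (p ∷ v)
    rewrite isBlossom-toTree s w′ | hasBlossom-toTree w
      | ¬hasBlossomAsChildL (split ⊕ t) (All⇒hasBlossomL (All.map (λ {u} → WF⇒¬hasBlossom u ∘ proj₁) (proj₂ (proj₂ (WF-split ⊕ p)))))
    = parentKind-toTree w v
  parentKind-toTree (linear ⊖ t ∷ w@(s ∷ w′)) (p ∷ v)
    rewrite isBlossom-toTree s w′ | hasBlossom-toTree w
      | ¬hasBlossomAsChildL (split ⊖ t) (All⇒hasBlossomL (All.map (λ {u} → WF⇒¬hasBlossom u ∘ proj₁) (proj₂ (proj₂ (WF-split ⊖ p)))))
    = parentKind-toTree w v
  parentKind-toTree (prime k H ts ∷ w@(s ∷ w′)) ((_ , _ , p) ∷ v)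
    rewrite isBlossom-toTree s w′ | hasBlossom-toTree w | ¬hasBlossomAsChildV ts (¬hasBlossomV ts p)
    = parentKind-toTree w v

  validStep-rename : ∀ f s → Monotone f → InjectiveOn (leavesS s) f → ValidStep s → ValidStep (renameS f s)
  validStep-rename f (linear c t) mono inj v = WF-rename f t mono inj v
  validStep-rename f (prime k H ts) mono inj (p , s , w) = p , SortedV-rename f ts mono inj s w , WFV-rename f ts mono inj w

  validSteps-rename : ∀ f w → Monotone f → InjectiveOn (leavesW w) f → All ValidStep w → All ValidStep (renameW f w)
  validSteps-rename f [] mono inj [] = []
  validSteps-rename f (s ∷ w) mono inj (p ∷ v) =
    validStep-rename f s mono (λ i∈ j∈ → inj (∈-++⁺ʳ (leavesW w) i∈) (∈-++⁺ʳ (leavesW w) j∈)) p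
    ∷ validSteps-rename f w mono (λ i∈ j∈ → inj (∈-++⁺ˡ i∈) (∈-++⁺ˡ j∈)) v

  WordsWith : (List Kind → Set) → Labelled
  WordsWith K = record
    { Carrier        = Word
    ; labels         = leavesW
    ; rename         = renameW
    ; Valid          = λ w → ValidWord w × K (kinds w)
    ; labels-rename  = leavesW-rename
    ; rename-inverse = renameW-inverse
    ; rename-valid   = λ { f w mono inj ((a , v) , k) →
        (subst Alternating (sym (kinds-rename f w)) a , validSteps-rename f w mono inj v) , subst K (sym (kinds-rename f w)) k }
    }

  ValidMaybe : Maybe Tree → Set
  ValidMaybe nothing = ⊤
  ValidMaybe (just t) = WF P t

  leavesM : Maybe Tree → List ℕ
  leavesM nothing = []
  leavesM (just t) = leaves t

  -- The class with generating series 1 + T: `nothing` stands for the absence of a leading ⊕-step.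
  MaybeTrees : Labelled
  MaybeTrees = record
    { Carrier        = Maybe Tree
    ; labels         = leavesM
    ; rename         = λ f → Maybe.map (renameT f)
    ; Valid          = ValidMaybe
    ; labels-rename  = λ { f nothing → refl ; f (just t) → leaves-rename f t }
    ; rename-inverse = λ { f g nothing p → refl ; f g (just t) p → cong just (renameT-inverse f g t p) }
    ; rename-valid   = λ { f nothing mono inj v → tt ; f (just t) mono inj v → WF-rename f t mono inj v }
    }

  count-MaybeTrees : ∀ {c : ℕ → ℕ} → (∀ n → Count (IsTree P n) (c n)) → ∀ n → Count (OfSize MaybeTrees n) (unitCount n ℕ.+ c n)
  count-MaybeTrees {c} count n = count-⊎ {A = λ m → m ≡ nothing × n ≡ 0} {B = IsJustTree}
    (λ { nothing _ () ; (just t) (() , _) _ })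
    (λ { _ (refl , refl) → tt , ↭-refl })
    (λ { (just t) p → p })
    (λ { nothing (_ , p) → inj₁ (refl , empty n p) ; (just t) p → inj₂ p })
    (count-nothing n)
    (count-transfer (λ t m → just t ≡ m) (λ {t} p → just t , p , refl) (λ { {just t} p → t , p , refl })
      (λ { _ _ refl refl → refl }) (λ { _ _ _ refl refl → refl }) (count n))
    where
    IsJustTree : Maybe Tree → Set
    IsJustTree nothing = ⊥
    IsJustTree (just t) = IsTree P n t
    empty : ∀ n → [] ↭ upTo n → n ≡ 0
    empty zero _ = refl
    empty (suc n) p with ↭-empty-inv (↭-sym p)
    ... | ()
    count-nothing : ∀ n → Count {Maybe Tree} (λ m → m ≡ nothing × n ≡ 0) (unitCount n)
    count-nothing zero = count-resp-⇔ (λ _ → mk⇔ (_, refl) proj₁) (count-≡ nothing)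
    count-nothing (suc n) = count-⊥ λ { _ (_ , ()) }

  HeadNot⊕∧ : (Maybe Kind → Set) → List Kind → Set
  HeadNot⊕∧ L ks = HeadNot ⊕ ks × L (last ks)

  -- A ⊕-step in front of the word is detached together with its operands, which amount to an arbitrary tree.
  count-detach : ∀ {L} {c e : ℕ → ℕ} → L nothing ⇔ L (just (sgn ⊕)) →
    (∀ n → Count (OfSize (WordsWith (HeadNot⊕∧ L)) n) (c n)) → (∀ n → Count (OfSize MaybeTrees n) (e n)) →
    ∀ n → Count (OfSize (WordsWith (L ∘ last)) n) (binomialConv c e n)
  count-detach {L} L⇔ cw ce n = count-transfer {A = Pair} {B = Whole} (λ z w → attach z ≡ w)
    (λ {z} → total {z}) (λ {w} → surj {w}) (λ {z} {z′} → inj {z} {z′}) (λ { _ _ _ refl refl → refl })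
    (count-pairs (WordsWith (HeadNot⊕∧ L)) MaybeTrees cw ce n)
    where
    attach : Word × Maybe Tree → Word
    attach (w , nothing) = w
    attach (w , just t) = linear ⊕ t ∷ w

    Pair : Word × Maybe Tree → Set
    Pair = PairOfSize (WordsWith (HeadNot⊕∧ L)) MaybeTrees n
    Whole : Word → Set
    Whole = OfSize (WordsWith (L ∘ last)) n

    -- Prepending ⊕ changes the last kind only for the empty word, from none to ⊕; `L⇔` covers
    -- exactly this case.
    last⁺ : ∀ ks → L (last ks) → L (last (sgn ⊕ ∷ ks))
    last⁺ [] = Equivalence.to L⇔
    last⁺ (k ∷ ks) = id
    last⁻ : ∀ ks → L (last (sgn ⊕ ∷ ks)) → L (last ks)
    last⁻ [] = Equivalence.from L⇔
    last⁻ (k ∷ ks) = id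

    total : ∀ {z} → Pair z → ∃ λ w → Whole w × attach z ≡ w
    total {w , nothing} (((v , h , l) , _) , p) = w , ((v , l) , subst (_↭ upTo n) (++-identityʳ (leavesW w)) p) , refl
    total {w , just t} ((((a , v) , h , l) , wt) , p) = linear ⊕ t ∷ w ,
      (((alternating-∷ (λ { _ refl → h }) a , wt ∷ v) , last⁺ (kinds w) l) , p) , refl

    surj : ∀ {w} → Whole w → ∃ λ z → Pair z × attach z ≡ w
    surj {linear ⊕ t ∷ w} (((a , wt ∷ v) , l) , p) = (w , just t) ,
      ((((Linked.tail a , v) , alternating-head a ⊕ refl , last⁻ (kinds w) l) , wt) , p) , refl
    surj {[]} ((v , l) , p) = ([] , nothing) , (((v , (λ ()) , l) , tt) , p) , refl
    surj {linear ⊖ t ∷ w} ((v , l) , p) = (linear ⊖ t ∷ w , nothing) ,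
      (((v , (λ ()) , l) , tt) , subst (_↭ upTo n) (sym (++-identityʳ _)) p) , refl
    surj {prime k H ts ∷ w} ((v , l) , p) = (prime k H ts ∷ w , nothing) ,
      (((v , (λ ()) , l) , tt) , subst (_↭ upTo n) (sym (++-identityʳ _)) p) , refl

    inj : ∀ {z z′ w} → Pair z → Pair z′ → attach z ≡ w → attach z′ ≡ w → z ≡ z′
    inj {w , nothing} {_ , nothing} _ _ refl refl = refl
    -- A word left as it is does not start with ⊕, so it never coincides with one that received a
    -- ⊕-step.
    inj {w , nothing} {w′ , just t} (((_ , h , _) , _) , _) _ refl refl = ⊥-elim (h refl)
    inj {w , just t} {w′ , nothing} _ (((_ , h , _) , _) , _) refl refl = ⊥-elim (h refl)
    inj {w , just t} {w′ , just t′} _ _ refl refl = refl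

  count-reverse : ∀ {n c} → Count (OfSize (WordsWith (HeadNot ⊕)) n) c → Count (OfSize (WordsWith (LastNot ⊕ ∘ last)) n) c
  count-reverse {n} = count-transfer (λ w w′ → reverse w ≡ w′)
    (λ {w} (((a , v) , h) , p) → reverse w , ((valid-reverse w (a , v) ,
      subst (_≢ just (sgn ⊕)) (trans (sym (last-reverse (kinds w))) (cong last (sym (reverse-map kind w)))) h) , size w p) , refl)
    (λ {w} (((a , v) , h) , p) → reverse w , ((valid-reverse w (a , v) ,
      subst (_≢ just (sgn ⊕)) (trans (sym (head-reverse (kinds w))) (cong head (sym (reverse-map kind w)))) h) , size w p) ,
      reverse-involutive w)
    (λ _ _ e e′ → reverse-injective (trans e (sym e′)))
    (λ { _ _ _ refl refl → refl })
    where
    valid-reverse : ∀ w → ValidWord w → ValidWord (reverse w)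
    valid-reverse w (a , v) = subst Alternating (sym (reverse-map kind w)) (alternating-reverse a) , All-resp-↭ (↭-sym (↭-reverse w)) v
    size : ∀ w → leavesW w ↭ upTo n → leavesW (reverse w) ↭ upTo n
    size w p = ↭-trans (leavesW-↭ (↭-reverse w)) p

  -- `ValidStep (linear c t)` does not mention `c`, so the signs along the path can change while
  -- every hanging tree, with its own signs, stays the same.
  count-opposite : ∀ {n c} → Count (OfSize (WordsWith (LastNot ⊕ ∘ last)) n) c → Count (OfSize (WordsWith (LastNot ⊖ ∘ last)) n) c
  count-opposite {n} = count-transfer (λ w w′ → oppositeW w ≡ w′)
    (λ {w} p → oppositeW w , opposite-ofSize ⊕ w p , refl)
    (λ {w} p → oppositeW w , opposite-ofSize ⊖ w p , oppositeW-involutive w)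
    (λ {w} {w′} _ _ e e′ → trans (sym (oppositeW-involutive w))
      (trans (cong oppositeW (trans e (sym e′))) (oppositeW-involutive w′)))
    (λ { _ _ _ refl refl → refl })
    where
    steps : ∀ {w} → All ValidStep w → All ValidStep (oppositeW w)
    steps [] = []
    steps {linear c t ∷ w} (p ∷ v) = p ∷ steps v
    steps {prime k H ts ∷ w} (p ∷ v) = p ∷ steps v
    opposite-ofSize : ∀ c w → OfSize (WordsWith (LastNot c ∘ last)) n w → OfSize (WordsWith (LastNot (opposite c) ∘ last)) n (oppositeW w)
    opposite-ofSize c w (((a , v) , l) , p) =
      ((subst Alternating (sym (kinds-opposite w)) (alternating-opposite a) , steps v) ,
       subst (λ ks → LastNot (opposite c) (last ks)) (sym (kinds-opposite w)) (LastNot-opposite c (kinds w) l)) ,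
      subst (_↭ upTo n) (sym (leavesW-opposite w)) p

  leavesS-≢[] : ∀ s → ValidStep s → leavesS s ≢ []
  leavesS-≢[] (linear c t) v e with WF⇒NonEmpty t v
  ... | x , xs , e′ with trans (sym e) e′
  ... | ()
  leavesS-≢[] (prime k H ts) (p , s , w) e with P⇒prime (suc k) H p
  leavesS-≢[] (prime (suc k) H (t ∷ ts)) (_ , _ , w , _) e | _ with WF⇒NonEmpty t w
  ... | x , xs , e′ with trans (sym (cong (_++ leavesV ts) e′)) e
  ... | ()
  -- A prime step without hanging trees would have a decoration on one vertex, but prime graphs have
  -- at least three.
  leavesS-≢[] (prime zero H []) _ _ | s≤s () , _

  leavesW-[] : ∀ w → All ValidStep w → leavesW w ≡ [] → w ≡ []
  leavesW-[] [] _ _ = refl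
  leavesW-[] (s ∷ w) (p ∷ v) e = ⊥-elim (leavesS-≢[] s p (Listₚ.++-conicalʳ (leavesW w) (leavesS s) e))

  size-0 : ∀ K {w} → OfSize (WordsWith K) 0 w → w ≡ []
  size-0 K {w} (((a , v) , _) , p) = leavesW-[] w v (↭-empty-inv p)

  -- Every valid step carries a leaf, so the empty word is the only one of size 0, and dropping it
  -- changes the count at n = 0 alone, from 1 to 0.
  count-nonempty : ∀ {c} n → Count (OfSize (WordsWith (LastNot ⊕ ∘ last)) n) c →
    ∃ λ d → Count (OfSize (WordsWith (NonemptyLastNot⊕ ∘ last)) n) d × c ≡ unitCount n ℕ.+ d
  count-nonempty {c} zero count = 0 , count-⊥ absent ,
    count-unique count (count-resp-⇔ (λ w → mk⇔ (λ { refl → ((([] , []) , λ ()) , ↭-refl) }) (size-0 (LastNot ⊕ ∘ last))) (count-≡ []))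
    where
    absent : ∀ w → ¬ OfSize (WordsWith (NonemptyLastNot⊕ ∘ last)) 0 w
    absent w p with size-0 (NonemptyLastNot⊕ ∘ last) p
    ... | refl = proj₁ (proj₂ (proj₁ p)) refl
  count-nonempty {c} (suc n) count = c , count-resp-⇔ (λ w → mk⇔ (to w) (λ ((v , _ , l) , p) → (v , l) , p)) count , refl
    where
    to : ∀ w → OfSize (WordsWith (LastNot ⊕ ∘ last)) (suc n) w → OfSize (WordsWith (NonemptyLastNot⊕ ∘ last)) (suc n) w
    to [] (_ , p) with ↭-empty-inv (↭-sym p)
    ... | ()
    to (s ∷ w) ((v , l) , p) = (v , last-∷-≢nothing (kind s) (kinds w) , l) , p

  upTo-last : ∀ n → upTo (suc n) ↭ n ∷ upTo n
  upTo-last n = ↭-trans (upTo-unskip ℕₚ.≤-refl) (↭-reflexive (cong (n ∷_) (trans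
    (Listₚ.map-cong-local (All.tabulate (λ i∈ → unskip-< (∈-upTo⁻ i∈)))) (Listₚ.map-id (upTo n)))))
    where
    unskip-< : ∀ {m i} → i < m → unskip m i ≡ i
    unskip-< {suc m} {zero} _ = refl
    unskip-< {suc m} {suc i} (s≤s p) = cong suc (unskip-< p)

  -- All labels lie below `n`, where `skip n` is the identity: blossoming at the largest leaf leaves
  -- the other labels as they are.
  renameW-skip : ∀ n w → leavesW w ↭ upTo n → renameW (skip n) w ≡ w
  renameW-skip n w p = renameW-fixed (skip n) w (λ i∈ → skip-< (∈-upTo⁻ (∈-resp-↭ p i∈)))

  unique-leaves : ∀ {n t} → IsTree P n t → Unique (leaves t)
  unique-leaves {n} (_ , p) = Unique-resp-↭ (↭-sym p) (Uniqueₚ.upTo⁺ n)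

  Words : (List Kind → Set) → ℕ → Word → Set
  Words K = OfSize (WordsWith K)

  cut-ofSize : ∀ {n t w} → IsTree P (suc n) t → Cut n t w → ValidWord w × leavesW w ↭ upTo n
  cut-ofSize {n} (wf , p) cut = proj₁ (cut-valid wf cut) , drop-∷ (↭-trans (↭-sym (cut-leaves cut)) (↭-trans p (upTo-last n)))

  blossomAt-last : ∀ {n t w} → IsTree P (suc n) t → Cut n t w → blossomAt n t ≡ toTree w
  blossomAt-last {n} {t} {w} it cut = trans (blossomAt-cut (proj₁ it) (unique-leaves it) cut)
    (cong toTree (renameW-skip n w (proj₂ (cut-ofSize it cut))))

  graft-last : ∀ {n w} → ValidWord w → leavesW w ↭ upTo n →
    ∃ λ t → IsTree P (suc n) t × Cut n t w × (∀ c → HeadNot c (kinds w) → RootNot c t)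
  graft-last {n} {w} v p with graft {n} w v (Unique-resp-↭ (↭-trans (upTo-last n) (↭-prep n (↭-sym p))) (Uniqueₚ.upTo⁺ (suc n)))
  ... | t , wf , cut , r = t , (wf , ↭-trans (cut-leaves cut) (↭-trans (↭-prep n p) (↭-sym (upTo-last n)))) , cut , r

  -- Up to the factorial, coefficient n of a derivative counts trees with n + 1 leaves; cutting at
  -- the largest leaf turns them into words of size n. The two implications translate a condition on
  -- the root into one on the first step.
  count-cut : ∀ (Q : Tree → Set) (K : List Kind → Set) →
    (∀ {t ks} → (∀ c → RootNot c t → HeadNot c ks) → Q t → K ks) →
    (∀ {t ks} → (∀ c → HeadNot c ks → RootNot c t) → K ks → Q t) →
    ∀ {n c} → Count (λ t → IsTree P (suc n) t × Q t) c → Count (Words K n) c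
  count-cut Q K to from {n} = count-transfer (Cut n) total surj
    (λ (it , _) (it′ , _) → cut-injective (proj₁ it) (proj₁ it′))
    -- Two words cut from the same tree give the same blossomed tree, and `toTree` is injective on
    -- valid words.
    (λ { (it , _) (((_ , v) , _) , p) (((_ , v′) , _) , p′) cut cut′ →
      toTree-injective v v′ (trans (sym (blossomAt-last it cut)) (blossomAt-last it cut′)) })
    where
    total : ∀ {t} → IsTree P (suc n) t × Q t → ∃ λ w → Words K n w × Cut n t w
    total {t} (it , q) with locate t (∈-resp-↭ (↭-sym (proj₂ it)) (∈-upTo⁺ (ℕₚ.n<1+n n)))
    ... | w , cut with cut-ofSize it cut
    ... | v , p = w , ((v , to (proj₂ (cut-valid (proj₁ it) cut)) q) , p) , cut
    surj : ∀ {w} → Words K n w → ∃ λ t → (IsTree P (suc n) t × Q t) × Cut n t w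
    surj ((v , k) , p) with graft-last v p
    ... | t , it , cut , r = t , (it , from r k) , cut

  blossomed⇒word : ∀ {n t} → Blossomed P n t → ∃ λ w → (ValidWord w × leavesW w ↭ upTo n) × toTree w ≡ t
  blossomed⇒word {n} (t₀ , m , it , m<1+n , refl) with locate t₀ (∈-resp-↭ (↭-sym (proj₂ it)) (∈-upTo⁺ m<1+n))
  ... | w , cut with cut-valid (proj₁ it) cut
  ... | (a , v) , _ = renameW (skip m) w ,
    ((subst Alternating (sym (kinds-rename (skip m) w)) a ,
      validSteps-rename (skip m) w (skip-mono m) (λ i∈ j∈ → skip-injective m (avoids i∈) (avoids j∈)) v) ,
     subst (_↭ upTo n) (sym (leavesW-rename (skip m) w)) (skip-upTo (ℕₚ.≤-pred m<1+n) (↭-trans (↭-sym (cut-leaves cut)) (proj₂ it)))) ,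
    sym (blossomAt-cut (proj₁ it) (unique-leaves it) cut)
    where
    avoids : ∀ {i} → i ∈ leavesW w → i ≢ m
    avoids i∈ refl = Uniqueₚ.Unique[x∷xs]⇒x∉xs (Unique-resp-↭ (cut-leaves cut) (unique-leaves it)) i∈

  -- Blossoming at the largest leaf already reaches every word. Together with `blossomed⇒word`, this
  -- removes the freedom of the leaf in `Blossomed`.
  word⇒blossomed : ∀ {n w} → ValidWord w → leavesW w ↭ upTo n → Blossomed P n (toTree w)
  word⇒blossomed {n} v p with graft-last v p
  ... | t , it , cut , _ = t , n , it , ℕₚ.n<1+n n , blossomAt-last it cut

  count-blossomed : ∀ (Q : Tree → Set) (K : List Kind → Set) →
    (∀ w → All ValidStep w → Q (toTree w) ⇔ K (kinds w)) →
    ∀ {n c} → Count (λ t → Blossomed P n t × Q t) c → Count (Words K n) c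
  count-blossomed Q K Q⇔K {n} = count-transfer (λ t w → toTree w ≡ t) total surj
    (λ { _ _ refl refl → refl })
    (λ { _ (((_ , v) , _) , _) (((_ , v′) , _) , _) e e′ → toTree-injective v v′ (trans e (sym e′)) })
    where
    total : ∀ {t} → Blossomed P n t × Q t → ∃ λ w → Words K n w × toTree w ≡ t
    total (b , q) with blossomed⇒word b
    ... | w , (v , p) , refl = w , ((v , Equivalence.to (Q⇔K w (proj₂ v)) q) , p) , refl
    surj : ∀ {w} → Words K n w → ∃ λ t → (Blossomed P n t × Q t) × toTree w ≡ t
    surj {w} ((v , k) , p) = toTree w , (word⇒blossomed v p , Equivalence.from (Q⇔K w (proj₂ v)) k) , refl

  ⊕-replaceable⇔ : ∀ w → All ValidStep w → ⊕-replaceable (toTree w) ⇔ LastNot ⊕ (last (kinds w))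
  ⊕-replaceable⇔ w v = subst (λ k → (¬ k ≡ par⊕) ⇔ LastNot ⊕ (last (kinds w))) (sym (parentKind-toTree w v)) (replaceable⊕⇔ (last (kinds w)))

  ⊖-replaceable⇔ : ∀ w → All ValidStep w → ⊖-replaceable (toTree w) ⇔ LastNot ⊖ (last (kinds w))
  ⊖-replaceable⇔ w v = subst (λ k → (¬ k ≡ par⊖) ⇔ LastNot ⊖ (last (kinds w))) (sym (parentKind-toTree w v)) (replaceable⊖⇔ (last (kinds w)))

  open Classes P

  count-ClT : ∀ {n c} → Count (ClT (suc n)) c → Count (Words (λ _ → ⊤) n) c
  count-ClT = count-cut (λ _ → ⊤) (λ _ → ⊤) (λ _ _ → tt) (λ _ _ → tt) ∘ count-resp-⇔ (λ _ → mk⇔ (_, tt) proj₁)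

  count-ClTnot⊕ : ∀ {n c} → Count (ClTnot⊕ (suc n)) c → Count (Words (HeadNot ⊕) n) c
  count-ClTnot⊕ = count-cut RootNot⊕ (HeadNot ⊕) (λ h → h ⊕) (λ h → h ⊕)

  count-ClT⊕ : ∀ {n c} → Count (ClT⊕ n) c → Count (Words (LastNot ⊕ ∘ last) n) c
  count-ClT⊕ = count-blossomed ⊕-replaceable (LastNot ⊕ ∘ last) ⊕-replaceable⇔

  count-ClT⊖not⊕ : ∀ {n c} → Count (ClT⊖not⊕ n) c → Count (Words (HeadNot⊕∧ (LastNot ⊖)) n) c
  count-ClT⊖not⊕ = count-blossomed (λ t → RootNot⊕ t × ⊖-replaceable t) (HeadNot⊕∧ (LastNot ⊖)) λ w v → mk⇔
    (λ (r , q) → Equivalence.to (RootNot-toTree ⊕ w) r , Equivalence.to (⊖-replaceable⇔ w v) q)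
    (λ (r , q) → Equivalence.from (RootNot-toTree ⊕ w) r , Equivalence.from (⊖-replaceable⇔ w v) q)

  last-nothing : ∀ w → last (kinds w) ≡ nothing ⇔ toTree w ≡ blossom
  last-nothing [] = mk⇔ (λ _ → refl) (λ _ → refl)
  last-nothing (s ∷ w) = mk⇔ (λ e → ⊥-elim (last-∷-≢nothing (kind s) (kinds w) e))
    (λ e → ⊥-elim (true≢false (trans (cong isBlossom (sym e)) (isBlossom-toTree s w))))
    where
    true≢false : true ≢ false
    true≢false ()

  count-ClT⊕not⊕ : ∀ {n c} → Count (ClT⊕not⊕ n) c → Count (Words (HeadNot⊕∧ NonemptyLastNot⊕) n) c
  count-ClT⊕not⊕ = count-blossomed (λ t → RootNot⊕ t × ⊕-replaceable t × t ≢ blossom) (HeadNot⊕∧ NonemptyLastNot⊕) λ w v → mk⇔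
    (λ (r , q , b) → Equivalence.to (RootNot-toTree ⊕ w) r , b ∘ Equivalence.to (last-nothing w) , Equivalence.to (⊕-replaceable⇔ w v) q)
    (λ (r , b , q) → Equivalence.from (RootNot-toTree ⊕ w) r , Equivalence.from (⊕-replaceable⇔ w v) q , b ∘ Equivalence.from (last-nothing w))

  size-0-tree : ∀ {t} → ¬ IsTree P 0 t
  size-0-tree {t} (wf , p) with WF⇒NonEmpty t wf | ↭-empty-inv p
  ... | x , xs , e | e′ with trans (sym e) e′
  ... | ()

-- From bijections to the three identities

cancel-expₛ : ∀ {B C E X : Series} → (E *ₛ X) ≈ oneₛ → B ≈ (C *ₛ E) → C ≈ (B *ₛ X)
cancel-expₛ {B} {C} {E} {X} EX B≈CE n = begin
  C n                  ≡⟨ sym (*ₛ-identityʳ C n) ⟩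
  (C *ₛ oneₛ) n        ≡⟨ *ₛ-cong {a = C} (λ _ → refl) (≈-sym EX) n ⟩
  (C *ₛ (E *ₛ X)) n    ≡⟨ sym (*ₛ-assoc C E X n) ⟩
  ((C *ₛ E) *ₛ X) n    ≡⟨ *ₛ-cong {b = X} (≈-sym B≈CE) (λ _ → refl) n ⟩
  (B *ₛ X) n ∎
  where open ≡-Reasoning

egf-cong : ∀ {c d} → (∀ n → c n ≡ d n) → egf c ≈ egf d
egf-cong p n = cong (λ z → egf (λ _ → z) n) (p n)

egf-product : ∀ {b c e} → (∀ n → b n ≡ binomialConv c e n) → egf b ≈ (egf c *ₛ egf e)
egf-product {c = c} {e} p = ≈-trans (egf-cong p) (egf-binomialConv c e)

theorem4p10 : (P : (k : ℕ) → Graph k → Set) → IsPrimeFamily P →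
    (cT cTnot⊕ cT⊕ cT⊖not⊕ cT⊕not⊕ : ℕ → ℕ) →
    (∀ n → HasCount (Classes.ClT P n) (cT n)) →
    (∀ n → HasCount (Classes.ClTnot⊕ P n) (cTnot⊕ n)) →
    (∀ n → HasCount (Classes.ClT⊕ P n) (cT⊕ n)) →
    (∀ n → HasCount (Classes.ClT⊖not⊕ P n) (cT⊖not⊕ n)) →
    (∀ n → HasCount (Classes.ClT⊕not⊕ P n) (cT⊕not⊕ n)) →
    (∀ n → egf cT⊕ n ≡ (deriv (egf cT) *ₛ expₛ (-ₛ egf cTnot⊕)) n)
    × (∀ n → egf cT⊖not⊕ n ≡ (egf cT⊕ *ₛ expₛ (-ₛ egf cTnot⊕)) n)
    × (∀ n → egf cT⊕not⊕ n ≡ ((egf cT⊕ -ₛ oneₛ) *ₛ expₛ (-ₛ egf cTnot⊕)) n)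
theorem4p10 P (P⇒prime , P-relabel) cT cTnot⊕ cT⊕ cT⊖not⊕ cT⊕not⊕ hT hTnot⊕ hT⊕ hT⊖not⊕ hT⊕not⊕ =
  ≈-trans T⊕≈Tnot⊕′ (cancel-expₛ inverse T′) , cancel-expₛ inverse T⊕≈ , cancel-expₛ inverse T⊕-1≈
  where
  open Enumeration P P⇒prime P-relabel

  -- `e` has generating series 1 + T, and `d` counts the nonempty words not ending with ⊕.
  e d : ℕ → ℕ
  e n = unitCount n ℕ.+ cT n
  d n = proj₁ (count-nonempty n (count-ClT⊕ (fromHasCount (hT⊕ n))))

  WordCount : (List Kind → Set) → (ℕ → ℕ) → Set
  WordCount K c = ∀ n → Count (Words K n) (c n)

  all : WordCount (λ _ → ⊤) (cT ∘ suc)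
  all n = count-ClT (fromHasCount (hT (suc n)))

  headNot⊕ : WordCount (HeadNot ⊕) (cTnot⊕ ∘ suc)
  headNot⊕ n = count-ClTnot⊕ (fromHasCount (hTnot⊕ (suc n)))

  lastNot⊕ : WordCount (LastNot ⊕ ∘ last) cT⊕
  lastNot⊕ n = count-ClT⊕ (fromHasCount (hT⊕ n))

  detach : ∀ {L} {b c : ℕ → ℕ} → L nothing ⇔ L (just (sgn ⊕)) →
    WordCount (L ∘ last) b → WordCount (HeadNot⊕∧ L) c → egf b ≈ (egf c *ₛ egf e)
  detach {L} L⇔ whole rest = egf-product λ n → count-unique (whole n)
    (count-detach {L} L⇔ rest (count-MaybeTrees (fromHasCount ∘ hT)) n)

  egf-e : egf e ≈ (oneₛ +ₛ egf cT)
  egf-e n = trans (egf-+ unitCount cT n) (cong (_+ℚ egf cT n) (egf-unitCount n))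

  empty : ∀ (A : Tree → Set) {c : ℕ → ℕ} → (∀ {t} → A t → IsTree P 0 t) → HasCount A (c 0) → egf c 0 ≡ 0ℚ
  empty A {c} A⇒ h = cong (λ z → egf (λ _ → z) 0)
    (count-unique (fromHasCount h) (count-⊥ λ _ → size-0-tree ∘ A⇒))

  T′ : deriv (egf cT) ≈ (deriv (egf cTnot⊕) *ₛ egf e)
  T′ = ≈-trans (deriv-egf cT) (≈-trans
    (detach {L = λ _ → ⊤} (mk⇔ _ _) all (λ n → count-resp-⇔
      (λ _ → mk⇔ (λ ((v , h) , p) → (v , h , _) , p) (λ ((v , h , _) , p) → (v , h) , p)) (headNot⊕ n)))
    (*ₛ-cong {b = egf e} (≈-sym (deriv-egf cTnot⊕)) (λ _ → refl)))

  -- Differentiating E = 1 + T kills the constant, so `T′` is the equation E' = T_not⊕' E asked for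
  -- by `*ₛ-expₛ-inverse`. The constant terms come from the absence of trees without leaves.
  inverse : (egf e *ₛ expₛ (-ₛ egf cTnot⊕)) ≈ oneₛ
  inverse = *ₛ-expₛ-inverse (egf e) (egf cTnot⊕)
    (trans (egf-e 0) (cong (1ℚ +ℚ_) (empty (Classes.ClT P 0) {cT} (λ p → p) (hT 0))))
    (empty (Classes.ClTnot⊕ P 0) {cTnot⊕} proj₁ (hTnot⊕ 0))
    (≈-trans (deriv-cong egf-e) (≈-trans (deriv-+ₛ oneₛ (egf cT)) (λ n →
      trans (cong (_+ℚ deriv (egf cT) n) (deriv-oneₛ n)) (trans (ℚₚ.+-identityˡ _) (T′ n)))))

  T⊕≈Tnot⊕′ : egf cT⊕ ≈ deriv (egf cTnot⊕)
  T⊕≈Tnot⊕′ = ≈-trans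
    (egf-cong λ n → count-unique (lastNot⊕ n) (count-reverse (headNot⊕ n)))
    (≈-sym (deriv-egf cTnot⊕))

  -- Detaching ⊕ needs a condition on the last kind that treats the empty word and a final ⊕ alike.
  -- `LastNot ⊖` does and `LastNot ⊕` does not, which is why the signs are exchanged first.
  T⊕≈ : egf cT⊕ ≈ (egf cT⊖not⊕ *ₛ egf e)
  T⊕≈ = detach {L = LastNot ⊖} (mk⇔ (λ _ ()) (λ _ ())) (λ n → count-opposite (lastNot⊕ n))
    (λ n → count-ClT⊖not⊕ (fromHasCount (hT⊖not⊕ n)))

  T⊕-1≈ : (egf cT⊕ -ₛ oneₛ) ≈ (egf cT⊕not⊕ *ₛ egf e)
  T⊕-1≈ n = begin
    egf cT⊕ n +ℚ -ℚ oneₛ n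
      ≡⟨ cong (_+ℚ -ℚ oneₛ n) (egf-cong {c = cT⊕} {d = λ n → unitCount n ℕ.+ d n}
           (λ n → proj₂ (proj₂ (count-nonempty n (lastNot⊕ n)))) n) ⟩
    egf (λ n → unitCount n ℕ.+ d n) n +ℚ -ℚ oneₛ n
      ≡⟨ cong (_+ℚ -ℚ oneₛ n) (trans (egf-+ unitCount d n) (cong (_+ℚ egf d n) (egf-unitCount n))) ⟩
    oneₛ n +ℚ egf d n +ℚ -ℚ oneₛ n
      ≡⟨ solve 2 (λ x y → x :+ y :+ :- x := y) refl (oneₛ n) (egf d n) ⟩
    egf d n
      -- Both sides of the required equivalence are false: the empty word is excluded, and so is a
      -- final ⊕.
      ≡⟨ detach {L = NonemptyLastNot⊕} (mk⇔ (λ (p , _) → ⊥-elim (p refl)) (λ (_ , p) → ⊥-elim (p refl)))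
           (λ n → proj₁ (proj₂ (count-nonempty n (lastNot⊕ n))))
           (λ n → count-ClT⊕not⊕ (fromHasCount (hT⊕not⊕ n))) n ⟩
    (egf cT⊕not⊕ *ₛ egf e) n ∎
    where open ≡-Reasoning; open ℚ-Solver
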